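{- The following hold. (a) If $w$ is a word in which no letter appears both at an odd index and at an even index, then $w$ is $d$-stackable for every positive integer $d$. (b) If $w$ is $d$-stackable and $k$ is a positive integer, then the word $w'$ obtained from $w$ by repeating each letter $k$ times consecutively (e.g. $\mathsf{AABC}$ becomes $\mathsf{AAAABBCC}$ for $k=2$) is $d$-stackable. (c) If $w$ is a word with at most four characters, then $w$ is $2$-stackable if and only if $w$ is not of the form $\mathsf{A}\mathsf{B}\mathsf{B}\mathsf{B}$ or $\mathsf{B}\mathsf{B}\mathsf{B}\mathsf{A}$ for some distinct letters $\mathsf A,\mathsf B$. (d) For every integer $\ell>3$, the word $\mathsf{A}\mathsf{B}^{\ell-1}$ (one $\mathsf A$ followed by $\ell-1$ copies of a distinct letter $\mathsf B$) is not $2$-stackable.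
   Context: A word is a finite string $w=w_0w_1\cdots w_{\ell-1}$ of letters from some alphabet; words are assumed to contain at least two distinct letters. A $d$-dimensional grid $\Gamma$ of shape $G=\prod_{i=1}^d\mathbb Z/n_i\mathbb Z$ ($n_i$ positive integers) is a map $\Gamma\colon G\to\Sigma$ to an alphabet; its size is $|G|$. An appearance of $w$ in $\Gamma$ is a pair $(p,\mathbf v)\in G\times(\{ -1,0,1\}^d\setminus\{\mathbf 0\})$ with $\Gamma(p+i\mathbf v)=w_i$ for all $0\le i<\ell$. The concentration $c_d(w,\Gamma)$ is the number of appearances divided by $|G|$, and $C_d(w)$ is the supremum of $c_d(w,\Gamma)$ over all $d$-dimensional grids. A word $w$ is called $d$-stackable if $C_d(w)=3^{d-1}C_1(w)$. -}

module Defs where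

open import Data.Bool using (Bool; true; false; _∧_; _∨_; if_then_else_)
open import Data.Nat as ℕ using (ℕ; zero; suc; _+_; _∸_; _^_; _≡ᵇ_; NonZero)
open import Data.Nat.Properties using (m*n≢0)
open import Data.Nat.DivMod using (_mod_)
open import Data.Fin using (Fin; toℕ)
open import Data.Vec using (Vec; []; _∷_)
open import Data.Nat.ListAction using (sum)
open import Data.List using (List; []; _∷_; [_]; map; concatMap; allFin; length; replicate)
open import Data.List.Membership.Propositional using (_∈_)
open import Data.Product using (_×_; _,_; ∃; ∃-syntax)
open import Data.Unit using (⊤; tt)
open import Data.Integer using (+_)
open import Data.Rational using (ℚ; _/_; _≤_) renaming (_*_ to _*ℚ_)
open import Relation.Binary.PropositionalEquality using (_≢_)
open import Function.Bundles using (_⇔_)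

-- Letters are natural numbers (any finite alphabet embeds in ℕ); a word is a list of letters.
Word : Set
Word = List ℕ

TwoLetters : Word → Set
TwoLetters w = ∃[ a ] ∃[ b ] (a ∈ w × b ∈ w × a ≢ b)

-- A shape ∏ ℤ/n_i is encoded by ms with n_i = suc m_i (so n_i ≥ 1).
-- A point of the grid: one coordinate in Fin n_i per dimension.
Pos : ∀ {d} → Vec ℕ d → Set
Pos [] = ⊤
Pos (m ∷ ms) = Fin (suc m) × Pos ms

allPos : ∀ {d} (ms : Vec ℕ d) → List (Pos ms)
allPos [] = [ tt ]
allPos (m ∷ ms) = concatMap (λ i → map (λ p → (i , p)) (allPos ms)) (allFin (suc m))

size : ∀ {d} → Vec ℕ d → ℕ
size [] = 1
size (m ∷ ms) = suc m ℕ.* size ms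

size-nz : ∀ {d} (ms : Vec ℕ d) → NonZero (size ms)
size-nz [] = _
size-nz (m ∷ ms) = m*n≢0 (suc m) (size ms) {{_}} {{size-nz ms}}

data Sign : Set where
  neg zer pos : Sign

allDirs : ∀ d → List (Vec Sign d)
allDirs zero = [ [] ]
allDirs (suc d) = concatMap (λ s → map (s ∷_) (allDirs d)) (neg ∷ zer ∷ pos ∷ [])

nonzero : ∀ {d} → Vec Sign d → Bool
nonzero [] = false
nonzero (zer ∷ v) = nonzero v
nonzero (neg ∷ v) = true
nonzero (pos ∷ v) = true

-- -1 is represented as n-1 = m modulo n = suc m.
signVal : ℕ → Sign → ℕ
signVal m neg = m
signVal m zer = 0
signVal m pos = 1

shift : ∀ {d} {ms : Vec ℕ d} → Pos ms → Vec Sign d → ℕ → Pos ms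
shift {ms = []} tt [] j = tt
shift {ms = m ∷ ms} (i , p) (s ∷ v) j = ((toℕ i + j ℕ.* signVal m s) mod suc m) , shift p v j

matchFrom : ∀ {d} {ms : Vec ℕ d} → (Pos ms → ℕ) → Pos ms → Vec Sign d → ℕ → Word → Bool
matchFrom Γ p v i [] = true
matchFrom Γ p v i (a ∷ w) = (Γ (shift p v i) ≡ᵇ a) ∧ matchFrom Γ p v (suc i) w

appearances : ∀ {d} (ms : Vec ℕ d) → (Pos ms → ℕ) → Word → ℕ
appearances {d} ms Γ w =
  sum (concatMap (λ p → map (λ v → if nonzero v ∧ matchFrom Γ p v 0 w then 1 else 0) (allDirs d)) (allPos ms))

conc : ∀ {d} (ms : Vec ℕ d) → (Pos ms → ℕ) → Word → ℚ
conc ms Γ w = _/_ (+ appearances ms Γ w) (size ms) {{size-nz ms}}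

-- q is an upper bound of { c_d(w,Γ) }, i.e. C_d(w) ≤ q.
UpperBound : ℕ → Word → ℚ → Set
UpperBound d w q = ∀ (ms : Vec ℕ d) (Γ : Pos ms → ℕ) → conc ms Γ w ≤ q

-- d-stackable: C_d(w) = 3^{d-1} C_1(w), expressed without reals as equality of suprema:
-- for every rational q, C_d(w) ≤ 3^{d-1} q  iff  C_1(w) ≤ q.
Stackable : ℕ → Word → Set
Stackable d w = ∀ (q : ℚ) → (UpperBound d w ((+ (3 ^ (d ∸ 1))) / 1 *ℚ q) ⇔ UpperBound 1 w q)

stretch : ℕ → Word → Word
stretch k w = concatMap (replicate k) w

{-# OPTIONS --safe #-}

-- One inequality, C_d(w) ≥ 3^{d-1} C_1(w), holds for every word (stack copies of a line); only the other is at stake.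
-- A bound on C_1(w) bounds the readings of w and of its reversal along every measure-preserving walk on a finite set,
-- since long stretches of the walk are one-dimensional grids.
--
-- (a) Colour letters by the parity of their indices. An appearance of w only uses edges of the grid with ends of
-- different colours. Apply the previous remark to the walk on these directed edges that turns back whenever the next
-- edge is monochromatic: appearances are bounded by C_1(w) times the number of bichromatic edges. That number is at
-- most 3^{d-1} |G|, because p ↦ Σ_v f(p + v) is a tensor power of I + S + S⁻¹, whose spectrum lies in [-1, 3].
--
-- (b) C_d(stretch k w) ≤ C_d(w) / k, because each appearance of the stretched word gives k appearances of w with step
-- k and these do not collide; and C_1(stretch k w) ≥ C_1(w) / k by lingering on each cell of a line.
--
-- (c) Writing X for any letter but B, 3 × 3 windows with suitable potentials give XXB ≤ 2 |G| and XXB + 2 XBX ≤ 6 |G|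
-- in the plane. Reversal, prefixes and identification of letters reduce all remaining words to these two bounds.
--
-- (d) C_1 = 2 / ℓ, while the grid with A at the zeros of 2 i + j modulo n, for n ≥ ℓ prime to 6, has concentration
-- 8 / n > 6 / ℓ; such n exists unless ℓ = 8, where a permutation grid is used.

module Submission where

open import Defs
open import Data.Nat using (ℕ; zero; suc; _∸_; _%_; _≤_; _<_)
open import Data.Fin using (Fin; toℕ)
open import Data.List using (List; []; _∷_; length; lookup; replicate)
open import Data.Product using (_×_; _,_; ∃-syntax)
open import Data.Sum using (_⊎_)
open import Relation.Nullary using (¬_)
open import Relation.Binary.PropositionalEquality using (_≡_; _≢_)
open import Function.Bundles using (_⇔_)

open import Algebra.Bundles using (CommutativeSemiring)
open import Data.Bool using (Bool; true; false; _∧_; _∨_; _xor_; not; if_then_else_; T)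
open import Data.Bool.Properties using (∧-assoc; ∧-comm; ∧-identityʳ; ∨-zeroʳ; xor-comm)
open import Data.Empty using (⊥; ⊥-elim)
import Data.Fin as Fin
open import Data.Fin.Patterns using (0F; 1F; 2F; 3F; 4F; 5F)
open import Data.Fin.Properties using (any?; toℕ-fromℕ<; toℕ-injective; toℕ<n)
open import Data.Integer as ℤ using (ℤ; +_; -_; -[1+_]; 0ℤ)
import Data.Integer.Properties as ℤ
import Data.Integer.Tactic.RingSolver as ℤ-Solver
open import Data.List using (_++_; [_]; map; concatMap; allFin; tabulate; upTo; applyUpTo; reverse; _ʳ++_)
open import Data.List.Membership.Propositional using (_∈_)
open import Data.List.Properties using (++-assoc; ++-identityʳ; concatMap-++; reverse-++; unfold-reverse; length-reverse; ∷-injectiveˡ; ∷-injectiveʳ)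
open import Data.List.Relation.Unary.Any using (here; there)
import Data.Nat as ℕ
import Data.Nat.Properties as ℕ
open import Data.Nat.Coprimality using (Coprime; coprime-divisor)
open import Data.Nat.Divisibility using (_∣_; ∣m+n∣m⇒∣n; m∣m*n; n∣m*n; ∣n⇒∣m*n; ∣1⇒≡1; >⇒∤; m%n≡0⇒n∣m; n∣m⇒m%n≡0)
open import Data.Nat.DivMod using (_mod_; _divMod_; module DivMod; [m+kn]%n≡m%n; [m+n]%n≡m%n; m<n⇒m%n≡m; m%n<n; m%n%n≡m%n; %-distribˡ-+; %-distribˡ-*)
open import Data.Nat.ListAction using (sum)
open import Data.Nat.Tactic.RingSolver using (solve-∀)
open import Data.Product using (∃; proj₁; proj₂)
open import Data.Rational as ℚ using (mkℚ; _/_; toℚᵘ)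
import Data.Rational.Properties as ℚ
open import Data.Rational.Unnormalised as ℚᵘ using (mkℚᵘ; *≤*; *≡*)
import Data.Rational.Unnormalised.Properties as ℚᵘ
open import Data.Sum using (inj₁; inj₂)
open import Data.Unit using (⊤; tt)
open import Data.Vec as Vec using (Vec; []; _∷_)
open import Function using (_∘_; id; it; mk⇔)
open import Function.Bundles using (Equivalence)
open import Level using (0ℓ)
open import Relation.Binary.PropositionalEquality as ≡ using ()
open import Relation.Nullary using (Dec; does; yes; no)
open import Relation.Nullary.Decidable using (_×-dec_; dec-true; dec-false)

-- Two obstacles shape the proof. First, suprema and eigenvalues are handled without real numbers. A
-- bound on C_d(w) is an inequality of naturals over all grids, and the spectral estimate is an
-- identity over the integers, 4 (I + S + S⁻¹) = 3 (I + S)(I + S⁻¹) - (I - S)(I - S⁻¹), where the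
-- two products add up to 4 I; the induction on the dimension then runs on sums and differences of
-- neighbouring slices.
--
-- Second, the sides of a grid may be short and may share factors with any number, so lines wrap
-- around early. Hence a walk is unrolled for k steps and closed to a cycle whose seam spoils a
-- number of readings independent of k; dilation by k, which need not be a bijection of the torus,
-- is averaged over all translates; and windows may overlap themselves.
--
-- The constants in (a) fit exactly. There are at most 2 · 3^{d-1} |G| directed bichromatic edges,
-- and every appearance counts twice on them: as a reading of w and, from its other end, as a
-- reading of the reversal.

advance : ∀ {m} → Fin (suc m) → ℕ → Fin (suc m)
advance {m} i a = (toℕ i ℕ.+ a) mod suc m

toℕ-mod : ∀ a m → toℕ (a mod suc m) ≡ a % suc m
toℕ-mod a m = toℕ-fromℕ< (m%n<n a (suc m))

mod-toℕ : ∀ {m} (i : Fin (suc m)) → toℕ i mod suc m ≡ i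
mod-toℕ {m} i = toℕ-injective (≡.trans (toℕ-mod (toℕ i) m) (m<n⇒m%n≡m (toℕ<n i)))

mod-cong : ∀ {m} a b → a % suc m ≡ b % suc m → a mod suc m ≡ b mod suc m
mod-cong {m} a b eq = toℕ-injective (≡.trans (toℕ-mod a m) (≡.trans eq (≡.sym (toℕ-mod b m))))

%-+-congˡ : ∀ a b m → (a % suc m ℕ.+ b) % suc m ≡ (a ℕ.+ b) % suc m
%-+-congˡ a b m = begin
  (a % suc m ℕ.+ b) % suc m                     ≡⟨ %-distribˡ-+ (a % suc m) b (suc m) ⟩
  (a % suc m % suc m ℕ.+ b % suc m) % suc m     ≡⟨ ≡.cong (λ x → (x ℕ.+ b % suc m) % suc m) (m%n%n≡m%n a (suc m)) ⟩
  (a % suc m ℕ.+ b % suc m) % suc m             ≡⟨ %-distribˡ-+ a b (suc m) ⟨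
  (a ℕ.+ b) % suc m                             ∎
  where open ≡.≡-Reasoning

advance-0 : ∀ {m} (i : Fin (suc m)) → advance i 0 ≡ i
advance-0 {m} i = ≡.trans (≡.cong (_mod suc m) (ℕ.+-identityʳ (toℕ i))) (mod-toℕ i)

advance-+ : ∀ {m} (i : Fin (suc m)) a b → advance (advance i a) b ≡ advance i (a ℕ.+ b)
advance-+ {m} i a b = mod-cong (toℕ (advance i a) ℕ.+ b) (toℕ i ℕ.+ (a ℕ.+ b)) (begin
  (toℕ (advance i a) ℕ.+ b) % suc m          ≡⟨ ≡.cong (λ x → (x ℕ.+ b) % suc m) (toℕ-mod (toℕ i ℕ.+ a) m) ⟩
  ((toℕ i ℕ.+ a) % suc m ℕ.+ b) % suc m      ≡⟨ %-+-congˡ (toℕ i ℕ.+ a) b m ⟩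
  (toℕ i ℕ.+ a ℕ.+ b) % suc m                ≡⟨ ≡.cong (_% suc m) (ℕ.+-assoc (toℕ i) a b) ⟩
  (toℕ i ℕ.+ (a ℕ.+ b)) % suc m              ∎)
  where open ≡.≡-Reasoning

advance-cong-% : ∀ {m} (i : Fin (suc m)) a b → a % suc m ≡ b % suc m → advance i a ≡ advance i b
advance-cong-% {m} i a b eq = mod-cong (toℕ i ℕ.+ a) (toℕ i ℕ.+ b) (begin
  (toℕ i ℕ.+ a) % suc m                      ≡⟨ %-distribˡ-+ (toℕ i) a (suc m) ⟩
  (toℕ i % suc m ℕ.+ a % suc m) % suc m      ≡⟨ ≡.cong (λ x → (toℕ i % suc m ℕ.+ x) % suc m) eq ⟩
  (toℕ i % suc m ℕ.+ b % suc m) % suc m      ≡⟨ %-distribˡ-+ (toℕ i) b (suc m) ⟨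
  (toℕ i ℕ.+ b) % suc m                      ∎)
  where open ≡.≡-Reasoning

advance-period : ∀ {m} (i : Fin (suc m)) k → advance i (k ℕ.* suc m) ≡ i
advance-period {m} i k = ≡.trans (advance-cong-% i (k ℕ.* suc m) 0 ([m+kn]%n≡m%n 0 k (suc m))) (advance-0 i)

infixl 6 _⊕_
_⊕_ : ∀ {d} {ms : Vec ℕ d} → Pos ms → Vec ℕ d → Pos ms
_⊕_ {ms = []}     tt      []       = tt
_⊕_ {ms = m ∷ ms} (i , p) (a ∷ as) = advance i a , p ⊕ as

-- Finite sums, used over ℕ for counting and over ℤ for quadratic forms, and their translation
-- invariance.

module BigSum (R : CommutativeSemiring 0ℓ 0ℓ) where

  open CommutativeSemiring R
  open import Relation.Binary.Reasoning.Setoid setoid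
  open import Algebra.Properties.CommutativeSemigroup +-commutativeSemigroup using (interchange)

  ∑ : {A : Set} → List A → (A → Carrier) → Carrier
  ∑ []       f = 0#
  ∑ (x ∷ xs) f = f x + ∑ xs f

  module _ {A : Set} where

    ∑-cong : ∀ (xs : List A) {f g : A → Carrier} → (∀ x → f x ≈ g x) → ∑ xs f ≈ ∑ xs g
    ∑-cong []       eq = refl
    ∑-cong (x ∷ xs) eq = +-cong (eq x) (∑-cong xs eq)

    ∑-++ : ∀ (xs ys : List A) (f : A → Carrier) → ∑ (xs ++ ys) f ≈ ∑ xs f + ∑ ys f
    ∑-++ []       ys f = sym (+-identityˡ _)
    ∑-++ (x ∷ xs) ys f = trans (+-congˡ (∑-++ xs ys f)) (sym (+-assoc _ _ _))

    ∑-+ : ∀ (xs : List A) (f g : A → Carrier) → ∑ xs (λ x → f x + g x) ≈ ∑ xs f + ∑ xs g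
    ∑-+ []       f g = sym (+-identityˡ _)
    ∑-+ (x ∷ xs) f g = trans (+-congˡ (∑-+ xs f g)) (interchange _ _ _ _)

    ∑-* : ∀ (xs : List A) c (f : A → Carrier) → ∑ xs (λ x → c * f x) ≈ c * ∑ xs f
    ∑-* []       c f = sym (zeroʳ c)
    ∑-* (x ∷ xs) c f = trans (+-congˡ (∑-* xs c f)) (sym (distribˡ c _ _))

  ∑-0 : ∀ {A : Set} (xs : List A) → ∑ xs (λ _ → 0#) ≈ 0#
  ∑-0 []       = refl
  ∑-0 (x ∷ xs) = trans (+-identityˡ _) (∑-0 xs)

  ∑-swap : ∀ {A B : Set} (xs : List A) (ys : List B) (f : A → B → Carrier) →
           ∑ xs (λ x → ∑ ys (f x)) ≈ ∑ ys (λ y → ∑ xs (λ x → f x y))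
  ∑-swap []       ys f = sym (∑-0 ys)
  ∑-swap (x ∷ xs) ys f = trans (+-congˡ (∑-swap xs ys f)) (sym (∑-+ ys (f x) _))

  ∑-map : ∀ {A B : Set} (h : A → B) (xs : List A) (f : B → Carrier) → ∑ (map h xs) f ≈ ∑ xs (f ∘ h)
  ∑-map h []       f = refl
  ∑-map h (x ∷ xs) f = +-congˡ (∑-map h xs f)

  ∑-concatMap : ∀ {A B : Set} (h : A → List B) (xs : List A) (f : B → Carrier) →
                ∑ (concatMap h xs) f ≈ ∑ xs (λ x → ∑ (h x) f)
  ∑-concatMap h []       f = refl
  ∑-concatMap h (x ∷ xs) f = trans (∑-++ (h x) (concatMap h xs) f) (+-congˡ (∑-concatMap h xs f))

  ∑-pairs : ∀ {A B C : Set} (xs : List A) (ys : List B) (h : A → B → C) (f : C → Carrier) →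
            ∑ (concatMap (λ x → map (h x) ys) xs) f ≈ ∑ xs (λ x → ∑ ys (λ y → f (h x y)))
  ∑-pairs xs ys h f = trans (∑-concatMap (λ x → map (h x) ys) xs f) (∑-cong xs (λ x → ∑-map (h x) ys f))

  ∑-applyUpTo : ∀ n (h : ℕ → ℕ) (f : ℕ → Carrier) → ∑ (applyUpTo h n) f ≈ ∑ (upTo n) (f ∘ h)
  ∑-applyUpTo zero    h f = refl
  ∑-applyUpTo (suc n) h f =
    +-congˡ (trans (∑-applyUpTo n (h ∘ suc) f) (sym (∑-applyUpTo n suc (f ∘ h))))

  ∑-upTo-head : ∀ n (f : ℕ → Carrier) → ∑ (upTo (suc n)) f ≈ f 0 + ∑ (upTo n) (f ∘ suc)
  ∑-upTo-head n f = +-congˡ (∑-applyUpTo n suc f)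

  ∑-upTo-last : ∀ n (f : ℕ → Carrier) → ∑ (upTo (suc n)) f ≈ ∑ (upTo n) f + f n
  ∑-upTo-last zero    f = +-comm _ _
  ∑-upTo-last (suc n) f = begin
    ∑ (upTo (suc (suc n))) f                   ≈⟨ ∑-upTo-head (suc n) f ⟩
    f 0 + ∑ (upTo (suc n)) (f ∘ suc)           ≈⟨ +-congˡ (∑-upTo-last n (f ∘ suc)) ⟩
    f 0 + (∑ (upTo n) (f ∘ suc) + f (suc n))   ≈⟨ +-assoc _ _ _ ⟨
    f 0 + ∑ (upTo n) (f ∘ suc) + f (suc n)     ≈⟨ +-congʳ (∑-upTo-head n f) ⟨
    ∑ (upTo (suc n)) f + f (suc n)             ∎

  ∑-tabulate : ∀ {A : Set} n (h : Fin n → A) (f : A → Carrier) (g : ℕ → Carrier) →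
               (∀ i → f (h i) ≈ g (toℕ i)) → ∑ (tabulate h) f ≈ ∑ (upTo n) g
  ∑-tabulate zero    h f g eq = refl
  ∑-tabulate (suc n) h f g eq = trans
    (+-cong (eq Fin.zero) (∑-tabulate n (h ∘ Fin.suc) f (g ∘ suc) (eq ∘ Fin.suc)))
    (sym (∑-upTo-head n g))

  ∑-allFin : ∀ n (f : Fin n → Carrier) (g : ℕ → Carrier) →
             (∀ i → f i ≈ g (toℕ i)) → ∑ (allFin n) f ≈ ∑ (upTo n) g
  ∑-allFin n = ∑-tabulate n id

  -- Shifting by one trades the term at 0 for the term at `n`, and periodicity makes these equal.
  -- The induction applies this to the translate `h` of `g`.
  ∑-upTo-shift : ∀ n (g : ℕ → Carrier) → (∀ t → g (t ℕ.+ n) ≈ g t) →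
                 ∀ a → ∑ (upTo n) (λ t → g (t ℕ.+ a)) ≈ ∑ (upTo n) g
  ∑-upTo-shift n g per zero    = ∑-cong (upTo n) (λ t → reflexive (≡.cong g (ℕ.+-identityʳ t)))
  ∑-upTo-shift n g per (suc a) = begin
    ∑ (upTo n) (λ t → g (t ℕ.+ suc a))   ≈⟨ ∑-cong (upTo n) (λ t → reflexive (≡.cong g (ℕ.+-suc t a))) ⟩
    ∑ (upTo n) (λ t → g (suc t ℕ.+ a))   ≈⟨ rotate n h (h-per n per) ⟩
    ∑ (upTo n) h                         ≈⟨ ∑-upTo-shift n g per a ⟩
    ∑ (upTo n) g                         ∎
    where
    h : ℕ → Carrier
    h t = g (t ℕ.+ a)
    h-per : ∀ n → (∀ t → g (t ℕ.+ n) ≈ g t) → h n ≈ h 0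
    h-per n per = trans (reflexive (≡.cong g (ℕ.+-comm n a))) (per a)
    rotate : ∀ n (h : ℕ → Carrier) → h n ≈ h 0 → ∑ (upTo n) (h ∘ suc) ≈ ∑ (upTo n) h
    rotate zero    h eq = refl
    rotate (suc n) h eq = begin
      ∑ (upTo (suc n)) (h ∘ suc)           ≈⟨ ∑-upTo-last n (h ∘ suc) ⟩
      ∑ (upTo n) (h ∘ suc) + h (suc n)     ≈⟨ +-congˡ eq ⟩
      ∑ (upTo n) (h ∘ suc) + h 0           ≈⟨ +-comm _ _ ⟩
      h 0 + ∑ (upTo n) (h ∘ suc)           ≈⟨ ∑-upTo-head n h ⟨
      ∑ (upTo (suc n)) h                   ∎

  ∑-advance : ∀ m (f : Fin (suc m) → Carrier) a →
              ∑ (allFin (suc m)) (λ i → f (advance i a)) ≈ ∑ (allFin (suc m)) f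
  ∑-advance m f a = begin
    ∑ (allFin (suc m)) (λ i → f (advance i a))   ≈⟨ ∑-allFin (suc m) _ (λ t → g (t ℕ.+ a)) (λ _ → refl) ⟩
    ∑ (upTo (suc m)) (λ t → g (t ℕ.+ a))         ≈⟨ ∑-upTo-shift (suc m) g per a ⟩
    ∑ (upTo (suc m)) g                           ≈⟨ ∑-allFin (suc m) f g (λ i → reflexive (≡.cong f (≡.sym (mod-toℕ i)))) ⟨
    ∑ (allFin (suc m)) f                         ∎
    where
    g : ℕ → Carrier
    g t = f (t mod suc m)
    per : ∀ t → g (t ℕ.+ suc m) ≈ g t
    per t = reflexive (≡.cong f (mod-cong (t ℕ.+ suc m) t ([m+n]%n≡m%n t (suc m))))

  ∑-allPos : ∀ {d} m (ms : Vec ℕ d) (f : Pos (m ∷ ms) → Carrier) →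
             ∑ (allPos (m ∷ ms)) f ≈ ∑ (allFin (suc m)) (λ i → ∑ (allPos ms) (λ p → f (i , p)))
  ∑-allPos m ms f = ∑-pairs (allFin (suc m)) (allPos ms) _,_ f

  ∑-⊕ : ∀ {d} (ms : Vec ℕ d) (f : Pos ms → Carrier) as →
        ∑ (allPos ms) (λ p → f (p ⊕ as)) ≈ ∑ (allPos ms) f
  ∑-⊕ []       f []       = refl
  ∑-⊕ (m ∷ ms) f (a ∷ as) = begin
    ∑ (allPos (m ∷ ms)) (λ p → f (p ⊕ (a ∷ as)))
      ≈⟨ ∑-allPos m ms _ ⟩
    ∑ (allFin (suc m)) (λ i → ∑ (allPos ms) (λ p → f (advance i a , p ⊕ as)))
      ≈⟨ ∑-cong (allFin (suc m)) (λ i → ∑-⊕ ms (λ p → f (advance i a , p)) as) ⟩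
    ∑ (allFin (suc m)) (λ i → ∑ (allPos ms) (λ p → f (advance i a , p)))
      ≈⟨ ∑-advance m (λ i → ∑ (allPos ms) (λ p → f (i , p))) a ⟩
    ∑ (allFin (suc m)) (λ i → ∑ (allPos ms) (λ p → f (i , p)))
      ≈⟨ ∑-allPos m ms f ⟨
    ∑ (allPos (m ∷ ms)) f ∎

module ∑ℕ = BigSum ℕ.+-*-commutativeSemiring
module ∑ℤ = BigSum ℤ.+-*-commutativeSemiring

open ∑ℕ
open ∑ℤ using () renaming
  ( ∑ to ∑ᶻ; ∑-cong to ∑ᶻ-cong; ∑-+ to ∑ᶻ-+; ∑-* to ∑ᶻ-*; ∑-0 to ∑ᶻ-0; ∑-swap to ∑ᶻ-swap
  ; ∑-pairs to ∑ᶻ-pairs; ∑-advance to ∑ᶻ-advance; ∑-allPos to ∑ᶻ-allPos )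
open import Data.Nat using (_+_; _*_; _^_; _≤ᵇ_; _≡ᵇ_; z≤n; s≤s; NonZero)

-- Indicators and counting.

⟦_⟧ : Bool → ℕ
⟦ b ⟧ = if b then 1 else 0

⟦⟧-mono : ∀ {b c} → (b ≡ true → c ≡ true) → ⟦ b ⟧ ≤ ⟦ c ⟧
⟦⟧-mono {false} h = z≤n
⟦⟧-mono {true}  h = ℕ.≤-reflexive (≡.sym (≡.cong ⟦_⟧ (h ≡.refl)))

∧-split : ∀ {a b} → a ∧ b ≡ true → a ≡ true × b ≡ true
∧-split {true} {true} _ = ≡.refl , ≡.refl

∧-join : ∀ {a b} → a ≡ true → b ≡ true → a ∧ b ≡ true
∧-join ≡.refl ≡.refl = ≡.refl

≡ᵇ⇒≡ : ∀ {m n} → (m ≡ᵇ n) ≡ true → m ≡ n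
≡ᵇ⇒≡ {m} {n} eq = ℕ.≡ᵇ⇒≡ m n (≡.subst T (≡.sym eq) tt)

≡⇒≡ᵇ : ∀ {m n} → m ≡ n → (m ≡ᵇ n) ≡ true
≡⇒≡ᵇ {zero}  ≡.refl = ≡.refl
≡⇒≡ᵇ {suc m} ≡.refl = ≡⇒≡ᵇ {m} ≡.refl

≢⇒≡ᵇ : ∀ {m n} → m ≢ n → (m ≡ᵇ n) ≡ false
≢⇒≡ᵇ {m} {n} m≢n with m ≡ᵇ n in eq
... | true  = ⊥-elim (m≢n (≡ᵇ⇒≡ eq))
... | false = ≡.refl

∑-mono : ∀ {A : Set} (xs : List A) {f g : A → ℕ} → (∀ x → f x ≤ g x) → ∑ xs f ≤ ∑ xs g
∑-mono []       le = z≤n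
∑-mono (x ∷ xs) le = ℕ.+-mono-≤ (le x) (∑-mono xs le)

∑-*ʳ : ∀ {A : Set} (xs : List A) (f : A → ℕ) c → ∑ xs (λ x → f x * c) ≡ ∑ xs f * c
∑-*ʳ xs f c = ≡.trans (∑-cong xs (λ x → ℕ.*-comm (f x) c)) (≡.trans (∑-* xs c f) (ℕ.*-comm c _))

∑-upTo-const : ∀ n c → ∑ (upTo n) (λ _ → c) ≡ n * c
∑-upTo-const zero    c = ≡.refl
∑-upTo-const (suc n) c = ≡.trans (∑-upTo-head n _) (≡.cong (_+_ c) (∑-upTo-const n c))

∑-allFin-const : ∀ n c → ∑ (allFin n) (λ _ → c) ≡ n * c
∑-allFin-const n c = ≡.trans (∑-allFin n _ (λ _ → c) (λ _ → ≡.refl)) (∑-upTo-const n c)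

∑-allPos-const : ∀ {d} (ms : Vec ℕ d) c → ∑ (allPos ms) (λ _ → c) ≡ size ms * c
∑-allPos-const []       c = ≡.refl
∑-allPos-const (m ∷ ms) c = begin
  ∑ (allPos (m ∷ ms)) (λ _ → c)                              ≡⟨ ∑-allPos m ms _ ⟩
  ∑ (allFin (suc m)) (λ _ → ∑ (allPos ms) (λ _ → c))         ≡⟨ ∑-allFin-const (suc m) _ ⟩
  suc m * ∑ (allPos ms) (λ _ → c)                            ≡⟨ ≡.cong (suc m *_) (∑-allPos-const ms c) ⟩
  suc m * (size ms * c)                                      ≡⟨ ℕ.*-assoc (suc m) (size ms) c ⟨
  suc m * size ms * c                                        ∎
  where open ≡.≡-Reasoning

sum≡∑ : ∀ xs → sum xs ≡ ∑ xs id
sum≡∑ []       = ≡.refl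
sum≡∑ (x ∷ xs) = ≡.cong (_+_ x) (sum≡∑ xs)

-- Reading a word along the orbit of a map.

iter : {S : Set} → (S → S) → ℕ → S → S
iter σ zero    s = s
iter σ (suc n) s = iter σ n (σ s)

-- The map `σ` is left abstract so that the same predicate covers straight lines in a grid, their
-- subsampling with step `k`, and the bouncing and lingering walks.
reads : {S : Set} → (S → S) → (S → ℕ) → S → Word → Bool
reads σ lab s []      = true
reads σ lab s (a ∷ w) = (lab s ≡ᵇ a) ∧ reads σ lab (σ s) w

module _ {S : Set} (σ : S → S) where

  iter-comm : ∀ n s → iter σ n (σ s) ≡ σ (iter σ n s)
  iter-comm zero    s = ≡.refl
  iter-comm (suc n) s = iter-comm n (σ s)

  iter-+ : ∀ m n s → iter σ (m + n) s ≡ iter σ n (iter σ m s)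
  iter-+ zero    n s = ≡.refl
  iter-+ (suc m) n s = iter-+ m n (σ s)

  iter-inverse : (τ : S → S) → (∀ s → σ (τ s) ≡ s) → ∀ n s → iter σ n (iter τ n s) ≡ s
  iter-inverse τ στ zero    s = ≡.refl
  iter-inverse τ στ (suc n) s =
    ≡.trans (iter-comm n _) (≡.trans (≡.cong σ (iter-inverse τ στ n (τ s))) (στ s))

  module _ (lab : S → ℕ) where

    reads-++ : ∀ w z s → reads σ lab s (w ++ z) ≡ reads σ lab s w ∧ reads σ lab (iter σ (length w) s) z
    reads-++ []      z s = ≡.refl
    reads-++ (a ∷ w) z s =
      ≡.trans (≡.cong ((lab s ≡ᵇ a) ∧_) (reads-++ w z (σ s))) (≡.sym (∧-assoc (lab s ≡ᵇ a) _ _))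

    -- After `length w` steps of `τ` the walk is one cell past the last letter, so one step of `σ`
    -- leads back to it. This form of the starting point makes sense for the empty word too.
    reads-reverse : (τ : S → S) → (∀ s → σ (τ s) ≡ s) → ∀ w s →
                    reads τ lab s w ≡ reads σ lab (σ (iter τ (length w) s)) (reverse w)
    reads-reverse τ στ []      s = ≡.refl
    reads-reverse τ στ (a ∷ w) s = begin
      (lab s ≡ᵇ a) ∧ reads τ lab (τ s) w
        ≡⟨ ≡.cong ((lab s ≡ᵇ a) ∧_) (reads-reverse τ στ w (τ s)) ⟩
      (lab s ≡ᵇ a) ∧ reads σ lab q (reverse w)
        ≡⟨ ∧-comm (lab s ≡ᵇ a) _ ⟩
      reads σ lab q (reverse w) ∧ (lab s ≡ᵇ a)
        ≡⟨ ≡.cong (reads σ lab q (reverse w) ∧_)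
             (≡.trans (≡.cong (λ x → lab x ≡ᵇ a) (≡.sym back)) (≡.sym (∧-identityʳ _))) ⟩
      reads σ lab q (reverse w) ∧ reads σ lab (iter σ (length (reverse w)) q) [ a ]
        ≡⟨ reads-++ (reverse w) [ a ] q ⟨
      reads σ lab q (reverse w ++ [ a ])
        ≡⟨ ≡.cong (reads σ lab q) (unfold-reverse a w) ⟨
      reads σ lab q (reverse (a ∷ w)) ∎
      where
      open ≡.≡-Reasoning
      q : S
      q = σ (iter τ (length w) (τ s))
      back : iter σ (length (reverse w)) q ≡ s
      back = ≡.trans (≡.cong (λ n → iter σ n q) (length-reverse w)) (iter-inverse τ στ (suc (length w)) s)

module _ {S : Set} (E : List S) (τ : S → S) (inv : ∀ f → ∑ E (f ∘ τ) ≡ ∑ E f) where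

  ∑-iter : ∀ n f → ∑ E (f ∘ iter τ n) ≡ ∑ E f
  ∑-iter zero    f = ≡.refl
  ∑-iter (suc n) f = ≡.trans (inv (f ∘ iter τ n)) (∑-iter n f)

-- Directions, straight lines, and appearances as sums of readings.

opposite : Sign → Sign
opposite neg = pos
opposite zer = zer
opposite pos = neg

negate : ∀ {d} → Vec Sign d → Vec Sign d
negate []      = []
negate (s ∷ v) = opposite s ∷ negate v

negate-involutive : ∀ {d} (v : Vec Sign d) → negate (negate v) ≡ v
negate-involutive []        = ≡.refl
negate-involutive (neg ∷ v) = ≡.cong (neg ∷_) (negate-involutive v)
negate-involutive (zer ∷ v) = ≡.cong (zer ∷_) (negate-involutive v)
negate-involutive (pos ∷ v) = ≡.cong (pos ∷_) (negate-involutive v)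

nonzero-negate : ∀ {d} (v : Vec Sign d) → nonzero (negate v) ≡ nonzero v
nonzero-negate []        = ≡.refl
nonzero-negate (neg ∷ v) = ≡.refl
nonzero-negate (zer ∷ v) = nonzero-negate v
nonzero-negate (pos ∷ v) = ≡.refl

∑-allDirs : ∀ d (f : Vec Sign (suc d) → ℕ) →
            ∑ (allDirs (suc d)) f ≡ ∑ (neg ∷ zer ∷ pos ∷ []) (λ s → ∑ (allDirs d) (λ v → f (s ∷ v)))
∑-allDirs d f = ∑-pairs (neg ∷ zer ∷ pos ∷ []) (allDirs d) _∷_ f

∑-negate : ∀ d (f : Vec Sign d → ℕ) → ∑ (allDirs d) (f ∘ negate) ≡ ∑ (allDirs d) f
∑-negate zero    f = ≡.refl
∑-negate (suc d) f = begin
  ∑ (allDirs (suc d)) (f ∘ negate)                    ≡⟨ ∑-allDirs d _ ⟩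
  ∑ signs (λ s → ∑ (allDirs d) (λ v → f (opposite s ∷ negate v)))
    ≡⟨ ∑-cong signs (λ s → ∑-negate d (λ v → f (opposite s ∷ v))) ⟩
  F pos + (F zer + (F neg + 0))                       ≡⟨ rearrange (F pos) (F zer) (F neg) ⟩
  F neg + (F zer + (F pos + 0))                       ≡⟨ ∑-allDirs d f ⟨
  ∑ (allDirs (suc d)) f                               ∎
  where
  open ≡.≡-Reasoning
  signs : List Sign
  signs = neg ∷ zer ∷ pos ∷ []
  F : Sign → ℕ
  F s = ∑ (allDirs d) (λ v → f (s ∷ v))
  rearrange : ∀ a b c → a + (b + (c + 0)) ≡ c + (b + (a + 0))
  rearrange = solve-∀

offset : ∀ {d} → Vec ℕ d → Vec Sign d → ℕ → Vec ℕ d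
offset []       []      j = []
offset (m ∷ ms) (s ∷ v) j = j * signVal m s ∷ offset ms v j

shift≡⊕ : ∀ {d} {ms : Vec ℕ d} (p : Pos ms) v j → shift p v j ≡ p ⊕ offset ms v j
shift≡⊕ {ms = []}     tt      []      j = ≡.refl
shift≡⊕ {ms = m ∷ ms} (i , p) (s ∷ v) j = ≡.cong (advance i (j * signVal m s) ,_) (shift≡⊕ p v j)

shift-0 : ∀ {d} {ms : Vec ℕ d} (p : Pos ms) v → shift p v 0 ≡ p
shift-0 {ms = []}     tt      []      = ≡.refl
shift-0 {ms = m ∷ ms} (i , p) (s ∷ v) = ≡.cong₂ _,_ (advance-0 i) (shift-0 p v)

shift-+ : ∀ {d} {ms : Vec ℕ d} (p : Pos ms) v i j → shift (shift p v i) v j ≡ shift p v (i + j)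
shift-+ {ms = []}     tt      []      i j = ≡.refl
shift-+ {ms = m ∷ ms} (x , p) (s ∷ v) i j = ≡.cong₂ _,_
  (≡.trans (advance-+ x (i * signVal m s) (j * signVal m s))
           (≡.cong (advance x) (≡.sym (ℕ.*-distribʳ-+ (signVal m s) i j))))
  (shift-+ p v i j)

step : ∀ {d} {ms : Vec ℕ d} → Vec Sign d → Pos ms → Pos ms
step v p = shift p v 1

step-negate : ∀ {d} {ms : Vec ℕ d} v (p : Pos ms) → step v (step (negate v) p) ≡ p
step-negate {ms = []}     []      tt      = ≡.refl
step-negate {ms = m ∷ ms} (s ∷ v) (i , p) = ≡.cong₂ _,_
  (≡.trans (advance-+ i (1 * signVal m (opposite s)) (1 * signVal m s)) (cancel s))
  (step-negate v p)
  where
  cancel : ∀ s → advance i (1 * signVal m (opposite s) + 1 * signVal m s) ≡ i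
  cancel neg = ≡.trans (≡.cong (advance i) (≡.cong suc (ℕ.+-identityʳ m))) (full i)
    where
    full : ∀ i → advance i (suc m) ≡ i
    full i = ≡.trans (≡.cong (advance i) (≡.sym (ℕ.*-identityˡ (suc m)))) (advance-period i 1)
  cancel zer = advance-0 i
  cancel pos = ≡.trans (≡.cong (advance i) (≡.trans (≡.cong (_+ 1) (ℕ.*-identityˡ m))
                          (≡.trans (ℕ.+-comm m 1) (≡.sym (ℕ.*-identityˡ (suc m)))))) (advance-period i 1)

step-negate′ : ∀ {d} {ms : Vec ℕ d} v (p : Pos ms) → step (negate v) (step v p) ≡ p
step-negate′ v p = ≡.trans (≡.cong (λ u → step (negate v) (step u p)) (≡.sym (negate-involutive v)))
                           (step-negate (negate v) p)

shift≡iter : ∀ {d} {ms : Vec ℕ d} v n (p : Pos ms) → shift p v n ≡ iter (step v) n p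
shift≡iter v zero    p = shift-0 p v
shift≡iter v (suc n) p = ≡.trans (≡.sym (shift-+ p v 1 n)) (shift≡iter v n (step v p))

∑-step : ∀ {d} (ms : Vec ℕ d) v (f : Pos ms → ℕ) → ∑ (allPos ms) (f ∘ step v) ≡ ∑ (allPos ms) f
∑-step ms v f = ≡.trans (∑-cong (allPos ms) (λ p → ≡.cong f (shift≡⊕ p v 1))) (∑-⊕ ms f (offset ms v 1))

matchFrom≡reads : ∀ {d} {ms : Vec ℕ d} (Γ : Pos ms → ℕ) p v i w →
                  matchFrom Γ p v i w ≡ reads (step v) Γ (shift p v i) w
matchFrom≡reads Γ p v i []      = ≡.refl
matchFrom≡reads Γ p v i (a ∷ w) = ≡.cong ((Γ (shift p v i) ≡ᵇ a) ∧_) (≡.trans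
  (matchFrom≡reads Γ p v (suc i) w)
  (≡.cong (λ q → reads (step v) Γ q w)
     (≡.trans (≡.cong (shift p v) (ℕ.+-comm 1 i)) (≡.sym (shift-+ p v i 1)))))

along : ∀ {d} (ms : Vec ℕ d) → (Pos ms → ℕ) → Vec Sign d → Word → ℕ
along ms Γ v w = ∑ (allPos ms) (λ p → ⟦ reads (step v) Γ p w ⟧)

appearances≡ : ∀ {d} (ms : Vec ℕ d) Γ w →
  appearances ms Γ w ≡ ∑ (allPos ms) (λ p → ∑ (allDirs d) (λ v → ⟦ nonzero v ∧ reads (step v) Γ p w ⟧))
appearances≡ {d} ms Γ w = begin
  appearances ms Γ w
    ≡⟨ sum≡∑ terms ⟩
  ∑ terms id
    ≡⟨ ∑-pairs (allPos ms) (allDirs d) _ id ⟩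
  ∑ (allPos ms) (λ p → ∑ (allDirs d) (λ v → ⟦ nonzero v ∧ matchFrom Γ p v 0 w ⟧))
    ≡⟨ ∑-cong (allPos ms) (λ p → ∑-cong (allDirs d) (λ v → ≡.cong (λ b → ⟦ nonzero v ∧ b ⟧)
         (≡.trans (matchFrom≡reads Γ p v 0 w) (≡.cong (λ q → reads (step v) Γ q w) (shift-0 p v))))) ⟩
  ∑ (allPos ms) (λ p → ∑ (allDirs d) (λ v → ⟦ nonzero v ∧ reads (step v) Γ p w ⟧)) ∎
  where
  open ≡.≡-Reasoning
  terms : List ℕ
  terms = concatMap (λ p → map (λ v → ⟦ nonzero v ∧ matchFrom Γ p v 0 w ⟧) (allDirs d)) (allPos ms)

⟦∧⟧ : ∀ b c → ⟦ b ∧ c ⟧ ≡ ⟦ b ⟧ * ⟦ c ⟧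
⟦∧⟧ false c = ≡.refl
⟦∧⟧ true  c = ≡.sym (ℕ.+-identityʳ ⟦ c ⟧)

appearances≡∑along : ∀ {d} (ms : Vec ℕ d) Γ w →
  appearances ms Γ w ≡ ∑ (allDirs d) (λ v → ⟦ nonzero v ⟧ * along ms Γ v w)
appearances≡∑along {d} ms Γ w = begin
  appearances ms Γ w
    ≡⟨ appearances≡ ms Γ w ⟩
  ∑ (allPos ms) (λ p → ∑ (allDirs d) (λ v → ⟦ nonzero v ∧ reads (step v) Γ p w ⟧))
    ≡⟨ ∑-swap (allPos ms) (allDirs d) _ ⟩
  ∑ (allDirs d) (λ v → ∑ (allPos ms) (λ p → ⟦ nonzero v ∧ reads (step v) Γ p w ⟧))
    ≡⟨ ∑-cong (allDirs d) (λ v → ≡.trans (∑-cong (allPos ms) (λ p → ⟦∧⟧ (nonzero v) _))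
         (∑-* (allPos ms) ⟦ nonzero v ⟧ _)) ⟩
  ∑ (allDirs d) (λ v → ⟦ nonzero v ⟧ * along ms Γ v w) ∎
  where open ≡.≡-Reasoning

along-reverse : ∀ {d} (ms : Vec ℕ d) Γ v w → along ms Γ (negate v) w ≡ along ms Γ v (reverse w)
along-reverse ms Γ v w = begin
  along ms Γ (negate v) w
    ≡⟨ ∑-cong (allPos ms) (λ p → ≡.cong ⟦_⟧ (reads-reverse (step v) Γ (step (negate v)) (step-negate v) w p)) ⟩
  ∑ (allPos ms) (λ p → ⟦ reads (step v) Γ (step v (iter (step (negate v)) (length w) p)) (reverse w) ⟧)
    ≡⟨ ∑-iter (allPos ms) (step (negate v)) (∑-step ms (negate v)) (length w)
         (λ p → ⟦ reads (step v) Γ (step v p) (reverse w) ⟧) ⟩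
  ∑ (allPos ms) (λ p → ⟦ reads (step v) Γ (step v p) (reverse w) ⟧)
    ≡⟨ ∑-step ms v (λ p → ⟦ reads (step v) Γ p (reverse w) ⟧) ⟩
  along ms Γ v (reverse w) ∎
  where open ≡.≡-Reasoning

-- Negating a direction reads its lines backwards, and negation permutes the nonzero directions.
appearances-reverse : ∀ {d} (ms : Vec ℕ d) Γ w → appearances ms Γ (reverse w) ≡ appearances ms Γ w
appearances-reverse {d} ms Γ w = begin
  appearances ms Γ (reverse w)
    ≡⟨ appearances≡∑along ms Γ (reverse w) ⟩
  ∑ (allDirs d) (λ v → ⟦ nonzero v ⟧ * along ms Γ v (reverse w))
    ≡⟨ ∑-cong (allDirs d) (λ v → ≡.cong₂ _*_ (≡.cong ⟦_⟧ (≡.sym (nonzero-negate v)))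
                                             (≡.sym (along-reverse ms Γ v w))) ⟩
  ∑ (allDirs d) (λ v → ⟦ nonzero (negate v) ⟧ * along ms Γ (negate v) w)
    ≡⟨ ∑-negate d (λ v → ⟦ nonzero v ⟧ * along ms Γ v w) ⟩
  ∑ (allDirs d) (λ v → ⟦ nonzero v ⟧ * along ms Γ v w)
    ≡⟨ appearances≡∑along ms Γ w ⟨
  appearances ms Γ w ∎
  where open ≡.≡-Reasoning

-- The direction -1 is traded for the reversed word, so that walks need only run forwards to account
-- for every appearance on a line.
appearances-line : ∀ m (Γ : Pos (m ∷ []) → ℕ) w →
  appearances (m ∷ []) Γ w ≡ along (m ∷ []) Γ (pos ∷ []) w + along (m ∷ []) Γ (pos ∷ []) (reverse w)
appearances-line m Γ w = begin
  appearances (m ∷ []) Γ w     ≡⟨ appearances≡∑along (m ∷ []) Γ w ⟩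
  1 * N + (0 + (1 * P + 0))    ≡⟨ rearrange N P ⟩
  P + N                        ≡⟨ ≡.cong (_+_ P) (along-reverse (m ∷ []) Γ (pos ∷ []) w) ⟩
  P + along (m ∷ []) Γ (pos ∷ []) (reverse w) ∎
  where
  open ≡.≡-Reasoning
  N P : ℕ
  N = along (m ∷ []) Γ (neg ∷ []) w
  P = along (m ∷ []) Γ (pos ∷ []) w
  rearrange : ∀ n p → 1 * n + (0 + (1 * p + 0)) ≡ p + n
  rearrange = solve-∀

-- Clearing denominators: rational bounds as inequalities of naturals.

/-≤⇒ : ∀ a n i m .{{_ : NonZero n}} .{{_ : NonZero m}} →
       (+ a) / n ℚ.≤ i / m → + a ℤ.* + m ℤ.≤ i ℤ.* + n
/-≤⇒ a (suc n) i (suc m) le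
  with *≤* h ← ℚᵘ.≤-respˡ-≃ (ℚ.toℚᵘ-fromℚᵘ (mkℚᵘ (+ a) n))
                 (ℚᵘ.≤-respʳ-≃ (ℚ.toℚᵘ-fromℚᵘ (mkℚᵘ i m)) (ℚ.toℚᵘ-mono-≤ le)) = h

/-≤⇐ : ∀ a n i m .{{_ : NonZero n}} .{{_ : NonZero m}} →
       + a ℤ.* + m ℤ.≤ i ℤ.* + n → (+ a) / n ℚ.≤ i / m
/-≤⇐ a (suc n) i (suc m) le = ℚ.toℚᵘ-cancel-≤
  (ℚᵘ.≤-respˡ-≃ (ℚᵘ.≃-sym (ℚ.toℚᵘ-fromℚᵘ (mkℚᵘ (+ a) n)))
    (ℚᵘ.≤-respʳ-≃ (ℚᵘ.≃-sym (ℚ.toℚᵘ-fromℚᵘ (mkℚᵘ i m))) (*≤* le)))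

*-/ : ∀ c i m .{{_ : NonZero m}} → (+ c) / 1 ℚ.* (i / m) ≡ (+ c ℤ.* i) / m
*-/ c i (suc m) = ℚ.toℚᵘ-injective (begin
  toℚᵘ ((+ c) / 1 ℚ.* (i / suc m))            ≈⟨ ℚ.toℚᵘ-homo-* ((+ c) / 1) (i / suc m) ⟩
  toℚᵘ ((+ c) / 1) ℚᵘ.* toℚᵘ (i / suc m)
    ≈⟨ ℚᵘ.*-cong (ℚ.toℚᵘ-fromℚᵘ (mkℚᵘ (+ c) 0)) (ℚ.toℚᵘ-fromℚᵘ (mkℚᵘ i m)) ⟩
  mkℚᵘ (+ c) 0 ℚᵘ.* mkℚᵘ i m
    ≈⟨ *≡* (≡.cong (λ x → + c ℤ.* i ℤ.* + suc x) (≡.sym (ℕ.+-identityʳ m))) ⟩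
  mkℚᵘ (+ c ℤ.* i) m                          ≈⟨ ℚ.toℚᵘ-fromℚᵘ (mkℚᵘ (+ c ℤ.* i) m) ⟨
  toℚᵘ ((+ c ℤ.* i) / suc m)                  ∎)
  where open import Relation.Binary.Reasoning.Setoid ℚᵘ.≃-setoid

-- C_d(w) ≤ A / B, with denominators cleared.
Bounded : ℕ → Word → ℕ → ℕ → Set
Bounded d w A B = ∀ (ms : Vec ℕ d) (Γ : Pos ms → ℕ) → appearances ms Γ w * B ≤ A * size ms

Bounded⇒UpperBound : ∀ d w A B .{{_ : NonZero B}} → Bounded d w A B → UpperBound d w ((+ A) / B)
Bounded⇒UpperBound d w A B bd ms Γ = /-≤⇐ (appearances ms Γ w) (size ms) (+ A) B {{size-nz ms}}
  (≡.subst₂ ℤ._≤_ (ℤ.pos-* (appearances ms Γ w) B) (ℤ.pos-* A (size ms)) (ℤ.+≤+ (bd ms Γ)))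

UpperBound⇒Bounded : ∀ d w A B .{{_ : NonZero B}} → UpperBound d w ((+ A) / B) → Bounded d w A B
UpperBound⇒Bounded d w A B ub ms Γ = ℤ.drop‿+≤+
  (≡.subst₂ ℤ._≤_ (≡.sym (ℤ.pos-* (appearances ms Γ w) B)) (≡.sym (ℤ.pos-* A (size ms)))
    (/-≤⇒ (appearances ms Γ w) (size ms) (+ A) B {{size-nz ms}} (ub ms Γ)))

+≰-negative : ∀ a B c k n .{{_ : NonZero c}} .{{_ : NonZero n}} →
              ¬ (+ a ℤ.* + B ℤ.≤ + c ℤ.* -[1+ k ] ℤ.* + n)
+≰-negative a B (suc c) k (suc n) le with () ← ≡.subst (ℤ._≤ _) (≡.sym (ℤ.pos-* a B)) le

-- Concentrations are nonnegative, so a grid with a single cell refutes a negative bound. For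
-- negative `q` both sides of the equivalence in `Stackable` are therefore false.
¬UpperBound-negative : ∀ d w c k B .{{_ : NonZero c}} .{{_ : NonZero B}} →
                       ¬ UpperBound d w ((+ c ℤ.* -[1+ k ]) / B)
¬UpperBound-negative d w c k B ub = +≰-negative (appearances ms Γ w) B c k (size ms) {{it}} {{size-nz ms}}
  (/-≤⇒ (appearances ms Γ w) (size ms) (+ c ℤ.* -[1+ k ]) B {{size-nz ms}} (ub ms Γ))
  where
  ms : Vec ℕ d
  ms = Vec.replicate d 0
  Γ : Pos ms → ℕ
  Γ _ = 0

-- C_d(w) ≤ 3^{d-1} C_1(w); the converse inequality holds for every word.
Stackable≤ : ℕ → Word → Set
Stackable≤ d w = ∀ A B .{{_ : NonZero B}} → Bounded 1 w A B → Bounded d w (3 ^ (d ∸ 1) * A) B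

Stackable⇒Stackable≤ : ∀ d w → Stackable d w → Stackable≤ d w
Stackable⇒Stackable≤ d w st A B bd = UpperBound⇒Bounded d w (3 ^ (d ∸ 1) * A) B
  (≡.subst (UpperBound d w)
    (≡.trans (*-/ (3 ^ (d ∸ 1)) (+ A) B) (≡.cong (λ i → i / B) (≡.sym (ℤ.pos-* (3 ^ (d ∸ 1)) A))))
    (Equivalence.from (st ((+ A) / B)) (Bounded⇒UpperBound 1 w A B bd)))

-- Stacking copies of a line.

∑-allDirs-const : ∀ d c → ∑ (allDirs d) (λ _ → c) ≡ 3 ^ d * c
∑-allDirs-const zero    c = ≡.refl
∑-allDirs-const (suc d) c = begin
  ∑ (allDirs (suc d)) (λ _ → c)   ≡⟨ ∑-allDirs d _ ⟩
  N + (N + (N + 0))               ≡⟨ ≡.cong (λ n → n + (n + (n + 0))) (∑-allDirs-const d c) ⟩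
  3 * (3 ^ d * c)                 ≡⟨ ℕ.*-assoc 3 (3 ^ d) c ⟨
  3 ^ suc d * c                   ∎
  where
  open ≡.≡-Reasoning
  N : ℕ
  N = ∑ (allDirs d) (λ _ → c)

reads-proj : ∀ {S U : Set} (h : S → U) (σ : S → S) (π : U → U) (lab : U → ℕ) →
             (∀ s → h (σ s) ≡ π (h s)) → ∀ w s → reads σ (lab ∘ h) s w ≡ reads π lab (h s) w
reads-proj h σ π lab comm []      s = ≡.refl
reads-proj h σ π lab comm (a ∷ w) s = ≡.cong ((lab (h s) ≡ᵇ a) ∧_)
  (≡.trans (reads-proj h σ π lab comm w (σ s)) (≡.cong (λ u → reads π lab u w) (comm s)))

size-replicate-0 : ∀ d → size (Vec.replicate d 0) ≡ 1
size-replicate-0 zero    = ≡.refl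
size-replicate-0 (suc d) = ≡.trans (ℕ.+-identityʳ _) (size-replicate-0 d)

-- A line is a d-dimensional grid whose other side lengths are 1.
module Stack (d m : ℕ) (Γ : Pos (m ∷ []) → ℕ) where

  sides : Vec ℕ (suc d)
  sides = m ∷ Vec.replicate d 0

  line : Pos sides → Pos (m ∷ [])
  line (i , _) = i , tt

  size-sides : size sides ≡ size (m ∷ [])
  size-sides = ≡.cong (suc m *_) (size-replicate-0 d)

  along-line : ∀ s v w → along sides (Γ ∘ line) (s ∷ v) w ≡ along (m ∷ []) Γ (s ∷ []) w
  along-line s v w = begin
    along sides (Γ ∘ line) (s ∷ v) w
      ≡⟨ ∑-allPos m (Vec.replicate d 0) _ ⟩
    ∑ (allFin (suc m)) (λ i → ∑ (allPos (Vec.replicate d 0)) (λ p → ⟦ reads (step (s ∷ v)) (Γ ∘ line) (i , p) w ⟧))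
      ≡⟨ ∑-cong (allFin (suc m)) (λ i → ∑-cong (allPos (Vec.replicate d 0)) (λ p → ≡.cong ⟦_⟧
           (reads-proj line (step (s ∷ v)) (step (s ∷ [])) Γ (λ _ → ≡.refl) w (i , p)))) ⟩
    ∑ (allFin (suc m)) (λ i → ∑ (allPos (Vec.replicate d 0)) (λ p → ⟦ reads (step (s ∷ [])) Γ (i , tt) w ⟧))
      ≡⟨ ∑-cong (allFin (suc m)) (λ i → ≡.trans (∑-allPos-const (Vec.replicate d 0) _)
           (≡.cong (_* ⟦ reads (step (s ∷ [])) Γ (i , tt) w ⟧) (size-replicate-0 d))) ⟩
    ∑ (allFin (suc m)) (λ i → ∑ (allPos []) (λ p → ⟦ reads (step (s ∷ [])) Γ (i , p) w ⟧))
      ≡⟨ ∑-allPos m [] _ ⟨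
    along (m ∷ []) Γ (s ∷ []) w ∎
    where open ≡.≡-Reasoning

  -- Each of the two directions of the line extends to 3^d directions, because nothing moves along
  -- sides of length 1. Directions whose first sign is `zer` are dropped, hence an inequality.
  appearances-sides : ∀ w → 3 ^ d * appearances (m ∷ []) Γ w ≤ appearances sides (Γ ∘ line) w
  appearances-sides w = begin
    3 ^ d * appearances (m ∷ []) Γ w
      ≡⟨ ≡.cong (3 ^ d *_) (appearances≡∑along (m ∷ []) Γ w) ⟩
    3 ^ d * ∑ (allDirs 1) (λ v → ⟦ nonzero v ⟧ * along (m ∷ []) Γ v w)
      ≡⟨ rearrange (3 ^ d) (L neg) (L pos) ⟩
    3 ^ d * L neg + (0 + (3 ^ d * L pos + 0))
      ≡⟨ ≡.cong₂ (λ x y → x + (0 + (y + 0))) (∑-allDirs-const d (L neg)) (∑-allDirs-const d (L pos)) ⟨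
    ∑ (allDirs d) (λ v → L neg) + (0 + (∑ (allDirs d) (λ v → L pos) + 0))
      ≤⟨ ℕ.+-mono-≤ (ℕ.≤-reflexive (∑-cong (allDirs d) (term neg ≡.refl)))
           (ℕ.+-mono-≤ (z≤n {F zer}) (ℕ.+-monoˡ-≤ 0 (ℕ.≤-reflexive (∑-cong (allDirs d) (term pos ≡.refl))))) ⟩
    ∑ (neg ∷ zer ∷ pos ∷ []) F
      ≡⟨ ∑-allDirs d _ ⟨
    ∑ (allDirs (suc d)) (λ v → ⟦ nonzero v ⟧ * along sides (Γ ∘ line) v w)
      ≡⟨ appearances≡∑along sides (Γ ∘ line) w ⟨
    appearances sides (Γ ∘ line) w ∎
    where
    open ℕ.≤-Reasoning
    L F : Sign → ℕ
    L s = along (m ∷ []) Γ (s ∷ []) w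
    F s = ∑ (allDirs d) (λ v → ⟦ nonzero (s ∷ v) ⟧ * along sides (Γ ∘ line) (s ∷ v) w)
    term : ∀ s → ⟦ nonzero (s ∷ []) ⟧ ≡ 1 → ∀ v → L s ≡ ⟦ nonzero (s ∷ v) ⟧ * along sides (Γ ∘ line) (s ∷ v) w
    term neg _ v = ≡.trans (≡.sym (along-line neg v w)) (≡.sym (ℕ.+-identityʳ _))
    term pos _ v = ≡.trans (≡.sym (along-line pos v w)) (≡.sym (ℕ.+-identityʳ _))
    rearrange : ∀ c x y → c * (1 * x + (0 + (1 * y + 0))) ≡ c * x + (0 + (c * y + 0))
    rearrange = solve-∀

Bounded-stack : ∀ d w A B → Bounded (suc d) w (3 ^ d * A) B → Bounded 1 w A B
Bounded-stack d w A B bd (m ∷ []) Γ = ℕ.*-cancelˡ-≤ (3 ^ d) {{ℕ.m^n≢0 3 d}} (begin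
  3 ^ d * (appearances (m ∷ []) Γ w * B)       ≡⟨ ℕ.*-assoc (3 ^ d) _ B ⟨
  3 ^ d * appearances (m ∷ []) Γ w * B         ≤⟨ ℕ.*-monoˡ-≤ B (appearances-sides w) ⟩
  appearances sides (Γ ∘ line) w * B           ≤⟨ bd sides (Γ ∘ line) ⟩
  3 ^ d * A * size sides                       ≡⟨ ≡.cong (3 ^ d * A *_) size-sides ⟩
  3 ^ d * A * size (m ∷ [])                    ≡⟨ ℕ.*-assoc (3 ^ d) A _ ⟩
  3 ^ d * (A * size (m ∷ []))                  ∎)
  where
  open ℕ.≤-Reasoning
  open Stack d m Γ

Stackable≤⇒Stackable : ∀ d w → 1 ≤ d → Stackable≤ d w → Stackable d w
Stackable≤⇒Stackable (suc d) w _ st q@(mkℚ i m′ _) =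
  ≡.subst (λ x → UpperBound (suc d) w ((+ (3 ^ d)) / 1 ℚ.* x) ⇔ UpperBound 1 w x) (ℚ.↥p/↧p≡p q) (go i)
  where
  m : ℕ
  m = suc m′
  c : ℕ
  c = 3 ^ d
  fraction : ∀ A → (+ c) / 1 ℚ.* ((+ A) / m) ≡ (+ (c * A)) / m
  fraction A = ≡.trans (*-/ c (+ A) m) (≡.cong (λ i → i / m) (≡.sym (ℤ.pos-* c A)))
  go : ∀ i → UpperBound (suc d) w ((+ c) / 1 ℚ.* (i / m)) ⇔ UpperBound 1 w (i / m)
  go (+ A) = mk⇔
    (λ ub → Bounded⇒UpperBound 1 w A m (Bounded-stack d w A m
              (UpperBound⇒Bounded (suc d) w (c * A) m (≡.subst (UpperBound (suc d) w) (fraction A) ub))))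
    (λ ub → ≡.subst (UpperBound (suc d) w) (≡.sym (fraction A))
              (Bounded⇒UpperBound (suc d) w (c * A) m (st A m (UpperBound⇒Bounded 1 w A m ub))))
  go -[1+ k ] = mk⇔
    (λ ub → ⊥-elim (¬UpperBound-negative (suc d) w c k m {{ℕ.m^n≢0 3 d}} (≡.subst (UpperBound (suc d) w) (*-/ c -[1+ k ] m) ub)))
    (λ ub → ⊥-elim (¬UpperBound-negative 1 w 1 k m
              (≡.subst (λ i → UpperBound 1 w (i / m)) (≡.sym (ℤ.*-identityˡ -[1+ k ])) ub)))

-- Measure-preserving walks are bounded by the one-dimensional concentration.

∑-upTo-mono : ∀ n {f g : ℕ → ℕ} → (∀ t → t < n → f t ≤ g t) → ∑ (upTo n) f ≤ ∑ (upTo n) g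
∑-upTo-mono zero    le = z≤n
∑-upTo-mono (suc n) {f} {g} le = begin
  ∑ (upTo (suc n)) f            ≡⟨ ∑-upTo-head n f ⟩
  f 0 + ∑ (upTo n) (f ∘ suc)    ≤⟨ ℕ.+-mono-≤ (le 0 (s≤s z≤n)) (∑-upTo-mono n (λ t t<n → le (suc t) (s≤s t<n))) ⟩
  g 0 + ∑ (upTo n) (g ∘ suc)    ≡⟨ ∑-upTo-head n g ⟨
  ∑ (upTo (suc n)) g            ∎
  where open ℕ.≤-Reasoning

∑-upTo-prefix : ∀ k n (f : ℕ → ℕ) → ∑ (upTo n) f ≤ ∑ (upTo (k + n)) f
∑-upTo-prefix zero    n f = ℕ.≤-refl
∑-upTo-prefix (suc k) n f = begin
  ∑ (upTo n) f                    ≤⟨ ∑-upTo-prefix k n f ⟩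
  ∑ (upTo (k + n)) f              ≤⟨ ℕ.m≤m+n _ (f (k + n)) ⟩
  ∑ (upTo (k + n)) f + f (k + n)  ≡⟨ ∑-upTo-last (k + n) f ⟨
  ∑ (upTo (suc k + n)) f          ∎
  where open ℕ.≤-Reasoning

∑-line : ∀ m (f : Pos (m ∷ []) → ℕ) → ∑ (allPos (m ∷ [])) f ≡ ∑ (upTo (suc m)) (λ t → f (t mod suc m , tt))
∑-line m f = ≡.trans (∑-allPos m [] f) (∑-allFin (suc m) _ _
  (λ i → ≡.trans (ℕ.+-identityʳ _) (≡.cong (λ j → f (j , tt)) (≡.sym (mod-toℕ i)))))

-- The hypothesis `inv` says, through test functions, that `π` preserves the measure with density
-- `g`. The density is there for the bouncing walk, whose states are all pairs of a cell and a
-- direction but whose measure lives on bichromatic edges.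
module Walk {S : Set} (E : List S) (g : S → ℕ) (π : S → S) (lab : S → ℕ)
            (inv : ∀ (f : S → ℕ) → ∑ E (λ s → g s * f (π s)) ≡ ∑ E (λ s → g s * f s)) where

  visits : Word → ℕ
  visits w = ∑ E (λ s → g s * ⟦ reads π lab s w ⟧)

  inv-iter : ∀ n (f : S → ℕ) → ∑ E (λ s → g s * f (iter π n s)) ≡ ∑ E (λ s → g s * f s)
  inv-iter zero    f = ≡.refl
  inv-iter (suc n) f = ≡.trans (inv (f ∘ iter π n)) (inv-iter n f)

  track : ∀ {m} → S → Pos (m ∷ []) → ℕ
  track s (t , _) = lab (iter π (toℕ t) s)

  -- The first `suc m` labels of the walk are wound up to a cycle; a reading that ends before the
  -- seam does not notice the difference.
  reads-track : ∀ m s w t → t + length w ≤ m →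
                reads (step (pos ∷ [])) (track {m} s) (t mod suc m , tt) w ≡ reads π lab (iter π t s) w
  reads-track m s []      t le = ≡.refl
  reads-track m s (a ∷ w) t le = ≡.cong₂ _∧_
    (≡.cong (λ n → lab (iter π n s) ≡ᵇ a) toℕ-t)
    (begin
      reads (step (pos ∷ [])) (track s) (advance (t mod suc m) 1 , tt) w
        ≡⟨ ≡.cong (λ i → reads (step (pos ∷ [])) (track s) (i , tt) w) next ⟩
      reads (step (pos ∷ [])) (track s) (suc t mod suc m , tt) w
        ≡⟨ reads-track m s w (suc t) (≡.subst (_≤ m) (ℕ.+-suc t (length w)) le) ⟩
      reads π lab (iter π (suc t) s) w
        ≡⟨ ≡.cong (λ q → reads π lab q w) (iter-comm π t s) ⟩
      reads π lab (π (iter π t s)) w ∎)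
    where
    open ≡.≡-Reasoning
    toℕ-t : toℕ (t mod suc m) ≡ t
    toℕ-t = ≡.trans (toℕ-mod t m) (m<n⇒m%n≡m (s≤s (ℕ.≤-trans (ℕ.m≤m+n t _) le)))
    next : advance (t mod suc m) 1 ≡ suc t mod suc m
    next = ≡.cong (_mod suc m) (≡.trans (≡.cong (_+ 1) toℕ-t) (ℕ.+-comm t 1))

  along-track : ∀ k l s w → length w ≤ l →
    ∑ (upTo k) (λ t → ⟦ reads π lab (iter π t s) w ⟧) ≤ along ((l + k) ∷ []) (track s) (pos ∷ []) w
  along-track k l s w le = begin
    ∑ (upTo k) (λ t → ⟦ reads π lab (iter π t s) w ⟧)
      ≤⟨ ∑-upTo-mono k (λ t t<k → ℕ.≤-reflexive (≡.cong ⟦_⟧ (≡.sym (reads-track (l + k) s w t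
           (ℕ.≤-trans (ℕ.+-mono-≤ (ℕ.<⇒≤ t<k) le) (ℕ.≤-reflexive (ℕ.+-comm k l))))))) ⟩
    ∑ (upTo k) (λ t → ⟦ reads (step (pos ∷ [])) (track s) (t mod suc (l + k) , tt) w ⟧)
      ≤⟨ ∑-upTo-prefix (suc l) k _ ⟩
    ∑ (upTo (suc l + k)) (λ t → ⟦ reads (step (pos ∷ [])) (track s) (t mod suc (l + k) , tt) w ⟧)
      ≡⟨ ∑-line (l + k) _ ⟨
    along ((l + k) ∷ []) (track s) (pos ∷ []) w ∎
    where open ℕ.≤-Reasoning

  -- By invariance the start may be delayed by any `t < k` without changing the count; exchanging
  -- the sums collects the `k` starting times along each trajectory.
  visits-* : ∀ k w → k * visits w ≡ ∑ E (λ s → g s * ∑ (upTo k) (λ t → ⟦ reads π lab (iter π t s) w ⟧))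
  visits-* k w = begin
    k * visits w
      ≡⟨ ∑-upTo-const k (visits w) ⟨
    ∑ (upTo k) (λ t → visits w)
      ≡⟨ ∑-cong (upTo k) (λ t → inv-iter t (λ s → ⟦ reads π lab s w ⟧)) ⟨
    ∑ (upTo k) (λ t → ∑ E (λ s → g s * ⟦ reads π lab (iter π t s) w ⟧))
      ≡⟨ ∑-swap (upTo k) E _ ⟩
    ∑ E (λ s → ∑ (upTo k) (λ t → g s * ⟦ reads π lab (iter π t s) w ⟧))
      ≡⟨ ∑-cong E (λ s → ∑-* (upTo k) (g s) _) ⟩
    ∑ E (λ s → g s * ∑ (upTo k) (λ t → ⟦ reads π lab (iter π t s) w ⟧)) ∎
    where open ≡.≡-Reasoning

  -- Cutting the walk after l + k steps loses only a bounded number of visits, so k can go to infinity.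
  visits-bound : ∀ w A B → Bounded 1 w A B → (visits w + visits (reverse w)) * B ≤ A * ∑ E g
  visits-bound w A B bd = limit ((visits w + visits (reverse w)) * B) (A * ∑ E g) (suc (length w)) bound
    where
    open ℕ.≤-Reasoning
    l : ℕ
    l = length w
    count : ℕ → S → Word → ℕ
    count k s w = ∑ (upTo k) (λ t → ⟦ reads π lab (iter π t s) w ⟧)
    app : ℕ → S → ℕ
    app k s = appearances ((l + k) ∷ []) (track s) w
    bound : ∀ k → k * ((visits w + visits (reverse w)) * B) ≤ A * ∑ E g * (suc l + k)
    bound k = begin
      k * ((visits w + visits (reverse w)) * B)
        ≡⟨ distribute k (visits w) (visits (reverse w)) B ⟩
      (k * visits w + k * visits (reverse w)) * B
        ≡⟨ ≡.cong (_* B) (≡.cong₂ _+_ (visits-* k w) (visits-* k (reverse w))) ⟩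
      (∑ E (λ s → g s * count k s w) + ∑ E (λ s → g s * count k s (reverse w))) * B
        ≡⟨ ≡.cong (_* B) (∑-+ E _ _) ⟨
      ∑ E (λ s → g s * count k s w + g s * count k s (reverse w)) * B
        ≤⟨ ℕ.*-monoˡ-≤ B (∑-mono E (λ s → begin
             g s * count k s w + g s * count k s (reverse w)
               ≡⟨ ℕ.*-distribˡ-+ (g s) _ _ ⟨
             g s * (count k s w + count k s (reverse w))
               ≤⟨ ℕ.*-monoʳ-≤ (g s) (ℕ.+-mono-≤ (along-track k l s w ℕ.≤-refl)
                    (along-track k l s (reverse w) (ℕ.≤-reflexive (length-reverse w)))) ⟩
             g s * (along ((l + k) ∷ []) (track s) (pos ∷ []) w + along ((l + k) ∷ []) (track s) (pos ∷ []) (reverse w))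
               ≡⟨ ≡.cong (g s *_) (appearances-line (l + k) (track s) w) ⟨
             g s * app k s ∎)) ⟩
      ∑ E (λ s → g s * app k s) * B
        ≡⟨ ∑-*ʳ E _ B ⟨
      ∑ E (λ s → g s * app k s * B)
        ≤⟨ ∑-mono E (λ s → ℕ.≤-trans (ℕ.≤-reflexive (ℕ.*-assoc (g s) _ B))
             (ℕ.*-monoʳ-≤ (g s) (bd ((l + k) ∷ []) (track s)))) ⟩
      ∑ E (λ s → g s * (A * (suc (l + k) * 1)))
        ≡⟨ ∑-*ʳ E g _ ⟩
      ∑ E g * (A * (suc (l + k) * 1))
        ≡⟨ regroup (∑ E g) A (suc (l + k)) ⟩
      A * ∑ E g * (suc l + k) ∎
      where
      distribute : ∀ k x y b → k * ((x + y) * b) ≡ (k * x + k * y) * b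
      distribute = solve-∀
      regroup : ∀ e a n → e * (a * (n * 1)) ≡ a * e * n
      regroup = solve-∀
    limit : ∀ X Y c → (∀ k → k * X ≤ Y * (c + k)) → X ≤ Y
    limit X Y c h = ℕ.≮⇒≥ λ Y<X → ℕ.<-irrefl ≡.refl (ℕ.≤-<-trans (ℕ.≤-trans
        (ℕ.*-monoʳ-≤ k Y<X) (h k)) (ℕ.≤-reflexive (split Y c)))
      where
      -- If `Y < X`, the hypothesis gives `k * suc Y ≤ Y * (c + k)`, that is `k ≤ Y * c`, which the
      -- following `k` violates.
      k : ℕ
      k = suc (Y * c)
      split : ∀ Y c → suc (Y * (c + suc (Y * c))) ≡ suc (Y * c) * suc Y
      split = solve-∀

-- Alternating words and the walk that bounces between colour classes.

Alternates : (ℕ → Bool) → Word → Set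
Alternates par []          = ⊤
Alternates par (a ∷ [])    = ⊤
Alternates par (a ∷ b ∷ w) = (par a xor par b) ≡ true × Alternates par (b ∷ w)

Alternates-ʳ++ : ∀ par x xs ys → Alternates par (x ∷ xs) → Alternates par (x ∷ ys) → Alternates par (xs ʳ++ (x ∷ ys))
Alternates-ʳ++ par x []       ys alt₁ alt₂ = alt₂
Alternates-ʳ++ par x (y ∷ xs) ys (x≠y , alt₁) alt₂ =
  Alternates-ʳ++ par y xs (x ∷ ys) alt₁ (≡.trans (xor-comm (par y) (par x)) x≠y , alt₂)

Alternates-reverse : ∀ par w → Alternates par w → Alternates par (reverse w)
Alternates-reverse par []      alt = tt
Alternates-reverse par (x ∷ w) alt = Alternates-ʳ++ par x w [] alt tt

-- Walk along directed edges whose ends have different classes, turning back where the next edge has equal ends.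
module Bounce {d} (ms : Vec ℕ d) (Γ : Pos ms → ℕ) (par : ℕ → Bool) where

  crosses : Pos ms → Vec Sign d → Bool
  crosses p v = par (Γ p) xor par (Γ (step v p))

  State : Set
  State = Pos ms × Vec Sign d

  states : List State
  states = concatMap (λ p → map (p ,_) (allDirs d)) (allPos ms)

  weight : State → ℕ
  weight (p , v) = ⟦ crosses p v ⟧

  turn : Pos ms → Vec Sign d → Vec Sign d
  turn p v = if crosses p v then v else negate v

  bounce : State → State
  bounce (p , v) = step v p , turn (step v p) v

  ∑-states : ∀ (f : State → ℕ) → ∑ states f ≡ ∑ (allPos ms) (λ p → ∑ (allDirs d) (λ v → f (p , v)))
  ∑-states = ∑-pairs (allPos ms) (allDirs d) _,_

  crosses-back : ∀ q v → crosses (step (negate v) q) v ≡ crosses q (negate v)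
  crosses-back q v = ≡.trans (≡.cong (λ x → par (Γ (step (negate v) q)) xor par (Γ x)) (step-negate v q))
                             (xor-comm (par (Γ (step (negate v) q))) (par (Γ q)))

  -- At one cell, direction `v` is an arrival along a bichromatic edge if `b (negate v)` and a
  -- departure along one if `b v`. A departure `v` comes from the arrival `v` going straight if
  -- `b (negate v)` holds (`onward`), and otherwise from the arrival `negate v` turned back
  -- (`back`). So turning matches arrivals with departures bijectively.
  turn-sum : ∀ (b : Vec Sign d → Bool) (f : Vec Sign d → ℕ) →
    ∑ (allDirs d) (λ v → ⟦ b (negate v) ⟧ * f (if b v then v else negate v)) ≡ ∑ (allDirs d) (λ v → ⟦ b v ⟧ * f v)
  turn-sum b f = begin
    ∑ (allDirs d) (λ v → ⟦ b (negate v) ⟧ * f (if b v then v else negate v))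
      ≡⟨ ∑-cong (allDirs d) split ⟩
    ∑ (allDirs d) (λ v → onward v + back (negate v))
      ≡⟨ ∑-+ (allDirs d) onward (back ∘ negate) ⟩
    ∑ (allDirs d) onward + ∑ (allDirs d) (back ∘ negate)
      ≡⟨ ≡.cong (_+_ (∑ (allDirs d) onward)) (∑-negate d back) ⟩
    ∑ (allDirs d) onward + ∑ (allDirs d) back
      ≡⟨ ∑-+ (allDirs d) onward back ⟨
    ∑ (allDirs d) (λ v → onward v + back v)
      ≡⟨ ∑-cong (allDirs d) join ⟩
    ∑ (allDirs d) (λ v → ⟦ b v ⟧ * f v) ∎
    where
    open ≡.≡-Reasoning
    onward back : Vec Sign d → ℕ
    onward v = ⟦ b v ⟧ * (⟦ b (negate v) ⟧ * f v)
    back v = ⟦ b v ⟧ * (⟦ not (b (negate v)) ⟧ * f v)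
    split : ∀ v → ⟦ b (negate v) ⟧ * f (if b v then v else negate v) ≡ onward v + back (negate v)
    split v rewrite negate-involutive v with b v | b (negate v)
    ... | false | false = ≡.refl
    ... | false | true  = ≡.cong (_+ 0) (≡.sym (ℕ.+-identityʳ _))
    ... | true  | false = ≡.refl
    ... | true  | true  = ≡.sym (≡.trans (ℕ.+-identityʳ _) (ℕ.+-identityʳ _))
    join : ∀ v → onward v + back v ≡ ⟦ b v ⟧ * f v
    join v with b v | b (negate v)
    ... | false | _     = ≡.refl
    ... | true  | false = ℕ.+-identityʳ _
    ... | true  | true  = ≡.trans (ℕ.+-identityʳ _) (ℕ.+-identityʳ _)

  -- An edge is bichromatic seen from either end. Summing over the cell of arrival instead of
  -- departure turns the weight into the arrival condition of `turn-sum`, which then applies cell by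
  -- cell.
  bounce-inv : ∀ (f : State → ℕ) → ∑ states (λ s → weight s * f (bounce s)) ≡ ∑ states (λ s → weight s * f s)
  bounce-inv f = begin
    ∑ states (λ s → weight s * f (bounce s))
      ≡⟨ ∑-states _ ⟩
    ∑ (allPos ms) (λ p → ∑ (allDirs d) (λ v → weight (p , v) * f (bounce (p , v))))
      ≡⟨ ∑-cong (allPos ms) (λ p → ∑-cong (allDirs d) (λ v → ≡.cong (λ b → ⟦ b ⟧ * f (bounce (p , v)))
           (≡.trans (≡.cong (λ q → crosses q v) (≡.sym (step-negate′ v p))) (crosses-back (step v p) v)))) ⟩
    ∑ (allPos ms) (λ p → ∑ (allDirs d) (λ v → H v (step v p)))
      ≡⟨ ∑-swap (allPos ms) (allDirs d) _ ⟩
    ∑ (allDirs d) (λ v → ∑ (allPos ms) (λ p → H v (step v p)))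
      ≡⟨ ∑-cong (allDirs d) (λ v → ∑-step ms v (H v)) ⟩
    ∑ (allDirs d) (λ v → ∑ (allPos ms) (H v))
      ≡⟨ ∑-swap (allDirs d) (allPos ms) H ⟩
    ∑ (allPos ms) (λ q → ∑ (allDirs d) (λ v → H v q))
      ≡⟨ ∑-cong (allPos ms) (λ q → turn-sum (crosses q) (λ v → f (q , v))) ⟩
    ∑ (allPos ms) (λ q → ∑ (allDirs d) (λ v → weight (q , v) * f (q , v)))
      ≡⟨ ∑-states _ ⟨
    ∑ states (λ s → weight s * f s) ∎
    where
    open ≡.≡-Reasoning
    H : Vec Sign d → Pos ms → ℕ
    H v q = ⟦ crosses q (negate v) ⟧ * f (q , turn q v)

  open Walk states weight bounce (Γ ∘ proj₁) bounce-inv public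

  -- Along an appearance of an alternating word every edge between consecutive letters is
  -- bichromatic, so the walk goes straight. Beyond the last letter it may turn, which the reading
  -- does not see; this is why two letters form a base case.
  reads-bounce : ∀ w p v → Alternates par w → reads (step v) Γ p w ≡ true → reads bounce (Γ ∘ proj₁) (p , v) w ≡ true
  reads-bounce []           p v alt r = ≡.refl
  reads-bounce (a ∷ [])     p v alt r = r
  reads-bounce (a ∷ b ∷ []) p v alt r = r
  reads-bounce (a ∷ b ∷ c ∷ w) p v (_ , alt@(b≠c , _)) r = ∧-join (proj₁ (∧-split {Γ p ≡ᵇ a} r))
      (≡.subst (λ u → reads bounce (Γ ∘ proj₁) (step v p , u) (b ∷ c ∷ w) ≡ true) (≡.sym straight)
        (reads-bounce (b ∷ c ∷ w) (step v p) v alt r′))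
    where
    r′ : reads (step v) Γ (step v p) (b ∷ c ∷ w) ≡ true
    r′ = proj₂ (∧-split {Γ p ≡ᵇ a} r)
    straight : turn (step v p) v ≡ v
    straight with Γq≡b , r″ ← ∧-split {Γ (step v p) ≡ᵇ b} r′
             with Γr≡c , _  ← ∧-split {Γ (step v (step v p)) ≡ᵇ c} r″
      rewrite ≡ᵇ⇒≡ {Γ (step v p)} Γq≡b | ≡ᵇ⇒≡ {Γ (step v (step v p))} Γr≡c | b≠c = ≡.refl

  -- The first two letters show that the first edge is bichromatic, which gives the starting state
  -- weight 1.
  appearances≤visits : ∀ a b w → Alternates par (a ∷ b ∷ w) → appearances ms Γ (a ∷ b ∷ w) ≤ visits (a ∷ b ∷ w)
  appearances≤visits a b w alt@(a≠b , _) = begin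
    appearances ms Γ u
      ≡⟨ appearances≡ ms Γ u ⟩
    ∑ (allPos ms) (λ p → ∑ (allDirs d) (λ v → ⟦ nonzero v ∧ reads (step v) Γ p u ⟧))
      ≤⟨ ∑-mono (allPos ms) (λ p → ∑-mono (allDirs d) (λ v → ℕ.≤-trans (⟦⟧-mono (term p v))
           (ℕ.≤-reflexive (⟦∧⟧ (crosses p v) _)))) ⟩
    ∑ (allPos ms) (λ p → ∑ (allDirs d) (λ v → ⟦ crosses p v ⟧ * ⟦ reads bounce (Γ ∘ proj₁) (p , v) u ⟧))
      ≡⟨ ∑-states _ ⟨
    visits u ∎
    where
    open ℕ.≤-Reasoning
    u : Word
    u = a ∷ b ∷ w
    term : ∀ p v → nonzero v ∧ reads (step v) Γ p u ≡ true →
           crosses p v ∧ reads bounce (Γ ∘ proj₁) (p , v) u ≡ true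
    term p v h with _ , r ← ∧-split {nonzero v} h
               with Γp≡a , r′ ← ∧-split {Γ p ≡ᵇ a} r
               with Γq≡b , _  ← ∧-split {Γ (step v p) ≡ᵇ b} r′ =
      ∧-join (≡.trans (≡.cong₂ (λ x y → par x xor par y) (≡ᵇ⇒≡ {Γ p} Γp≡a) (≡ᵇ⇒≡ {Γ (step v p)} Γq≡b)) a≠b)
             (reads-bounce u p v alt r)

-- The spectral bound for the sum of all translations by directions.

∑ᶻ-mono : ∀ {A : Set} (xs : List A) {f g : A → ℤ} → (∀ x → f x ℤ.≤ g x) → ∑ᶻ xs f ℤ.≤ ∑ᶻ xs g
∑ᶻ-mono []       le = ℤ.≤-refl
∑ᶻ-mono (x ∷ xs) le = ℤ.+-mono-≤ (le x) (∑ᶻ-mono xs le)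

∑ᶻ-allDirs : ∀ d (f : Vec Sign (suc d) → ℤ) →
             ∑ᶻ (allDirs (suc d)) f ≡ ∑ᶻ (neg ∷ zer ∷ pos ∷ []) (λ s → ∑ᶻ (allDirs d) (λ v → f (s ∷ v)))
∑ᶻ-allDirs d f = ∑ᶻ-pairs (neg ∷ zer ∷ pos ∷ []) (allDirs d) _∷_ f

-- The bilinear form of the operator p ↦ Σ_v h (p + v). The zero direction is included, which is
-- what makes the operator a tensor power of I + S + S⁻¹.
corr : ∀ {d} (ms : Vec ℕ d) → (Pos ms → ℤ) → (Pos ms → ℤ) → ℤ
corr {d} ms f h = ∑ᶻ (allPos ms) (λ p → ∑ᶻ (allDirs d) (λ v → f p ℤ.* h (step v p)))

norm² : ∀ {d} (ms : Vec ℕ d) → (Pos ms → ℤ) → ℤ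
norm² ms f = ∑ᶻ (allPos ms) (λ p → f p ℤ.* f p)

module _ {d} (ms : Vec ℕ d) (f h : Pos ms → ℤ) where

  private
    ∑∑ : (Pos ms → Vec Sign d → ℤ) → ℤ
    ∑∑ F = ∑ᶻ (allPos ms) (λ p → ∑ᶻ (allDirs d) (F p))

    ∑∑-+ : ∀ F G → ∑∑ (λ p v → F p v ℤ.+ G p v) ≡ ∑∑ F ℤ.+ ∑∑ G
    ∑∑-+ F G = ≡.trans (∑ᶻ-cong (allPos ms) (λ p → ∑ᶻ-+ (allDirs d) (F p) (G p))) (∑ᶻ-+ (allPos ms) _ _)

    ∑∑-* : ∀ c F → ∑∑ (λ p v → c ℤ.* F p v) ≡ c ℤ.* ∑∑ F
    ∑∑-* c F = ≡.trans (∑ᶻ-cong (allPos ms) (λ p → ∑ᶻ-* (allDirs d) c (F p))) (∑ᶻ-* (allPos ms) c _)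

    ∑∑-cong : ∀ {F G} → (∀ p v → F p v ≡ G p v) → ∑∑ F ≡ ∑∑ G
    ∑∑-cong eq = ∑ᶻ-cong (allPos ms) (λ p → ∑ᶻ-cong (allDirs d) (eq p))

  -- Diagonalisation of the matrix with rows (2, 4) and (4, 2): its eigenvectors (1, 1) and (1, -1)
  -- have eigenvalues 6 and -2, and squared length 2 halves these to the coefficients 3 and -1.
  corr-polar : (+ 3) ℤ.* corr ms (λ p → f p ℤ.+ h p) (λ p → f p ℤ.+ h p) ℤ.- corr ms (λ p → f p ℤ.- h p) (λ p → f p ℤ.- h p)
             ≡ (+ 2) ℤ.* corr ms f f ℤ.+ (+ 2) ℤ.* corr ms h h ℤ.+ (+ 4) ℤ.* corr ms f h ℤ.+ (+ 4) ℤ.* corr ms h f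
  corr-polar = begin
    (+ 3) ℤ.* ∑∑ PP ℤ.- ∑∑ MM
      ≡⟨ shape (∑∑ PP) (∑∑ MM) ⟩
    (+ 3) ℤ.* ∑∑ PP ℤ.+ (- (+ 1)) ℤ.* ∑∑ MM
      ≡⟨ ≡.cong₂ ℤ._+_ (∑∑-* (+ 3) PP) (∑∑-* (- (+ 1)) MM) ⟨
    ∑∑ (λ p v → (+ 3) ℤ.* PP p v) ℤ.+ ∑∑ (λ p v → (- (+ 1)) ℤ.* MM p v)
      ≡⟨ ∑∑-+ _ _ ⟨
    ∑∑ (λ p v → (+ 3) ℤ.* PP p v ℤ.+ (- (+ 1)) ℤ.* MM p v)
      ≡⟨ ∑∑-cong (λ p v → expand (f p) (h p) (f (step v p)) (h (step v p))) ⟩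
    ∑∑ (λ p v → (+ 2) ℤ.* FF p v ℤ.+ (+ 2) ℤ.* HH p v ℤ.+ (+ 4) ℤ.* FH p v ℤ.+ (+ 4) ℤ.* HF p v)
      ≡⟨ ≡.trans (∑∑-+ _ _) (≡.cong (ℤ._+ ∑∑ (λ p v → (+ 4) ℤ.* HF p v))
           (≡.trans (∑∑-+ _ _) (≡.cong (ℤ._+ ∑∑ (λ p v → (+ 4) ℤ.* FH p v)) (∑∑-+ _ _)))) ⟩
    ∑∑ (λ p v → (+ 2) ℤ.* FF p v) ℤ.+ ∑∑ (λ p v → (+ 2) ℤ.* HH p v) ℤ.+ ∑∑ (λ p v → (+ 4) ℤ.* FH p v) ℤ.+ ∑∑ (λ p v → (+ 4) ℤ.* HF p v)
      ≡⟨ ≡.cong₂ ℤ._+_ (≡.cong₂ ℤ._+_ (≡.cong₂ ℤ._+_ (∑∑-* (+ 2) FF) (∑∑-* (+ 2) HH)) (∑∑-* (+ 4) FH)) (∑∑-* (+ 4) HF) ⟩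
    (+ 2) ℤ.* ∑∑ FF ℤ.+ (+ 2) ℤ.* ∑∑ HH ℤ.+ (+ 4) ℤ.* ∑∑ FH ℤ.+ (+ 4) ℤ.* ∑∑ HF ∎
    where
    open ≡.≡-Reasoning
    PP MM FF HH FH HF : Pos ms → Vec Sign d → ℤ
    PP p v = (f p ℤ.+ h p) ℤ.* (f (step v p) ℤ.+ h (step v p))
    MM p v = (f p ℤ.- h p) ℤ.* (f (step v p) ℤ.- h (step v p))
    FF p v = f p ℤ.* f (step v p)
    HH p v = h p ℤ.* h (step v p)
    FH p v = f p ℤ.* h (step v p)
    HF p v = h p ℤ.* f (step v p)
    shape : ∀ x y → (+ 3) ℤ.* x ℤ.- y ≡ (+ 3) ℤ.* x ℤ.+ (- (+ 1)) ℤ.* y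
    shape = ℤ-Solver.solve-∀
    expand : ∀ a b c e → (+ 3) ℤ.* ((a ℤ.+ b) ℤ.* (c ℤ.+ e)) ℤ.+ (- (+ 1)) ℤ.* ((a ℤ.- b) ℤ.* (c ℤ.- e))
                       ≡ (+ 2) ℤ.* (a ℤ.* c) ℤ.+ (+ 2) ℤ.* (b ℤ.* e) ℤ.+ (+ 4) ℤ.* (a ℤ.* e) ℤ.+ (+ 4) ℤ.* (b ℤ.* c)
    expand = ℤ-Solver.solve-∀

  norm²-parallelogram : norm² ms (λ p → f p ℤ.+ h p) ℤ.+ norm² ms (λ p → f p ℤ.- h p)
                      ≡ (+ 2) ℤ.* norm² ms f ℤ.+ (+ 2) ℤ.* norm² ms h
  norm²-parallelogram = begin
    norm² ms (λ p → f p ℤ.+ h p) ℤ.+ norm² ms (λ p → f p ℤ.- h p)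
      ≡⟨ ∑ᶻ-+ (allPos ms) _ _ ⟨
    ∑ᶻ (allPos ms) (λ p → (f p ℤ.+ h p) ℤ.* (f p ℤ.+ h p) ℤ.+ (f p ℤ.- h p) ℤ.* (f p ℤ.- h p))
      ≡⟨ ∑ᶻ-cong (allPos ms) (λ p → expand (f p) (h p)) ⟩
    ∑ᶻ (allPos ms) (λ p → (+ 2) ℤ.* (f p ℤ.* f p) ℤ.+ (+ 2) ℤ.* (h p ℤ.* h p))
      ≡⟨ ∑ᶻ-+ (allPos ms) _ _ ⟩
    ∑ᶻ (allPos ms) (λ p → (+ 2) ℤ.* (f p ℤ.* f p)) ℤ.+ ∑ᶻ (allPos ms) (λ p → (+ 2) ℤ.* (h p ℤ.* h p))
      ≡⟨ ≡.cong₂ ℤ._+_ (∑ᶻ-* (allPos ms) (+ 2) _) (∑ᶻ-* (allPos ms) (+ 2) _) ⟩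
    (+ 2) ℤ.* norm² ms f ℤ.+ (+ 2) ℤ.* norm² ms h ∎
    where
    open ≡.≡-Reasoning
    expand : ∀ a b → (a ℤ.+ b) ℤ.* (a ℤ.+ b) ℤ.+ (a ℤ.- b) ℤ.* (a ℤ.- b) ≡ (+ 2) ℤ.* (a ℤ.* a) ℤ.+ (+ 2) ℤ.* (b ℤ.* b)
    expand = ℤ-Solver.solve-∀

norm²-nonneg : ∀ {d} (ms : Vec ℕ d) f → 0ℤ ℤ.≤ norm² ms f
norm²-nonneg ms f = ≡.subst (ℤ._≤ norm² ms f) (∑ᶻ-0 (allPos ms)) (∑ᶻ-mono (allPos ms) (λ p → square (f p)))
  where
  square : ∀ i → 0ℤ ℤ.≤ i ℤ.* i
  square (+ n)      = ≡.subst (0ℤ ℤ.≤_) (ℤ.pos-* n n) (ℤ.+≤+ z≤n)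
  square ℤ.-[1+ n ] = ℤ.+≤+ z≤n

module _ {d} m (ms : Vec ℕ d) (f : Pos (m ∷ ms) → ℤ) where

  private
    I : List (Fin (suc m))
    I = allFin (suc m)

    slice : Fin (suc m) → Pos ms → ℤ
    slice i p = f (i , p)

    next : Fin (suc m) → Fin (suc m)
    next i = advance i 1

    ∑ᶻ-next : ∀ (F : Fin (suc m) → ℤ) → ∑ᶻ I (F ∘ next) ≡ ∑ᶻ I F
    ∑ᶻ-next F = ∑ᶻ-advance m F 1

    sums diffs : Fin (suc m) → Pos ms → ℤ
    sums i p = slice i p ℤ.+ slice (next i) p
    diffs i p = slice i p ℤ.- slice (next i) p

    X : Fin (suc m) → Fin (suc m) → ℤ
    X i j = corr ms (slice i) (slice j)

    N : Fin (suc m) → ℤ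
    N i = norm² ms (slice i)

  corr-slices : corr (m ∷ ms) f f ≡ ∑ᶻ I (λ i → X i i ℤ.+ X i (next i) ℤ.+ X (next i) i)
  corr-slices = begin
    corr (m ∷ ms) f f
      ≡⟨ ∑ᶻ-allPos m ms _ ⟩
    ∑ᶻ I (λ i → ∑ᶻ (allPos ms) (λ p → ∑ᶻ (allDirs (suc d)) (λ v → f (i , p) ℤ.* f (step v (i , p)))))
      ≡⟨ ∑ᶻ-cong I (λ i → ≡.trans (∑ᶻ-cong (allPos ms) (λ p → ∑ᶻ-allDirs d _))
           (∑ᶻ-swap (allPos ms) signs (λ p s → ∑ᶻ (allDirs d) (λ v → f (i , p) ℤ.* f (step (s ∷ v) (i , p)))))) ⟩
    ∑ᶻ I (λ i → Y neg i ℤ.+ (Y zer i ℤ.+ (Y pos i ℤ.+ 0ℤ)))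
      ≡⟨ ∑ᶻ-cong I (λ i → ≡.cong (λ x → Y neg i ℤ.+ (x ℤ.+ (X i (next i) ℤ.+ 0ℤ))) (≡.cong (X i) (advance-0 i))) ⟩
    ∑ᶻ I (λ i → Y neg i ℤ.+ (X i i ℤ.+ (X i (next i) ℤ.+ 0ℤ)))
      ≡⟨ ∑ᶻ-+ I (Y neg) (λ i → X i i ℤ.+ (X i (next i) ℤ.+ 0ℤ)) ⟩
    ∑ᶻ I (Y neg) ℤ.+ ∑ᶻ I (λ i → X i i ℤ.+ (X i (next i) ℤ.+ 0ℤ))
      ≡⟨ ≡.cong₂ ℤ._+_ (≡.trans (≡.sym (∑ᶻ-next (Y neg))) (∑ᶻ-cong I (λ i → ≡.cong (X (next i)) (back i))))
                     (∑ᶻ-cong I (λ i → ≡.cong (λ x → X i i ℤ.+ x) (ℤ.+-identityʳ _))) ⟩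
    ∑ᶻ I (λ i → X (next i) i) ℤ.+ ∑ᶻ I (λ i → X i i ℤ.+ X i (next i))
      ≡⟨ ℤ.+-comm (∑ᶻ I (λ i → X (next i) i)) _ ⟩
    ∑ᶻ I (λ i → X i i ℤ.+ X i (next i)) ℤ.+ ∑ᶻ I (λ i → X (next i) i)
      ≡⟨ ∑ᶻ-+ I (λ i → X i i ℤ.+ X i (next i)) (λ i → X (next i) i) ⟨
    ∑ᶻ I (λ i → X i i ℤ.+ X i (next i) ℤ.+ X (next i) i) ∎
    where
    open ≡.≡-Reasoning
    signs : List Sign
    signs = neg ∷ zer ∷ pos ∷ []
    Y : Sign → Fin (suc m) → ℤ
    Y s i = X i (advance i (1 ℕ.* signVal m s))
    back : ∀ i → advance (next i) (1 ℕ.* signVal m neg) ≡ i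
    back i = ≡.cong proj₁ (step-negate {ms = m ∷ []} (neg ∷ []) (i , tt))

  -- This is 4 (I + S + S⁻¹) = 3 (I + S)(I + S⁻¹) - (I - S)(I - S⁻¹) in the first coordinate,
  -- tensored with the form on slices. Half of the diagonal terms is moved to the next slice so that
  -- each summand involves one pair of neighbours symmetrically.
  corr-slices-polar : (+ 4) ℤ.* corr (m ∷ ms) f f
                    ≡ ∑ᶻ I (λ i → (+ 3) ℤ.* corr ms (sums i) (sums i) ℤ.- corr ms (diffs i) (diffs i))
  corr-slices-polar = begin
    (+ 4) ℤ.* corr (m ∷ ms) f f
      ≡⟨ ≡.cong ((+ 4) ℤ.*_) corr-slices ⟩
    (+ 4) ℤ.* ∑ᶻ I (λ i → X i i ℤ.+ X i (next i) ℤ.+ X (next i) i)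
      ≡⟨ ≡.cong ((+ 4) ℤ.*_) (≡.trans (∑ᶻ-cong I (λ i → ℤ.+-assoc (X i i) _ _)) (∑ᶻ-+ I D C)) ⟩
    (+ 4) ℤ.* (∑ᶻ I D ℤ.+ ∑ᶻ I C)
      ≡⟨ split (∑ᶻ I D) (∑ᶻ I C) ⟩
    (+ 2) ℤ.* ∑ᶻ I D ℤ.+ ((+ 2) ℤ.* ∑ᶻ I D ℤ.+ (+ 4) ℤ.* ∑ᶻ I C)
      ≡⟨ ≡.cong₂ ℤ._+_ (∑ᶻ-* I (+ 2) D) (≡.cong₂ ℤ._+_ (≡.trans (∑ᶻ-* I (+ 2) (D ∘ next)) (≡.cong ((+ 2) ℤ.*_) (∑ᶻ-next D)))
                                                  (∑ᶻ-* I (+ 4) C)) ⟨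
    ∑ᶻ I (λ i → (+ 2) ℤ.* D i) ℤ.+ (∑ᶻ I (λ i → (+ 2) ℤ.* D (next i)) ℤ.+ ∑ᶻ I (λ i → (+ 4) ℤ.* C i))
      ≡⟨ ≡.trans (∑ᶻ-+ I (λ i → (+ 2) ℤ.* D i) (λ i → (+ 2) ℤ.* D (next i) ℤ.+ (+ 4) ℤ.* C i))
           (≡.cong (λ x → ∑ᶻ I (λ i → (+ 2) ℤ.* D i) ℤ.+ x) (∑ᶻ-+ I (λ i → (+ 2) ℤ.* D (next i)) (λ i → (+ 4) ℤ.* C i))) ⟨
    ∑ᶻ I (λ i → (+ 2) ℤ.* D i ℤ.+ ((+ 2) ℤ.* D (next i) ℤ.+ (+ 4) ℤ.* C i))
      ≡⟨ ∑ᶻ-cong I (λ i → ≡.trans (join (D i) (D (next i)) (X i (next i)) (X (next i) i))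
                                 (≡.sym (corr-polar ms (slice i) (slice (next i))))) ⟩
    ∑ᶻ I (λ i → (+ 3) ℤ.* corr ms (sums i) (sums i) ℤ.- corr ms (diffs i) (diffs i)) ∎
    where
    open ≡.≡-Reasoning
    D C : Fin (suc m) → ℤ
    D i = X i i
    C i = X i (next i) ℤ.+ X (next i) i
    split : ∀ a b → (+ 4) ℤ.* (a ℤ.+ b) ≡ (+ 2) ℤ.* a ℤ.+ ((+ 2) ℤ.* a ℤ.+ (+ 4) ℤ.* b)
    split = ℤ-Solver.solve-∀
    join : ∀ a b x y → (+ 2) ℤ.* a ℤ.+ ((+ 2) ℤ.* b ℤ.+ (+ 4) ℤ.* (x ℤ.+ y)) ≡ (+ 2) ℤ.* a ℤ.+ (+ 2) ℤ.* b ℤ.+ (+ 4) ℤ.* x ℤ.+ (+ 4) ℤ.* y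
    join = ℤ-Solver.solve-∀

  -- The companion identity 4 I = (I + S)(I + S⁻¹) + (I - S)(I - S⁻¹).
  norm²-slices : (+ 4) ℤ.* norm² (m ∷ ms) f ≡ ∑ᶻ I (λ i → norm² ms (sums i) ℤ.+ norm² ms (diffs i))
  norm²-slices = begin
    (+ 4) ℤ.* norm² (m ∷ ms) f
      ≡⟨ ≡.cong ((+ 4) ℤ.*_) (∑ᶻ-allPos m ms _) ⟩
    (+ 4) ℤ.* ∑ᶻ I N
      ≡⟨ split (∑ᶻ I N) ⟩
    (+ 2) ℤ.* ∑ᶻ I N ℤ.+ (+ 2) ℤ.* ∑ᶻ I N
      ≡⟨ ≡.cong₂ ℤ._+_ (∑ᶻ-* I (+ 2) N) (≡.trans (∑ᶻ-* I (+ 2) (N ∘ next)) (≡.cong ((+ 2) ℤ.*_) (∑ᶻ-next N))) ⟨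
    ∑ᶻ I (λ i → (+ 2) ℤ.* N i) ℤ.+ ∑ᶻ I (λ i → (+ 2) ℤ.* N (next i))
      ≡⟨ ∑ᶻ-+ I (λ i → (+ 2) ℤ.* N i) (λ i → (+ 2) ℤ.* N (next i)) ⟨
    ∑ᶻ I (λ i → (+ 2) ℤ.* N i ℤ.+ (+ 2) ℤ.* N (next i))
      ≡⟨ ∑ᶻ-cong I (λ i → norm²-parallelogram ms (slice i) (slice (next i))) ⟨
    ∑ᶻ I (λ i → norm² ms (sums i) ℤ.+ norm² ms (diffs i)) ∎
    where
    open ≡.≡-Reasoning
    split : ∀ a → (+ 4) ℤ.* a ≡ (+ 2) ℤ.* a ℤ.+ (+ 2) ℤ.* a
    split = ℤ-Solver.solve-∀

pow3 : ℕ → ℤ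
pow3 zero    = + 1
pow3 (suc d) = (+ 3) ℤ.* pow3 d

pow3-nonneg : ∀ d → 0ℤ ℤ.≤ pow3 d
pow3-nonneg zero    = ℤ.+≤+ z≤n
pow3-nonneg (suc d) = ℤ.*-monoˡ-≤-nonNeg (+ 3) (pow3-nonneg d)

-- The form corr is the d-fold tensor power of a form with spectrum in [-1, 3], so its spectrum lies in [-3^{d-1}, 3^d].
corr-bounds : ∀ {d} (ms : Vec ℕ d) f →
  (- (pow3 d ℤ.* norm² ms f) ℤ.≤ (+ 3) ℤ.* corr ms f f) × (corr ms f f ℤ.≤ pow3 d ℤ.* norm² ms f)
corr-bounds [] f = lower , ℤ.≤-reflexive (upper (f tt))
  where
  x² : ℤ
  x² = norm² [] f
  upper : ∀ x → x ℤ.* x ℤ.+ 0ℤ ℤ.+ 0ℤ ≡ (+ 1) ℤ.* (x ℤ.* x ℤ.+ 0ℤ)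
  upper = ℤ-Solver.solve-∀
  -- In dimension 0 the lower end -3^{d-1} is -1/3; the factor 3 on `corr` keeps it integral. The
  -- two sides differ by 4 x².
  lower : - ((+ 1) ℤ.* x²) ℤ.≤ (+ 3) ℤ.* corr [] f f
  lower = ℤ.0≤i-j⇒j≤i (≡.subst (0ℤ ℤ.≤_) (diff (f tt)) (ℤ.*-monoˡ-≤-nonNeg (+ 4) (norm²-nonneg [] f)))
    where
    diff : ∀ x → (+ 4) ℤ.* (x ℤ.* x ℤ.+ 0ℤ) ≡ (+ 3) ℤ.* (x ℤ.* x ℤ.+ 0ℤ ℤ.+ 0ℤ) ℤ.- - ((+ 1) ℤ.* (x ℤ.* x ℤ.+ 0ℤ))
    diff = ℤ-Solver.solve-∀
corr-bounds {suc d} (m ∷ ms) f = lower , upper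
  where
  open ℤ.≤-Reasoning
  I : List (Fin (suc m))
  I = allFin (suc m)
  sums diffs : Fin (suc m) → Pos ms → ℤ
  sums i p = f (i , p) ℤ.+ f (advance i 1 , p)
  diffs i p = f (i , p) ℤ.- f (advance i 1 , p)
  T₊ T₋ N₊ N₋ : Fin (suc m) → ℤ
  T₊ i = corr ms (sums i) (sums i)
  T₋ i = corr ms (diffs i) (diffs i)
  N₊ i = norm² ms (sums i)
  N₋ i = norm² ms (diffs i)
  c : ℤ
  c = pow3 d
  c*norm² : ∀ k → ∑ᶻ I (λ i → k ℤ.* (N₊ i ℤ.+ N₋ i)) ≡ (+ 4) ℤ.* (k ℤ.* norm² (m ∷ ms) f)
  c*norm² k = ≡.trans (∑ᶻ-* I k (λ i → N₊ i ℤ.+ N₋ i)) (≡.trans (≡.cong (k ℤ.*_) (≡.sym (norm²-slices m ms f))) (comm k (norm² (m ∷ ms) f)))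
    where
    comm : ∀ k n → k ℤ.* ((+ 4) ℤ.* n) ≡ (+ 4) ℤ.* (k ℤ.* n)
    comm = ℤ-Solver.solve-∀
  nonneg* : ∀ {i j} → 0ℤ ℤ.≤ i → 0ℤ ℤ.≤ j → 0ℤ ℤ.≤ i ℤ.* j
  nonneg* {+ a} {+ b} _ _ = ≡.subst (0ℤ ℤ.≤_) (ℤ.pos-* a b) (ℤ.+≤+ z≤n)
  -- The minus sign before `T₋` calls for the upper bound on differences, as it calls for their
  -- lower bound in `upper-term`; hence both bounds are proved together.
  lower-term : ∀ i → (- ((+ 3) ℤ.* c)) ℤ.* (N₊ i ℤ.+ N₋ i) ℤ.≤ (+ 3) ℤ.* ((+ 3) ℤ.* T₊ i ℤ.- T₋ i)
  lower-term i = begin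
    (- ((+ 3) ℤ.* c)) ℤ.* (N₊ i ℤ.+ N₋ i)                      ≡⟨ shape c (N₊ i) (N₋ i) ⟩
    (+ 3) ℤ.* (- (c ℤ.* N₊ i)) ℤ.+ (- (+ 3)) ℤ.* (c ℤ.* N₋ i)
      ≤⟨ ℤ.+-mono-≤ (ℤ.*-monoˡ-≤-nonNeg (+ 3) (proj₁ (corr-bounds ms (sums i))))
                    (ℤ.*-monoˡ-≤-nonPos (- (+ 3)) (proj₂ (corr-bounds ms (diffs i)))) ⟩
    (+ 3) ℤ.* ((+ 3) ℤ.* T₊ i) ℤ.+ (- (+ 3)) ℤ.* T₋ i            ≡⟨ join (T₊ i) (T₋ i) ⟩
    (+ 3) ℤ.* ((+ 3) ℤ.* T₊ i ℤ.- T₋ i)                        ∎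
    where
    shape : ∀ c a b → (- ((+ 3) ℤ.* c)) ℤ.* (a ℤ.+ b) ≡ (+ 3) ℤ.* (- (c ℤ.* a)) ℤ.+ (- (+ 3)) ℤ.* (c ℤ.* b)
    shape = ℤ-Solver.solve-∀
    join : ∀ x y → (+ 3) ℤ.* ((+ 3) ℤ.* x) ℤ.+ (- (+ 3)) ℤ.* y ≡ (+ 3) ℤ.* ((+ 3) ℤ.* x ℤ.- y)
    join = ℤ-Solver.solve-∀
  lower : - (pow3 (suc d) ℤ.* norm² (m ∷ ms) f) ℤ.≤ (+ 3) ℤ.* corr (m ∷ ms) f f
  lower = ℤ.*-cancelˡ-≤-pos _ _ (+ 4) (begin
    (+ 4) ℤ.* - ((+ 3) ℤ.* c ℤ.* norm² (m ∷ ms) f)             ≡⟨ ≡.cong ((+ 4) ℤ.*_) (ℤ.neg-distribˡ-* ((+ 3) ℤ.* c) _) ⟩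
    (+ 4) ℤ.* ((- ((+ 3) ℤ.* c)) ℤ.* norm² (m ∷ ms) f)         ≡⟨ c*norm² (- ((+ 3) ℤ.* c)) ⟨
    ∑ᶻ I (λ i → (- ((+ 3) ℤ.* c)) ℤ.* (N₊ i ℤ.+ N₋ i))          ≤⟨ ∑ᶻ-mono I lower-term ⟩
    ∑ᶻ I (λ i → (+ 3) ℤ.* ((+ 3) ℤ.* T₊ i ℤ.- T₋ i))            ≡⟨ ∑ᶻ-* I (+ 3) (λ i → (+ 3) ℤ.* T₊ i ℤ.- T₋ i) ⟩
    (+ 3) ℤ.* ∑ᶻ I (λ i → (+ 3) ℤ.* T₊ i ℤ.- T₋ i)              ≡⟨ ≡.cong ((+ 3) ℤ.*_) (corr-slices-polar m ms f) ⟨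
    (+ 3) ℤ.* ((+ 4) ℤ.* corr (m ∷ ms) f f)                  ≡⟨ comm (corr (m ∷ ms) f f) ⟩
    (+ 4) ℤ.* ((+ 3) ℤ.* corr (m ∷ ms) f f)                  ∎)
    where
    comm : ∀ x → (+ 3) ℤ.* ((+ 4) ℤ.* x) ≡ (+ 4) ℤ.* ((+ 3) ℤ.* x)
    comm = ℤ-Solver.solve-∀
  i≤i+j : ∀ {i j} → 0ℤ ℤ.≤ j → i ℤ.≤ i ℤ.+ j
  i≤i+j {i} {j} 0≤j = ≡.subst (λ x → x ℤ.≤ i ℤ.+ j) (ℤ.+-identityʳ i) (ℤ.+-monoʳ-≤ i 0≤j)
  -- The induction hypotheses give 9 c N₊ + c N₋; adding 8 c N₋ ≥ 0 makes the two coefficients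
  -- equal.
  upper-term : ∀ i → (+ 3) ℤ.* ((+ 3) ℤ.* T₊ i ℤ.- T₋ i) ℤ.≤ (+ 3) ℤ.* ((+ 3) ℤ.* c ℤ.* (N₊ i ℤ.+ N₋ i))
  upper-term i = begin
    (+ 3) ℤ.* ((+ 3) ℤ.* T₊ i ℤ.- T₋ i)                        ≡⟨ shape (T₊ i) (T₋ i) ⟩
    (+ 9) ℤ.* T₊ i ℤ.- (+ 3) ℤ.* T₋ i
      ≤⟨ ℤ.+-mono-≤ (ℤ.*-monoˡ-≤-nonNeg (+ 9) (proj₂ (corr-bounds ms (sums i))))
                    (ℤ.neg-mono-≤ (proj₁ (corr-bounds ms (diffs i)))) ⟩
    (+ 9) ℤ.* (c ℤ.* N₊ i) ℤ.- - (c ℤ.* N₋ i)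
      ≤⟨ i≤i+j (ℤ.*-monoˡ-≤-nonNeg (+ 8) (nonneg* (pow3-nonneg d) (norm²-nonneg ms (diffs i)))) ⟩
    (+ 9) ℤ.* (c ℤ.* N₊ i) ℤ.- - (c ℤ.* N₋ i) ℤ.+ (+ 8) ℤ.* (c ℤ.* N₋ i)   ≡⟨ join c (N₊ i) (N₋ i) ⟩
    (+ 3) ℤ.* ((+ 3) ℤ.* c ℤ.* (N₊ i ℤ.+ N₋ i))                  ∎
    where
    shape : ∀ x y → (+ 3) ℤ.* ((+ 3) ℤ.* x ℤ.- y) ≡ (+ 9) ℤ.* x ℤ.- (+ 3) ℤ.* y
    shape = ℤ-Solver.solve-∀
    join : ∀ c a b → (+ 9) ℤ.* (c ℤ.* a) ℤ.- - (c ℤ.* b) ℤ.+ (+ 8) ℤ.* (c ℤ.* b) ≡ (+ 3) ℤ.* ((+ 3) ℤ.* c ℤ.* (a ℤ.+ b))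
    join = ℤ-Solver.solve-∀
  upper : corr (m ∷ ms) f f ℤ.≤ pow3 (suc d) ℤ.* norm² (m ∷ ms) f
  upper = ℤ.*-cancelˡ-≤-pos _ _ (+ 12) (begin
    (+ 12) ℤ.* corr (m ∷ ms) f f                           ≡⟨ comm (corr (m ∷ ms) f f) ⟩
    (+ 3) ℤ.* ((+ 4) ℤ.* corr (m ∷ ms) f f)                  ≡⟨ ≡.cong ((+ 3) ℤ.*_) (corr-slices-polar m ms f) ⟩
    (+ 3) ℤ.* ∑ᶻ I (λ i → (+ 3) ℤ.* T₊ i ℤ.- T₋ i)              ≡⟨ ∑ᶻ-* I (+ 3) (λ i → (+ 3) ℤ.* T₊ i ℤ.- T₋ i) ⟨
    ∑ᶻ I (λ i → (+ 3) ℤ.* ((+ 3) ℤ.* T₊ i ℤ.- T₋ i))            ≤⟨ ∑ᶻ-mono I upper-term ⟩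
    ∑ᶻ I (λ i → (+ 3) ℤ.* ((+ 3) ℤ.* c ℤ.* (N₊ i ℤ.+ N₋ i)))      ≡⟨ ∑ᶻ-* I (+ 3) (λ i → (+ 3) ℤ.* c ℤ.* (N₊ i ℤ.+ N₋ i)) ⟩
    (+ 3) ℤ.* ∑ᶻ I (λ i → (+ 3) ℤ.* c ℤ.* (N₊ i ℤ.+ N₋ i))        ≡⟨ ≡.cong ((+ 3) ℤ.*_) (c*norm² ((+ 3) ℤ.* c)) ⟩
    (+ 3) ℤ.* ((+ 4) ℤ.* ((+ 3) ℤ.* c ℤ.* norm² (m ∷ ms) f))     ≡⟨ comm ((+ 3) ℤ.* c ℤ.* norm² (m ∷ ms) f) ⟨
    (+ 12) ℤ.* ((+ 3) ℤ.* c ℤ.* norm² (m ∷ ms) f)              ∎)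
    where
    comm : ∀ x → (+ 12) ℤ.* x ≡ (+ 3) ℤ.* ((+ 4) ℤ.* x)
    comm = ℤ-Solver.solve-∀

-- Counting bichromatic edges.

pos-∑ : ∀ {A : Set} (xs : List A) f → + ∑ xs f ≡ ∑ᶻ xs (λ x → + f x)
pos-∑ []       f = ≡.refl
pos-∑ (x ∷ xs) f = ≡.trans (ℤ.pos-+ (f x) (∑ xs f)) (≡.cong (λ i → + f x ℤ.+ i) (pos-∑ xs f))

pow3≡ : ∀ d → pow3 d ≡ + (3 ^ d)
pow3≡ zero    = ≡.refl
pow3≡ (suc d) = ≡.trans (≡.cong (λ i → + 3 ℤ.* i) (pow3≡ d)) (≡.sym (ℤ.pos-* 3 (3 ^ d)))

module _ {d} (ms : Vec ℕ d) (c : Pos ms → Bool) where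

  -- Edges are directed here: each bichromatic edge is counted from both of its ends, and the zero
  -- direction contributes nothing.
  cut : ℕ
  cut = ∑ (allPos ms) (λ p → ∑ (allDirs d) (λ v → ⟦ c p xor c (step v p) ⟧))

  private
    spin : Bool → ℤ
    spin false = + 1
    spin true  = - (+ 1)

    f : Pos ms → ℤ
    f = spin ∘ c

    spin² : ∀ b → spin b ℤ.* spin b ≡ + 1
    spin² false = ≡.refl
    spin² true  = ≡.refl

    spin-* : ∀ a b → spin a ℤ.* spin b ℤ.+ + (2 * ⟦ a xor b ⟧) ≡ + 1
    spin-* false false = ≡.refl
    spin-* false true  = ≡.refl
    spin-* true  false = ≡.refl
    spin-* true  true  = ≡.refl

    norm²-spin : norm² ms f ≡ + size ms
    norm²-spin = begin
      norm² ms f                             ≡⟨ ∑ᶻ-cong (allPos ms) (λ p → spin² (c p)) ⟩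
      ∑ᶻ (allPos ms) (λ _ → + 1)           ≡⟨ pos-∑ (allPos ms) (λ _ → 1) ⟨
      + ∑ (allPos ms) (λ _ → 1)              ≡⟨ ≡.cong +_ (≡.trans (∑-allPos-const ms 1) (ℕ.*-identityʳ _)) ⟩
      + size ms                              ∎
      where open ≡.≡-Reasoning

    corr-spin : corr ms f f ℤ.+ + (2 * cut) ≡ + (size ms * 3 ^ d)
    corr-spin = begin
      corr ms f f ℤ.+ + (2 * cut)
        ≡⟨ ≡.cong (λ i → corr ms f f ℤ.+ i) push ⟩
      corr ms f f ℤ.+ ∑ᶻ (allPos ms) (λ p → ∑ᶻ (allDirs d) (λ v → + (2 * ⟦ c p xor c (step v p) ⟧)))
        ≡⟨ ≡.trans (∑ᶻ-cong (allPos ms) (λ p → ∑ᶻ-+ (allDirs d) _ _)) (∑ᶻ-+ (allPos ms) _ _) ⟨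
      ∑ᶻ (allPos ms) (λ p → ∑ᶻ (allDirs d) (λ v → f p ℤ.* f (step v p) ℤ.+ + (2 * ⟦ c p xor c (step v p) ⟧)))
        ≡⟨ ∑ᶻ-cong (allPos ms) (λ p → ∑ᶻ-cong (allDirs d) (λ v → spin-* (c p) (c (step v p)))) ⟩
      ∑ᶻ (allPos ms) (λ p → ∑ᶻ (allDirs d) (λ v → + 1))
        ≡⟨ ≡.trans (pos-∑ (allPos ms) _) (∑ᶻ-cong (allPos ms) (λ p → pos-∑ (allDirs d) (λ _ → 1))) ⟨
      + ∑ (allPos ms) (λ p → ∑ (allDirs d) (λ v → 1))
        ≡⟨ ≡.cong +_ (≡.trans (∑-allPos-const ms _) (≡.cong (size ms *_) (≡.trans (∑-allDirs-const d 1) (ℕ.*-identityʳ _)))) ⟩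
      + (size ms * 3 ^ d) ∎
      where
      open ≡.≡-Reasoning
      push : + (2 * cut) ≡ ∑ᶻ (allPos ms) (λ p → ∑ᶻ (allDirs d) (λ v → + (2 * ⟦ c p xor c (step v p) ⟧)))
      push = ≡.trans
        (≡.cong +_ (≡.trans (≡.sym (∑-* (allPos ms) 2 _)) (∑-cong (allPos ms) (λ p → ≡.sym (∑-* (allDirs d) 2 _)))))
        (≡.trans (pos-∑ (allPos ms) _) (∑ᶻ-cong (allPos ms) (λ p → pos-∑ (allDirs d) _)))

  -- For spins ±1 every bichromatic pair lowers `corr` by 2 from its maximum 3^d |G|. Since `corr`
  -- is at least -3^{d-1} |G|, at most (3^d + 3^{d-1}) |G| / 2 = 2 · 3^{d-1} |G| pairs are
  -- bichromatic.
  cut-bound : 3 * cut ≤ 2 * (3 ^ d * size ms)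
  cut-bound = ℕ.*-cancelˡ-≤ 2 (ℤ.drop‿+≤+ (begin
    + (2 * (3 * cut))
      ≡⟨ ≡.trans (≡.cong +_ (swap cut)) (ℤ.pos-* 3 (2 * cut)) ⟩
    + 3 ℤ.* + (2 * cut)
      ≡⟨ cancel (corr ms f f) (+ (2 * cut)) ⟩
    + 3 ℤ.* (corr ms f f ℤ.+ + (2 * cut)) ℤ.- + 3 ℤ.* corr ms f f
      ≤⟨ ℤ.+-monoʳ-≤ (+ 3 ℤ.* (corr ms f f ℤ.+ + (2 * cut))) (ℤ.neg-mono-≤ (proj₁ (corr-bounds ms f))) ⟩
    + 3 ℤ.* (corr ms f f ℤ.+ + (2 * cut)) ℤ.- - (pow3 d ℤ.* norm² ms f)
      ≡⟨ ≡.cong₂ (λ x y → + 3 ℤ.* x ℤ.- - y) corr-spin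
           (≡.trans (≡.cong₂ ℤ._*_ (pow3≡ d) norm²-spin) (≡.sym (ℤ.pos-* (3 ^ d) (size ms)))) ⟩
    + 3 ℤ.* + (size ms * 3 ^ d) ℤ.- - + (3 ^ d * size ms)
      ≡⟨ ≡.cong (λ n → + 3 ℤ.* + n ℤ.- - + (3 ^ d * size ms)) (ℕ.*-comm (size ms) (3 ^ d)) ⟩
    + 3 ℤ.* + (3 ^ d * size ms) ℤ.- - + (3 ^ d * size ms)
      ≡⟨ collect (+ (3 ^ d * size ms)) ⟩
    + 4 ℤ.* + (3 ^ d * size ms)
      ≡⟨ ≡.trans (≡.sym (ℤ.pos-* 4 (3 ^ d * size ms))) (≡.cong +_ (ℕ.*-assoc 2 2 (3 ^ d * size ms))) ⟩
    + (2 * (2 * (3 ^ d * size ms))) ∎))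
    where
    open ℤ.≤-Reasoning
    swap : ∀ x → 2 * (3 * x) ≡ 3 * (2 * x)
    swap = solve-∀
    cancel : ∀ x y → + 3 ℤ.* y ≡ + 3 ℤ.* (x ℤ.+ y) ℤ.- + 3 ℤ.* x
    cancel = ℤ-Solver.solve-∀
    collect : ∀ x → + 3 ℤ.* x ℤ.- - x ≡ + 4 ℤ.* x
    collect = ℤ-Solver.solve-∀

-- Appearances are bounded by the visits of the word and also by those of its reversal, so twice
-- their number is at most C_1 times the directed bichromatic edges. The factor 6 consists of this 2
-- and the 3 of `cut-bound`.
alternating⇒Stackable≤ : ∀ d par a b w → Alternates par (a ∷ b ∷ w) → Stackable≤ (suc d) (a ∷ b ∷ w)
alternating⇒Stackable≤ d par a b w alt A B bd ms Γ = ℕ.*-cancelˡ-≤ 6 (begin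
  6 * (appearances ms Γ u * B)
    ≡⟨ expand (appearances ms Γ u) B ⟩
  3 * ((appearances ms Γ u + appearances ms Γ u) * B)
    ≤⟨ ℕ.*-monoʳ-≤ 3 (ℕ.*-monoˡ-≤ B (ℕ.+-mono-≤ (appearances≤visits a b w alt) rev≤)) ⟩
  3 * ((visits u + visits (reverse u)) * B)
    ≤⟨ ℕ.*-monoʳ-≤ 3 (visits-bound u A B bd) ⟩
  3 * (A * ∑ states weight)
    ≡⟨ ≡.cong (λ n → 3 * (A * n)) (∑-states weight) ⟩
  3 * (A * cut ms (par ∘ Γ))
    ≡⟨ swap A (cut ms (par ∘ Γ)) ⟩
  A * (3 * cut ms (par ∘ Γ))
    ≤⟨ ℕ.*-monoʳ-≤ A (cut-bound ms (par ∘ Γ)) ⟩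
  A * (2 * (3 ^ suc d * size ms))
    ≡⟨ regroup A (3 ^ d) (size ms) ⟩
  6 * (3 ^ d * A * size ms) ∎)
  where
  open ℕ.≤-Reasoning
  open Bounce ms Γ par
  u : Word
  u = a ∷ b ∷ w
  visits-reverse : ∀ x → Alternates par x → 2 ≤ length x → appearances ms Γ x ≤ visits x
  visits-reverse (x ∷ [])    alt (s≤s ())
  visits-reverse (x ∷ y ∷ z) alt _ = appearances≤visits x y z alt
  rev≤ : appearances ms Γ u ≤ visits (reverse u)
  rev≤ = ≡.subst (_≤ visits (reverse u)) (appearances-reverse ms Γ u)
    (visits-reverse (reverse u) (Alternates-reverse par u alt)
      (ℕ.≤-trans (s≤s (s≤s z≤n)) (ℕ.≤-reflexive (≡.sym (length-reverse u)))))
  expand : ∀ x y → 6 * (x * y) ≡ 3 * ((x + x) * y)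
  expand = solve-∀
  swap : ∀ x y → 3 * (x * y) ≡ x * (3 * y)
  swap = solve-∀
  regroup : ∀ a k n → a * (2 * (3 * k * n)) ≡ 6 * (k * a * n)
  regroup = solve-∀

-- Colouring letters by the parity of their indices.

module _ (w : Word) (sep : ∀ (i j : Fin (length w)) → lookup w i ≡ lookup w j → toℕ i % 2 ≡ toℕ j % 2) where

  private
    even? : ∀ a → Dec (∃ λ (i : Fin (length w)) → lookup w i ≡ a × toℕ i % 2 ≡ 0)
    even? a = any? (λ i → (lookup w i ℕ.≟ a) ×-dec (toℕ i % 2 ℕ.≟ 0))

  class : ℕ → Bool
  class a = does (even? a)

  class-lookup : ∀ i → class (lookup w i) ≡ does (toℕ i % 2 ℕ.≟ 0)
  class-lookup i = go (toℕ i % 2 ℕ.≟ 0)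
    where
    go : (e? : Dec (toℕ i % 2 ≡ 0)) → class (lookup w i) ≡ does e?
    go (yes e) = dec-true (even? (lookup w i)) (i , ≡.refl , e)
    go (no ¬e) = dec-false (even? (lookup w i)) (λ (j , eq , e) → ¬e (≡.trans (≡.sym (sep j i eq)) e))

  private
    flips : ∀ n → (does (n % 2 ℕ.≟ 0) xor does (suc n % 2 ℕ.≟ 0)) ≡ true
    flips zero          = ≡.refl
    flips (suc zero)    = ≡.refl
    flips (suc (suc n)) = ≡.trans (≡.cong₂ (λ x y → does (x ℕ.≟ 0) xor does (y ℕ.≟ 0)) (period n) (period (suc n))) (flips n)
      where
      period : ∀ n → suc (suc n) % 2 ≡ n % 2
      period n = ≡.trans (≡.cong (_% 2) (ℕ.+-comm 2 n)) ([m+n]%n≡m%n n 2)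

    go : ∀ u k → (∀ (i : Fin (length u)) → class (lookup u i) ≡ does ((k + toℕ i) % 2 ℕ.≟ 0)) → Alternates class u
    go []          k h = tt
    go (a ∷ [])    k h = tt
    go (a ∷ b ∷ u) k h =
      ≡.trans (≡.cong₂ _xor_ (≡.trans (h Fin.zero) (≡.cong even (ℕ.+-identityʳ k)))
                             (≡.trans (h (Fin.suc Fin.zero)) (≡.cong even (ℕ.+-comm k 1)))) (flips k)
      , go (b ∷ u) (suc k) (λ i → ≡.trans (h (Fin.suc i)) (≡.cong even (ℕ.+-suc k (toℕ i))))
      where
      even : ℕ → Bool
      even n = does (n % 2 ℕ.≟ 0)

  class-alternates : Alternates class w
  class-alternates = go w 0 class-lookup

separated⇒Stackable : ∀ (w : Word) → TwoLetters w
      → (∀ (i j : Fin (length w)) → lookup w i ≡ lookup w j → toℕ i % 2 ≡ toℕ j % 2)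
      → ∀ (d : ℕ) → 1 ≤ d → Stackable d w
separated⇒Stackable []       (_ , _ , () , _) sep d 1≤d
separated⇒Stackable (x ∷ []) (_ , _ , here ≡.refl , here ≡.refl , a≢b) sep d 1≤d = ⊥-elim (a≢b ≡.refl)
separated⇒Stackable w@(x ∷ y ∷ z) _ sep (suc d) 1≤d = Stackable≤⇒Stackable (suc d) w 1≤d
  (alternating⇒Stackable≤ d (class w sep) x y z (class-alternates w sep))

-- Stretched words.

∑-upTo-exclusive : ∀ n (P : ℕ → Bool) c → (∀ j → j < n → P j ≡ true → c ≡ true) →
  (∀ i e → i + suc e < n → P i ≡ true → P (i + suc e) ≡ true → ⊥) → ∑ (upTo n) (λ j → ⟦ P j ⟧) ≤ ⟦ c ⟧
∑-upTo-exclusive zero    P c imp exc = z≤n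
∑-upTo-exclusive (suc n) P c imp exc = ℕ.≤-trans (ℕ.≤-reflexive (∑-upTo-head n _)) (go (P 0) ≡.refl)
  where
  open ℕ.≤-Reasoning
  tail : ℕ
  tail = ∑ (upTo n) (λ j → ⟦ P (suc j) ⟧)
  exc′ : ∀ i e → i + suc e < n → P (suc i) ≡ true → P (suc i + suc e) ≡ true → ⊥
  exc′ i e lt = exc (suc i) e (s≤s lt)
  go : ∀ b → P 0 ≡ b → ⟦ P 0 ⟧ + tail ≤ ⟦ c ⟧
  -- Once one condition holds all later ones must fail, which the recursive call expresses by taking
  -- `false` for `c`.
  go true P0 = begin
    ⟦ P 0 ⟧ + tail    ≤⟨ ℕ.+-monoʳ-≤ ⟦ P 0 ⟧ (∑-upTo-exclusive n (P ∘ suc) false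
                           (λ j j<n Pj → ⊥-elim (exc 0 j (s≤s j<n) P0 Pj)) exc′) ⟩
    ⟦ P 0 ⟧ + 0       ≡⟨ ℕ.+-identityʳ _ ⟩
    ⟦ P 0 ⟧           ≤⟨ ⟦⟧-mono (imp 0 (s≤s z≤n)) ⟩
    ⟦ c ⟧             ∎
  go false P0 = begin
    ⟦ P 0 ⟧ + tail    ≡⟨ ≡.cong (λ b → ⟦ b ⟧ + tail) P0 ⟩
    tail              ≤⟨ ∑-upTo-exclusive n (P ∘ suc) c (λ j j<n → imp (suc j) (s≤s j<n)) exc′ ⟩
    ⟦ c ⟧             ∎

-- Each point with P claims the next k points of its orbit, all of which have R; the claims are disjoint.
∑-spread : ∀ {S : Set} (E : List S) (σ τ : S → S) → (∀ s → σ (τ s) ≡ s) →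
  (∀ (f : S → ℕ) → ∑ E (f ∘ τ) ≡ ∑ E f) → ∀ k (P R : S → Bool) →
  (∀ s j → j < k → P s ≡ true → R (iter σ j s) ≡ true) →
  (∀ s e → suc e < k → P s ≡ true → P (iter σ (suc e) s) ≡ true → ⊥) →
  k * ∑ E (λ s → ⟦ P s ⟧) ≤ ∑ E (λ s → ⟦ R s ⟧)
∑-spread E σ τ στ inv k P R imp exc = begin
  k * ∑ E (λ s → ⟦ P s ⟧)
    ≡⟨ ∑-upTo-const k _ ⟨
  ∑ (upTo k) (λ j → ∑ E (λ s → ⟦ P s ⟧))
    ≡⟨ ∑-cong (upTo k) (λ j → ∑-iter E τ inv j (λ s → ⟦ P s ⟧)) ⟨
  ∑ (upTo k) (λ j → ∑ E (λ s → ⟦ P (iter τ j s) ⟧))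
    ≡⟨ ∑-swap (upTo k) E _ ⟩
  ∑ E (λ s → ∑ (upTo k) (λ j → ⟦ P (iter τ j s) ⟧))
    ≤⟨ ∑-mono E (λ s → ∑-upTo-exclusive k (λ j → P (iter τ j s)) (R s)
         (λ j j<k Pj → ≡.subst (λ x → R x ≡ true) (iter-inverse σ τ στ j s) (imp (iter τ j s) j j<k Pj))
         (λ i e lt Pi Pj → exc (iter τ (i + suc e) s) e (ℕ.≤-<-trans (ℕ.m≤n+m (suc e) i) lt) Pj
           (≡.subst (λ x → P x ≡ true) (≡.sym (back s i e)) Pi))) ⟩
  ∑ E (λ s → ⟦ R s ⟧) ∎
  where
  open ℕ.≤-Reasoning
  back : ∀ s i e → iter σ (suc e) (iter τ (i + suc e) s) ≡ iter τ i s
  back s i e = ≡.trans (≡.cong (iter σ (suc e)) (iter-+ τ i (suc e) s)) (iter-inverse σ τ στ (suc e) (iter τ i s))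

module _ {S : Set} (σ : S → S) (lab : S → ℕ) where

  reads-replicate : ∀ n a z s → reads σ lab s (replicate n a ++ z) ≡ true →
    (∀ t → t < n → lab (iter σ t s) ≡ a) × reads σ lab (iter σ n s) z ≡ true
  reads-replicate zero    a z s r = (λ t ()) , r
  reads-replicate (suc n) a z s r with eq , r′ ← ∧-split {lab s ≡ᵇ a} r
                                  with ih , rest ← reads-replicate n a z (σ s) r′ =
    (λ { zero _ → ≡ᵇ⇒≡ {lab s} eq ; (suc t) (s≤s t<n) → ih t t<n }) , rest

  -- Each letter of `stretch k w` fills `k` consecutive cells, so sampling every `k`-th cell from an
  -- offset `j < k` meets each of these blocks exactly once.
  reads-subsample : ∀ k w s j → j < k → reads σ lab s (stretch k w) ≡ true →
                    reads (iter σ k) lab (iter σ j s) w ≡ true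
  reads-subsample k []      s j j<k r = ≡.refl
  reads-subsample k (a ∷ w) s j j<k r with run , rest ← reads-replicate k a (stretch k w) s r =
    ∧-join (≡⇒≡ᵇ (run j j<k))
      (≡.subst (λ q → reads (iter σ k) lab q w ≡ true) swap (reads-subsample k w (iter σ k s) j j<k rest))
    where
    swap : iter σ j (iter σ k s) ≡ iter σ k (iter σ j s)
    swap = ≡.trans (≡.sym (iter-+ σ k j s)) (≡.trans (≡.cong (λ n → iter σ n s) (ℕ.+-comm k j)) (iter-+ σ j k s))

replicate-++ : ∀ m n (a : ℕ) → replicate m a ++ replicate n a ≡ replicate (m + n) a
replicate-++ zero    n a = ≡.refl
replicate-++ (suc m) n a = ≡.cong (a ∷_) (replicate-++ m n a)

stretch-run : ∀ k n a y → stretch k (replicate n a ++ y) ≡ replicate (n * k) a ++ stretch k y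
stretch-run k zero    a y = ≡.refl
stretch-run k (suc n) a y = begin
  replicate k a ++ stretch k (replicate n a ++ y)          ≡⟨ ≡.cong (replicate k a ++_) (stretch-run k n a y) ⟩
  replicate k a ++ (replicate (n * k) a ++ stretch k y)    ≡⟨ ++-assoc (replicate k a) _ _ ⟨
  (replicate k a ++ replicate (n * k) a) ++ stretch k y    ≡⟨ ≡.cong (_++ stretch k y) (replicate-++ k (n * k) a) ⟩
  replicate (k + n * k) a ++ stretch k y                   ∎
  where open ≡.≡-Reasoning

scan : ∀ x w → (∀ a → a ∈ w → a ≡ x) ⊎ (∃[ m ] ∃[ b ] ∃[ z ] (w ≡ replicate m x ++ b ∷ z × b ≢ x))
scan x []      = inj₁ (λ a ())
scan x (y ∷ w) with y ℕ.≟ x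
... | no y≢x = inj₂ (0 , y , w , ≡.refl , y≢x)
... | yes ≡.refl with scan x w
...   | inj₁ all = inj₁ (λ { a (here eq) → eq ; a (there a∈w) → all a a∈w })
...   | inj₂ (m , b , z , ≡.refl , b≢x) = inj₂ (suc m , b , z , ≡.refl , b≢x)

first-run : ∀ w → TwoLetters w → ∃[ a ] ∃[ m ] ∃[ b ] ∃[ z ] (w ≡ replicate (suc m) a ++ b ∷ z × b ≢ a)
first-run []      (_ , _ , () , _)
first-run (x ∷ w) (a , b , a∈ , b∈ , a≢b) with scan x w
... | inj₂ (m , c , z , ≡.refl , c≢x) = x , m , c , z , ≡.refl , c≢x
... | inj₁ all = ⊥-elim (a≢b (≡.trans (all′ a a∈) (≡.sym (all′ b b∈))))
  where
  all′ : ∀ a → a ∈ x ∷ w → a ≡ x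
  all′ a (here eq) = eq
  all′ a (there i) = all a i

-- The first run of equal letters of a stretched word is followed by a different letter; two overlapping
-- appearances at distance less than k would put that letter inside the first run of the later one.
stretch-exclusive : ∀ {S : Set} (σ : S → S) lab k w → TwoLetters w → ∀ s e → suc e < k →
  reads σ lab s (stretch k w) ≡ true → reads σ lab (iter σ (suc e) s) (stretch k w) ≡ true → ⊥
stretch-exclusive {S} σ lab k@(suc k′) w two s e e<k r₁ r₂ with first-run w two
... | a , m , b , z , ≡.refl , b≢a = b≢a (≡.trans (≡.sym at-b) at-a)
  where
  M : ℕ
  M = suc m * k
  split : ∀ s → reads σ lab s (stretch k (replicate (suc m) a ++ b ∷ z)) ≡ true →
          (∀ t → t < M → lab (iter σ t s) ≡ a) × reads σ lab (iter σ M s) (stretch k (b ∷ z)) ≡ true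
  split s r = reads-replicate σ lab M a (stretch k (b ∷ z)) s
    (≡.subst (λ u → reads σ lab s u ≡ true) (stretch-run k (suc m) a (b ∷ z)) r)
  at-b : lab (iter σ M s) ≡ b
  at-b = ≡ᵇ⇒≡ (proj₁ (∧-split {lab (iter σ M s) ≡ᵇ b} (proj₂ (split s r₁))))
  e≤M : suc e ≤ M
  e≤M = ℕ.≤-trans (ℕ.<⇒≤ e<k) (ℕ.m≤m+n k (m * k))
  at-a : lab (iter σ M s) ≡ a
  at-a = ≡.trans (≡.cong lab (≡.trans (≡.cong (λ n → iter σ n s) (≡.sym (ℕ.m+[n∸m]≡n e≤M))) (iter-+ σ (suc e) (M ∸ suc e) s)))
                 (proj₁ (split (iter σ (suc e) s) r₂) (M ∸ suc e) (ℕ.∸-monoʳ-< (s≤s z≤n) e≤M))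

scale : ∀ {d} {ms : Vec ℕ d} → ℕ → Pos ms → Vec ℕ d
scale {ms = []}     k tt      = []
scale {ms = m ∷ ms} k (i , p) = k * toℕ i ∷ scale k p

-- Multiplication by `k` is well defined on residues, so a unit step of `x`, wrap-around included,
-- moves the image by `k` steps.
dilate-step : ∀ {d} {ms : Vec ℕ d} k (r x : Pos ms) v → r ⊕ scale k (step v x) ≡ shift (r ⊕ scale k x) v k
dilate-step {ms = []}     k tt      tt      []      = ≡.refl
dilate-step {ms = m ∷ ms} k (r , q) (i , p) (s ∷ v) = ≡.cong₂ _,_
  (≡.trans (advance-cong-% r _ _ (begin
      (k * toℕ (advance i (1 * signVal m s))) % suc m
        ≡⟨ ≡.cong (λ x → (k * x) % suc m) (toℕ-mod (toℕ i + 1 * signVal m s) m) ⟩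
      (k * ((toℕ i + 1 * signVal m s) % suc m)) % suc m
        ≡⟨ reduce (toℕ i + 1 * signVal m s) ⟩
      (k * (toℕ i + 1 * signVal m s)) % suc m
        ≡⟨ ≡.cong (_% suc m) (distrib k (toℕ i) (signVal m s)) ⟩
      (k * toℕ i + k * signVal m s) % suc m ∎))
    (≡.sym (advance-+ r (k * toℕ i) (k * signVal m s))))
  (dilate-step k q p v)
  where
  open ≡.≡-Reasoning
  reduce : ∀ a → (k * (a % suc m)) % suc m ≡ (k * a) % suc m
  reduce a = ≡.trans (%-distribˡ-* k (a % suc m) (suc m)) (≡.trans
    (≡.cong (λ x → (k % suc m * x) % suc m) (m%n%n≡m%n a (suc m))) (≡.sym (%-distribˡ-* k a (suc m))))
  distrib : ∀ k x y → k * (x + 1 * y) ≡ k * x + k * y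
  distrib = solve-∀

module _ {d} (ms : Vec ℕ d) (Γ : Pos ms → ℕ) (k : ℕ) (w : Word) where

  private
    coarse : Vec Sign d → Pos ms → Bool
    coarse v q = reads (iter (step v) k) Γ q w

  -- Every point of the grid is r ⊕ scale k x for exactly size ms pairs (r , x).
  ∑-dilations : ∑ (allPos ms) (λ r → appearances ms (λ x → Γ (r ⊕ scale k x)) w)
              ≡ size ms * ∑ (allDirs d) (λ v → ⟦ nonzero v ⟧ * ∑ (allPos ms) (λ q → ⟦ coarse v q ⟧))
  ∑-dilations = begin
    ∑ (allPos ms) (λ r → appearances ms (λ x → Γ (r ⊕ scale k x)) w)
      ≡⟨ ∑-cong (allPos ms) (λ r → ≡.trans (appearances≡∑along ms _ w) (∑-cong (allDirs d) (λ v →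
           ≡.cong (⟦ nonzero v ⟧ *_) (∑-cong (allPos ms) (λ x → ≡.cong ⟦_⟧ (coarsen r v x)))))) ⟩
    ∑ (allPos ms) (λ r → ∑ (allDirs d) (λ v → ⟦ nonzero v ⟧ * ∑ (allPos ms) (λ x → ⟦ coarse v (r ⊕ scale k x) ⟧)))
      ≡⟨ ∑-swap (allPos ms) (allDirs d) _ ⟩
    ∑ (allDirs d) (λ v → ∑ (allPos ms) (λ r → ⟦ nonzero v ⟧ * ∑ (allPos ms) (λ x → ⟦ coarse v (r ⊕ scale k x) ⟧)))
      ≡⟨ ∑-cong (allDirs d) (λ v → ≡.trans (∑-* (allPos ms) ⟦ nonzero v ⟧ _) (≡.trans
           (≡.cong (⟦ nonzero v ⟧ *_) (average v)) (swap ⟦ nonzero v ⟧ (size ms) _))) ⟩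
    ∑ (allDirs d) (λ v → size ms * (⟦ nonzero v ⟧ * ∑ (allPos ms) (λ q → ⟦ coarse v q ⟧)))
      ≡⟨ ∑-* (allDirs d) (size ms) _ ⟩
    size ms * ∑ (allDirs d) (λ v → ⟦ nonzero v ⟧ * ∑ (allPos ms) (λ q → ⟦ coarse v q ⟧)) ∎
    where
    open ≡.≡-Reasoning
    swap : ∀ a b c → a * (b * c) ≡ b * (a * c)
    swap = solve-∀
    coarsen : ∀ r v x → reads (step v) (λ x → Γ (r ⊕ scale k x)) x w ≡ coarse v (r ⊕ scale k x)
    coarsen r v x = reads-proj (λ x → r ⊕ scale k x) (step v) (iter (step v) k) Γ
      (λ x → ≡.trans (dilate-step k r x v) (shift≡iter v k (r ⊕ scale k x))) w x
    average : ∀ v → ∑ (allPos ms) (λ r → ∑ (allPos ms) (λ x → ⟦ coarse v (r ⊕ scale k x) ⟧))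
                  ≡ size ms * ∑ (allPos ms) (λ q → ⟦ coarse v q ⟧)
    average v = ≡.trans (∑-swap (allPos ms) (allPos ms) _) (≡.trans
      (∑-cong (allPos ms) (λ x → ∑-⊕ ms (λ q → ⟦ coarse v q ⟧) (scale k x))) (∑-allPos-const ms _))

  stretch-appearances : TwoLetters w →
    size ms * (k * appearances ms Γ (stretch k w)) ≤ ∑ (allPos ms) (λ r → appearances ms (λ x → Γ (r ⊕ scale k x)) w)
  stretch-appearances two = begin
    size ms * (k * appearances ms Γ (stretch k w))
      ≡⟨ ≡.cong (λ n → size ms * (k * n)) (appearances≡∑along ms Γ (stretch k w)) ⟩
    size ms * (k * ∑ (allDirs d) (λ v → ⟦ nonzero v ⟧ * along ms Γ v (stretch k w)))
      ≡⟨ ≡.cong (size ms *_) (∑-* (allDirs d) k _) ⟨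
    size ms * ∑ (allDirs d) (λ v → k * (⟦ nonzero v ⟧ * along ms Γ v (stretch k w)))
      ≤⟨ ℕ.*-monoʳ-≤ (size ms) (∑-mono (allDirs d) (λ v →
           ℕ.≤-trans (ℕ.≤-reflexive (swap k ⟦ nonzero v ⟧ _)) (ℕ.*-monoʳ-≤ ⟦ nonzero v ⟧ (spread v)))) ⟩
    size ms * ∑ (allDirs d) (λ v → ⟦ nonzero v ⟧ * ∑ (allPos ms) (λ q → ⟦ coarse v q ⟧))
      ≡⟨ ∑-dilations ⟨
    ∑ (allPos ms) (λ r → appearances ms (λ x → Γ (r ⊕ scale k x)) w) ∎
    where
    open ℕ.≤-Reasoning
    swap : ∀ a b c → a * (b * c) ≡ b * (a * c)
    swap = solve-∀
    spread : ∀ v → k * along ms Γ v (stretch k w) ≤ ∑ (allPos ms) (λ q → ⟦ coarse v q ⟧)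
    spread v = ∑-spread (allPos ms) (step v) (step (negate v)) (step-negate v) (∑-step ms (negate v)) k
      (λ p → reads (step v) Γ p (stretch k w)) (coarse v)
      (λ s j j<k r → reads-subsample (step v) Γ k w s j j<k r)
      (stretch-exclusive (step v) Γ k w two)

-- A single dilate of the grid may miss cells when `k` shares a factor with a side, but all
-- translates together see every cell equally often. Some translate could thus be chosen; summing
-- the bound over all of them is simpler.
Bounded-stretch : ∀ d w k A B → TwoLetters w → Bounded d w A B → Bounded d (stretch k w) A (k * B)
Bounded-stretch d w k A B two bd ms Γ = ℕ.*-cancelˡ-≤ (size ms) {{size-nz ms}} (begin
  size ms * (appearances ms Γ (stretch k w) * (k * B))
    ≡⟨ regroup (size ms) _ k B ⟩
  size ms * (k * appearances ms Γ (stretch k w)) * B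
    ≤⟨ ℕ.*-monoˡ-≤ B (stretch-appearances ms Γ k w two) ⟩
  ∑ (allPos ms) (λ r → appearances ms (λ x → Γ (r ⊕ scale k x)) w) * B
    ≡⟨ ∑-*ʳ (allPos ms) _ B ⟨
  ∑ (allPos ms) (λ r → appearances ms (λ x → Γ (r ⊕ scale k x)) w * B)
    ≤⟨ ∑-mono (allPos ms) (λ r → bd ms (λ x → Γ (r ⊕ scale k x))) ⟩
  ∑ (allPos ms) (λ r → A * size ms)
    ≡⟨ ∑-allPos-const ms _ ⟩
  size ms * (A * size ms) ∎)
  where
  open ℕ.≤-Reasoning
  regroup : ∀ n x k b → n * (x * (k * b)) ≡ n * (k * x) * b
  regroup = solve-∀

stretch-∷ʳ : ∀ k w a → stretch k (w ++ [ a ]) ≡ stretch k w ++ replicate k a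
stretch-∷ʳ k w a = ≡.trans (concatMap-++ (replicate k) w [ a ]) (≡.cong (stretch k w ++_) (++-identityʳ _))

reverse-replicate : ∀ n (a : ℕ) → reverse (replicate n a) ≡ replicate n a
reverse-replicate zero    a = ≡.refl
reverse-replicate (suc n) a = begin
  reverse (a ∷ replicate n a)       ≡⟨ unfold-reverse a (replicate n a) ⟩
  reverse (replicate n a) ++ [ a ]  ≡⟨ ≡.cong (_++ [ a ]) (reverse-replicate n a) ⟩
  replicate n a ++ replicate 1 a    ≡⟨ replicate-++ n 1 a ⟩
  replicate (n + 1) a               ≡⟨ ≡.cong (λ m → replicate m a) (ℕ.+-comm n 1) ⟩
  replicate (suc n) a               ∎
  where open ≡.≡-Reasoning

reverse-stretch : ∀ k w → reverse (stretch k w) ≡ stretch k (reverse w)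
reverse-stretch k []      = ≡.refl
reverse-stretch k (a ∷ w) = begin
  reverse (replicate k a ++ stretch k w)            ≡⟨ reverse-++ (replicate k a) (stretch k w) ⟩
  reverse (stretch k w) ++ reverse (replicate k a)  ≡⟨ ≡.cong₂ _++_ (reverse-stretch k w) (reverse-replicate k a) ⟩
  stretch k (reverse w) ++ replicate k a            ≡⟨ stretch-∷ʳ k (reverse w) a ⟨
  stretch k (reverse w ++ [ a ])                    ≡⟨ ≡.cong (stretch k) (unfold-reverse a w) ⟨
  stretch k (reverse (a ∷ w))                       ∎
  where open ≡.≡-Reasoning

-- Walk along the line Γ, staying k = suc k′ steps on every cell; the second component counts the remaining ones.
module Linger (m : ℕ) (Γ : Pos (m ∷ []) → ℕ) (k′ : ℕ) where

  k : ℕ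
  k = suc k′

  State : Set
  State = Pos (m ∷ []) × ℕ

  states : List State
  states = concatMap (λ p → map (p ,_) (upTo k)) (allPos (m ∷ []))

  next : State → State
  next (p , zero)  = step (pos ∷ []) p , k′
  next (p , suc r) = p , r

  ∑-states : ∀ (f : State → ℕ) → ∑ states f ≡ ∑ (allPos (m ∷ [])) (λ p → ∑ (upTo k) (λ r → f (p , r)))
  ∑-states = ∑-pairs (allPos (m ∷ [])) (upTo k) _,_

  -- Counting down carries each level of the counter onto the one below it, and level 0 onto the top
  -- level of the next cell, so the states are permuted.
  next-inv : ∀ (f : State → ℕ) → ∑ states (λ s → 1 * f (next s)) ≡ ∑ states (λ s → 1 * f s)
  next-inv f = begin
    ∑ states (λ s → 1 * f (next s))
      ≡⟨ ≡.trans (∑-cong states (λ s → ℕ.*-identityˡ _)) (∑-states (f ∘ next)) ⟩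
    ∑ P (λ p → ∑ (upTo k) (λ r → f (next (p , r))))
      ≡⟨ ∑-cong P (λ p → ∑-upTo-head k′ (λ r → f (next (p , r)))) ⟩
    ∑ P (λ p → f (step (pos ∷ []) p , k′) + ∑ (upTo k′) (λ r → f (p , r)))
      ≡⟨ ∑-+ P (λ p → f (step (pos ∷ []) p , k′)) (λ p → ∑ (upTo k′) (λ r → f (p , r))) ⟩
    ∑ P (λ p → f (step (pos ∷ []) p , k′)) + ∑ P (λ p → ∑ (upTo k′) (λ r → f (p , r)))
      ≡⟨ ≡.cong (_+ ∑ P (λ p → ∑ (upTo k′) (λ r → f (p , r)))) (∑-step (m ∷ []) (pos ∷ []) (λ p → f (p , k′))) ⟩
    ∑ P (λ p → f (p , k′)) + ∑ P (λ p → ∑ (upTo k′) (λ r → f (p , r)))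
      ≡⟨ ℕ.+-comm (∑ P (λ p → f (p , k′))) _ ⟩
    ∑ P (λ p → ∑ (upTo k′) (λ r → f (p , r))) + ∑ P (λ p → f (p , k′))
      ≡⟨ ∑-+ P (λ p → ∑ (upTo k′) (λ r → f (p , r))) (λ p → f (p , k′)) ⟨
    ∑ P (λ p → ∑ (upTo k′) (λ r → f (p , r)) + f (p , k′))
      ≡⟨ ∑-cong P (λ p → ∑-upTo-last k′ (λ r → f (p , r))) ⟨
    ∑ P (λ p → ∑ (upTo k) (λ r → f (p , r)))
      ≡⟨ ≡.trans (∑-cong states (λ s → ℕ.*-identityˡ _)) (∑-states f) ⟨
    ∑ states (λ s → 1 * f s) ∎
    where
    open ≡.≡-Reasoning
    P : List (Pos (m ∷ []))
    P = allPos (m ∷ [])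

  open Walk states (λ _ → 1) next (Γ ∘ proj₁) next-inv public

  reads-stay : ∀ r p a z → (Γ p ≡ᵇ a) ≡ true → reads next (Γ ∘ proj₁) (step (pos ∷ []) p , k′) z ≡ true →
               reads next (Γ ∘ proj₁) (p , r) (replicate (suc r) a ++ z) ≡ true
  reads-stay zero    p a z eq rest = ∧-join eq rest
  reads-stay (suc r) p a z eq rest = ∧-join eq (reads-stay r p a z eq rest)

  reads-linger : ∀ w p → reads (step (pos ∷ [])) Γ p w ≡ true → reads next (Γ ∘ proj₁) (p , k′) (stretch k w) ≡ true
  reads-linger []      p r = ≡.refl
  reads-linger (a ∷ w) p r with eq , rest ← ∧-split {Γ p ≡ᵇ a} r =
    reads-stay k′ p a (stretch k w) eq (reads-linger w (step (pos ∷ []) p) rest)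

  along≤visits : ∀ w → along (m ∷ []) Γ (pos ∷ []) w ≤ visits (stretch k w)
  along≤visits w = begin
    along (m ∷ []) Γ (pos ∷ []) w
      ≤⟨ ∑-mono (allPos (m ∷ [])) (λ p → ℕ.≤-trans (⟦⟧-mono (reads-linger w p))
           (ℕ.≤-trans (ℕ.m≤n+m _ _) (ℕ.≤-reflexive (≡.sym (∑-upTo-last k′ (λ r → F (p , r))))))) ⟩
    ∑ (allPos (m ∷ [])) (λ p → ∑ (upTo k) (λ r → F (p , r)))
      ≡⟨ ∑-states F ⟨
    ∑ states F
      ≡⟨ ∑-cong states (λ s → ℕ.*-identityˡ (F s)) ⟨
    visits (stretch k w) ∎
    where
    open ℕ.≤-Reasoning
    F : State → ℕ
    F s = ⟦ reads next (Γ ∘ proj₁) s (stretch k w) ⟧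

-- The lingering walk has `k` states per cell, and each appearance on the line yields one reading of
-- the stretched word, started with a full counter.
Bounded-unstretch : ∀ w k A B → 1 ≤ k → Bounded 1 (stretch k w) A B → Bounded 1 w (k * A) B
Bounded-unstretch w (suc k′) A B _ bd (m ∷ []) Γ = begin
  appearances (m ∷ []) Γ w * B
    ≡⟨ ≡.cong (_* B) (appearances-line m Γ w) ⟩
  (along (m ∷ []) Γ (pos ∷ []) w + along (m ∷ []) Γ (pos ∷ []) (reverse w)) * B
    ≤⟨ ℕ.*-monoˡ-≤ B (ℕ.+-mono-≤ (along≤visits w) (along≤visits (reverse w))) ⟩
  (visits (stretch k w) + visits (stretch k (reverse w))) * B
    ≡⟨ ≡.cong (λ u → (visits (stretch k w) + visits u) * B) (reverse-stretch k w) ⟨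
  (visits (stretch k w) + visits (reverse (stretch k w))) * B
    ≤⟨ visits-bound (stretch k w) A B bd ⟩
  A * ∑ states (λ _ → 1)
    ≡⟨ ≡.cong (A *_) (≡.trans (∑-states (λ _ → 1)) (≡.trans (∑-cong (allPos (m ∷ [])) (λ _ → ∑-upTo-const k 1)) (∑-allPos-const (m ∷ []) _))) ⟩
  A * (size (m ∷ []) * (k * 1))
    ≡⟨ regroup A (size (m ∷ [])) k ⟩
  k * A * size (m ∷ []) ∎
  where
  open ℕ.≤-Reasoning
  open Linger m Γ k′
  regroup : ∀ a n k → a * (n * (k * 1)) ≡ k * a * n
  regroup = solve-∀

stretch-Stackable : ∀ (w : Word) (d k : ℕ) → TwoLetters w → 1 ≤ d → 1 ≤ k → Stackable d w → Stackable d (stretch k w)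
stretch-Stackable w d k@(suc _) two 1≤d 1≤k st = Stackable≤⇒Stackable d (stretch k w) 1≤d λ A B bd ms Γ →
  ℕ.*-cancelˡ-≤ k (begin
    k * (appearances ms Γ (stretch k w) * B)   ≡⟨ swap k (appearances ms Γ (stretch k w)) B ⟩
    appearances ms Γ (stretch k w) * (k * B)
      ≤⟨ Bounded-stretch d w k (3 ^ (d ∸ 1) * (k * A)) B two
           (Stackable⇒Stackable≤ d w st (k * A) B (Bounded-unstretch w k A B 1≤k bd)) ms Γ ⟩
    3 ^ (d ∸ 1) * (k * A) * size ms            ≡⟨ regroup (3 ^ (d ∸ 1)) k A (size ms) ⟩
    k * (3 ^ (d ∸ 1) * A * size ms)            ∎)
  where
  open ℕ.≤-Reasoning
  swap : ∀ a b c → a * (b * c) ≡ b * (a * c)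
  swap = solve-∀
  regroup : ∀ c k a n → c * (k * a) * n ≡ k * (c * a * n)
  regroup = solve-∀

-- Comparing the counts of different words.

appearances-mono : ∀ {d} (ms : Vec ℕ d) Γ Γ′ w w′ →
  (∀ p v → reads (step v) Γ p w ≡ true → reads (step v) Γ′ p w′ ≡ true) → appearances ms Γ w ≤ appearances ms Γ′ w′
appearances-mono {d} ms Γ Γ′ w w′ imp = begin
  appearances ms Γ w
    ≡⟨ appearances≡ ms Γ w ⟩
  ∑ (allPos ms) (λ p → ∑ (allDirs d) (λ v → ⟦ nonzero v ∧ reads (step v) Γ p w ⟧))
    ≤⟨ ∑-mono (allPos ms) (λ p → ∑-mono (allDirs d) (λ v → ⟦⟧-mono (λ h →
         ∧-join (proj₁ (∧-split {nonzero v} h)) (imp p v (proj₂ (∧-split {nonzero v} h)))))) ⟩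
  ∑ (allPos ms) (λ p → ∑ (allDirs d) (λ v → ⟦ nonzero v ∧ reads (step v) Γ′ p w′ ⟧))
    ≡⟨ appearances≡ ms Γ′ w′ ⟨
  appearances ms Γ′ w′ ∎
  where open ℕ.≤-Reasoning

reads-map : ∀ {S : Set} (σ : S → S) lab (f : ℕ → ℕ) w s → reads σ lab s w ≡ true → reads σ (f ∘ lab) s (map f w) ≡ true
reads-map σ lab f []      s r = ≡.refl
reads-map σ lab f (a ∷ w) s r = ∧-join (≡⇒≡ᵇ (≡.cong f (≡ᵇ⇒≡ {lab s} (proj₁ (∧-split {lab s ≡ᵇ a} r)))))
                                       (reads-map σ lab f w (σ s) (proj₂ (∧-split {lab s ≡ᵇ a} r)))

-- It serves two purposes: renaming carries an explicit example over to the given letters, and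
-- merging letters reduces an upper bound to two letters.
appearances-map : ∀ {d} (ms : Vec ℕ d) Γ (f : ℕ → ℕ) w → appearances ms Γ w ≤ appearances ms (f ∘ Γ) (map f w)
appearances-map ms Γ f w = appearances-mono ms Γ (f ∘ Γ) w (map f w) (λ p v → reads-map (step v) Γ f w p)

-- One A followed by Bs: the line bound and denser planar grids.

module _ (a b l : ℕ) (a≢b : a ≢ b) where

  private
    u : Word
    u = a ∷ replicate l b

  -- Each appearance claims the `suc l` cells it covers. Claims in one direction are disjoint, since
  -- the start of the later appearance would be an A among the Bs of the earlier one.
  along-head : ∀ m Γ v → suc l * along (m ∷ []) Γ v u ≤ size (m ∷ [])
  along-head m Γ v = ℕ.≤-trans
    (∑-spread (allPos (m ∷ [])) (step v) (step (negate v)) (step-negate v) (∑-step (m ∷ []) (negate v)) (suc l)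
      (λ p → reads (step v) Γ p u) (λ _ → true) (λ _ _ _ _ → ≡.refl) exclusive)
    (ℕ.≤-reflexive (≡.trans (∑-allPos-const (m ∷ []) 1) (ℕ.*-identityʳ _)))
    where
    exclusive : ∀ s e → suc e < suc l → reads (step v) Γ s u ≡ true → reads (step v) Γ (iter (step v) (suc e) s) u ≡ true → ⊥
    exclusive s e (s≤s e<l) r₁ r₂ = a≢b (≡.trans (≡.sym (≡ᵇ⇒≡ (proj₁ (∧-split {Γ (iter (step v) (suc e) s) ≡ᵇ a} r₂))))
      (proj₁ (reads-replicate (step v) Γ l b [] (step v s)
        (≡.subst (λ z → reads (step v) Γ (step v s) z ≡ true) (≡.sym (++-identityʳ (replicate l b)))
          (proj₂ (∧-split {Γ s ≡ᵇ a} r₁)))) e e<l))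

  Bounded-head : Bounded 1 u 2 (suc l)
  Bounded-head (m ∷ []) Γ = begin
    appearances (m ∷ []) Γ u * suc l
      ≡⟨ ≡.cong (_* suc l) (appearances≡∑along (m ∷ []) Γ u) ⟩
    (1 * N + (0 + (1 * P + 0))) * suc l
      ≡⟨ expand N P (suc l) ⟩
    suc l * N + suc l * P
      ≤⟨ ℕ.+-mono-≤ (along-head m Γ (neg ∷ [])) (along-head m Γ (pos ∷ [])) ⟩
    size (m ∷ []) + size (m ∷ [])
      ≡⟨ ≡.cong (_+_ (size (m ∷ []))) (ℕ.+-identityʳ _) ⟨
    2 * size (m ∷ []) ∎
    where
    open ℕ.≤-Reasoning
    N P : ℕ
    N = along (m ∷ []) Γ (neg ∷ []) u
    P = along (m ∷ []) Γ (pos ∷ []) u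
    expand : ∀ n p l → (1 * n + (0 + (1 * p + 0))) * l ≡ l * n + l * p
    expand = solve-∀

  -- Three times the line bound 2 / `suc l` is 6 / `suc l`, which a single planar grid has to
  -- exceed.
  ¬Stackable-head : ∀ (ms : Vec ℕ 2) Γ → 6 * size ms < appearances ms Γ u * suc l → ¬ Stackable 2 u
  ¬Stackable-head ms Γ lt st = ℕ.<⇒≱ lt (Stackable⇒Stackable≤ 2 u st 2 (suc l) Bounded-head ms Γ)

∑-allFin-≥ : ∀ n (f : Fin n → ℕ) i → f i ≤ ∑ (allFin n) f
∑-allFin-≥ n f i = go n id f i
  where
  go : ∀ {A : Set} n (h : Fin n → A) (f : A → ℕ) i → f (h i) ≤ ∑ (tabulate h) f
  go (suc n) h f Fin.zero    = ℕ.m≤m+n _ _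
  go (suc n) h f (Fin.suc i) = ℕ.≤-trans (go n (h ∘ Fin.suc) f i) (ℕ.m≤n+m _ _)

∣-% : ∀ m a b → a % suc m ≡ b % suc m → suc m ∣ a → suc m ∣ b
∣-% m a b eq n∣a = m%n≡0⇒n∣m b (suc m) (≡.trans (≡.sym eq) (n∣m⇒m%n≡0 a (suc m) n∣a))

-- In each of the eight directions 2 i + j advances by ±1, ±2 or ±3, so for n = suc m prime to 6
-- consecutive zeros of 2 i + j modulo n are at distance n.
module Lattice (m l a b : ℕ) (6⊥n : Coprime (suc m) 6) (l≤m : l ≤ m) where

  n : ℕ
  n = suc m

  value : Pos (m ∷ m ∷ []) → ℕ
  value (i , j , _) = 2 * toℕ i + toℕ j

  Γ : Pos (m ∷ m ∷ []) → ℕ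
  Γ p = if value p % n ≡ᵇ 0 then a else b

  slope : Vec Sign 2 → ℕ
  slope (s ∷ t ∷ []) = 2 * signVal m s + signVal m t

  value-shift : ∀ p v t → value (shift p v t) % n ≡ (value p + t * slope v) % n
  value-shift (i , j , tt) (s ∷ s′ ∷ []) t = begin
    (2 * toℕ (advance i (t * x)) + toℕ (advance j (t * y))) % n
      ≡⟨ ≡.cong₂ (λ p q → (2 * p + q) % n) (toℕ-mod (toℕ i + t * x) m) (toℕ-mod (toℕ j + t * y) m) ⟩
    (2 * ((toℕ i + t * x) % n) + (toℕ j + t * y) % n) % n
      ≡⟨ reduce (toℕ i + t * x) (toℕ j + t * y) ⟩
    (2 * (toℕ i + t * x) + (toℕ j + t * y)) % n
      ≡⟨ ≡.cong (_% n) (regroup (toℕ i) (toℕ j) t x y) ⟩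
    (2 * toℕ i + toℕ j + t * (2 * x + y)) % n ∎
    where
    open ≡.≡-Reasoning
    x y : ℕ
    x = signVal m s
    y = signVal m s′
    regroup : ∀ i j t x y → 2 * (i + t * x) + (j + t * y) ≡ 2 * i + j + t * (2 * x + y)
    regroup = solve-∀
    reduce : ∀ p q → (2 * (p % n) + q % n) % n ≡ (2 * p + q) % n
    reduce p q = begin
      (2 * (p % n) + q % n) % n            ≡⟨ %-distribˡ-+ (2 * (p % n)) (q % n) n ⟩
      ((2 * (p % n)) % n + q % n % n) % n
        ≡⟨ ≡.cong₂ (λ x y → (x + y) % n) (≡.trans (%-distribˡ-* 2 (p % n) n) (≡.trans
             (≡.cong (λ x → (2 % n * x) % n) (m%n%n≡m%n p n)) (≡.sym (%-distribˡ-* 2 p n)))) (m%n%n≡m%n q n) ⟩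
      ((2 * p) % n + q % n) % n            ≡⟨ %-distribˡ-+ (2 * p) q n ⟨
      (2 * p + q) % n                      ∎

  n∣6t⇒n∣t : ∀ t → n ∣ 6 * t → n ∣ t
  n∣6t⇒n∣t t = coprime-divisor 6⊥n

  slope-injective : ∀ v → nonzero v ≡ true → ∀ t → n ∣ t * slope v → n ∣ t
  slope-injective v nz t h = n∣6t⇒n∣t t (go v nz h)
    where
    -- Modulo n and up to sign the slope c is some e ∈ {1, 2, 3}, and f e = 6.
    plus : ∀ c e f k → f * (t * c) + f * (t * e) ≡ n * (k * t) → f * (t * e) ≡ 6 * t → n ∣ t * c → n ∣ 6 * t
    plus c e f k eq eq₆ h = ≡.subst (n ∣_) eq₆ (∣m+n∣m⇒∣n (≡.subst (n ∣_) (≡.sym eq) (m∣m*n (k * t))) (∣n⇒∣m*n f h))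
    minus : ∀ c k → 6 * (t * c) ≡ n * (k * t) + 6 * t → n ∣ t * c → n ∣ 6 * t
    minus c k eq h = ∣m+n∣m⇒∣n (≡.subst (n ∣_) eq (∣n⇒∣m*n 6 h)) (m∣m*n (k * t))
    times : ∀ c f → f * (t * c) ≡ 6 * t → n ∣ t * c → n ∣ 6 * t
    times c f eq h = ≡.subst (n ∣_) eq (∣n⇒∣m*n f h)
    e₁ : ∀ m t → 2 * (t * (2 * m + m)) + 2 * (t * 3) ≡ suc m * (6 * t)
    e₁ = solve-∀
    e₂ : ∀ m t → 3 * (t * (2 * m + 0)) + 3 * (t * 2) ≡ suc m * (6 * t)
    e₂ = solve-∀
    e₃ : ∀ m t → 6 * (t * (2 * m + 1)) + 6 * (t * 1) ≡ suc m * (12 * t)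
    e₃ = solve-∀
    e₄ : ∀ m t → 6 * (t * (0 + m)) + 6 * (t * 1) ≡ suc m * (6 * t)
    e₄ = solve-∀
    e₅ : ∀ m t → 6 * (t * (2 + m)) ≡ suc m * (6 * t) + 6 * t
    e₅ = solve-∀
    f₁ : ∀ t → 6 * (t * 1) ≡ 6 * t
    f₁ = solve-∀
    f₂ : ∀ t → 3 * (t * 2) ≡ 6 * t
    f₂ = solve-∀
    f₃ : ∀ t → 2 * (t * 3) ≡ 6 * t
    f₃ = solve-∀
    go : ∀ v → nonzero v ≡ true → n ∣ t * slope v → n ∣ 6 * t
    go (neg ∷ neg ∷ []) _ = plus (2 * m + m) 3 2 6 (e₁ m t) (f₃ t)
    go (neg ∷ zer ∷ []) _ = plus (2 * m + 0) 2 3 6 (e₂ m t) (f₂ t)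
    go (neg ∷ pos ∷ []) _ = plus (2 * m + 1) 1 6 12 (e₃ m t) (f₁ t)
    go (zer ∷ neg ∷ []) _ = plus (0 + m) 1 6 6 (e₄ m t) (f₁ t)
    go (zer ∷ pos ∷ []) _ = times 1 6 (f₁ t)
    go (pos ∷ neg ∷ []) _ = minus (2 + m) 6 (e₅ m t)
    go (pos ∷ zer ∷ []) _ = times 2 3 (f₂ t)
    go (pos ∷ pos ∷ []) _ = times 3 2 (f₃ t)

  Γ-zero : ∀ p → n ∣ value p → Γ p ≡ a
  Γ-zero p h rewrite n∣m⇒m%n≡0 (value p) n h = ≡.refl

  Γ-nonzero : ∀ p → ¬ n ∣ value p → Γ p ≡ b
  Γ-nonzero p h with value p % n in eq
  ... | zero  = ⊥-elim (h (m%n≡0⇒n∣m (value p) n eq))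
  ... | suc _ = ≡.refl

  -- Another zero after `t` steps would give `n ∣ t * slope v` and hence `n ∣ t`, impossible for
  -- `1 ≤ t < n`.
  reads-tail : ∀ k t p v → nonzero v ≡ true → n ∣ value p → 1 ≤ t → t + k ≤ n →
               reads (step v) Γ (shift p v t) (replicate k b) ≡ true
  reads-tail zero    t p v nz z 1≤t le = ≡.refl
  reads-tail (suc k) t@(suc _) p v nz z 1≤t le = ∧-join
    (≡⇒≡ᵇ (Γ-nonzero (shift p v t) λ h → >⇒∤ t<n (slope-injective v nz t
      (∣m+n∣m⇒∣n (∣-% m (value (shift p v t)) (value p + t * slope v) (value-shift p v t) h) z))))
    (≡.subst (λ q → reads (step v) Γ q (replicate k b) ≡ true)
      (≡.trans (≡.cong (shift p v) (ℕ.+-comm 1 t)) (≡.sym (shift-+ p v t 1)))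
      (reads-tail k (suc t) p v nz z (s≤s z≤n) (≡.subst (_≤ n) (ℕ.+-suc t k) le)))
    where
    t<n : t < n
    t<n = ℕ.≤-trans (≡.subst (_≤ t + suc k) (ℕ.+-comm t 1) (ℕ.+-monoʳ-≤ t (s≤s z≤n))) le

  reads-zero : ∀ p v → nonzero v ≡ true → n ∣ value p → reads (step v) Γ p (a ∷ replicate l b) ≡ true
  reads-zero p v nz z = ∧-join (≡⇒≡ᵇ (Γ-zero p z)) (reads-tail l 1 p v nz z (s≤s z≤n) (s≤s l≤m))

  stars : Pos (m ∷ m ∷ []) → ℕ
  stars p = ∑ (allDirs 2) (λ v → ⟦ nonzero v ∧ reads (step v) Γ p (a ∷ replicate l b) ⟧)

  stars-zero : ∀ p → n ∣ value p → 8 ≤ stars p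
  stars-zero p z = ∑-mono (allDirs 2) {λ v → ⟦ nonzero v ⟧} (λ v → ⟦⟧-mono {nonzero v} (λ nz → ∧-join nz (reads-zero p v nz z)))

  -- As `m` is -1 modulo `n`, this is -2 i, the column of the one zero in row `i`.
  root : Fin n → Fin n
  root i = (2 * toℕ i * m) mod n

  value-root : ∀ i → n ∣ value (i , root i , tt)
  value-root i = ∣-% m (2 * toℕ i * n) (value (i , root i , tt)) (begin
    (2 * toℕ i * n) % n                            ≡⟨ ≡.cong (_% n) (regroup (2 * toℕ i) m) ⟩
    (2 * toℕ i * m + 2 * toℕ i) % n                ≡⟨ %-+-congˡ (2 * toℕ i * m) (2 * toℕ i) m ⟨
    ((2 * toℕ i * m) % n + 2 * toℕ i) % n          ≡⟨ ≡.cong (_% n) (ℕ.+-comm ((2 * toℕ i * m) % n) (2 * toℕ i)) ⟩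
    (2 * toℕ i + (2 * toℕ i * m) % n) % n          ≡⟨ ≡.cong (λ x → (2 * toℕ i + x) % n) (toℕ-mod (2 * toℕ i * m) m) ⟨
    value (i , root i , tt) % n                    ∎)
    (n∣m*n (2 * toℕ i))
    where
    open ≡.≡-Reasoning
    regroup : ∀ x m → x * suc m ≡ x * m + x
    regroup = solve-∀

  appearances-lattice : n * 8 ≤ appearances (m ∷ m ∷ []) Γ (a ∷ replicate l b)
  appearances-lattice = begin
    n * 8                                              ≡⟨ ∑-allFin-const n 8 ⟨
    ∑ (allFin n) (λ _ → 8)                             ≤⟨ ∑-mono (allFin n) (λ i → ℕ.≤-trans (stars-zero (i , root i , tt) (value-root i)) (row i)) ⟩
    ∑ (allFin n) (λ i → ∑ (allPos (m ∷ [])) (λ q → stars (i , q)))  ≡⟨ ∑-allPos m (m ∷ []) stars ⟨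
    ∑ (allPos (m ∷ m ∷ [])) stars                      ≡⟨ appearances≡ (m ∷ m ∷ []) Γ (a ∷ replicate l b) ⟨
    appearances (m ∷ m ∷ []) Γ (a ∷ replicate l b)     ∎
    where
    open ℕ.≤-Reasoning
    row : ∀ i → stars (i , root i , tt) ≤ ∑ (allPos (m ∷ [])) (λ q → stars (i , q))
    row i = begin
      stars (i , root i , tt)                                      ≤⟨ ∑-allFin-≥ n (λ j → stars (i , j , tt)) (root i) ⟩
      ∑ (allFin n) (λ j → stars (i , j , tt))                      ≡⟨ ∑-cong (allFin n) (λ j → ℕ.+-identityʳ _) ⟨
      ∑ (allFin n) (λ j → ∑ (allPos []) (λ q → stars (i , j , q))) ≡⟨ ∑-allPos m [] (λ q → stars (i , q)) ⟨
      ∑ (allPos (m ∷ [])) (λ q → stars (i , q))                    ∎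

coprime-6 : ∀ k r → r ≡ 1 ⊎ r ≡ 5 → Coprime (k * 6 + r) 6
coprime-6 k r r≡ {d} (d∣n , d∣6) = ∣1⇒≡1 (unit r≡ (∣m+n∣m⇒∣n d∣n (∣n⇒∣m*n k d∣6)))
  where
  unit : r ≡ 1 ⊎ r ≡ 5 → d ∣ r → d ∣ 1
  unit (inj₁ ≡.refl) h = h
  unit (inj₂ ≡.refl) h = ∣m+n∣m⇒∣n d∣6 h

¬Stackable-lattice : ∀ m l a b → a ≢ b → Coprime (suc m) 6 → l ≤ m → 6 * suc m < 8 * suc l → ¬ Stackable 2 (a ∷ replicate l b)
¬Stackable-lattice m l a b a≢b 6⊥n l≤m lt = ¬Stackable-head a b l a≢b (m ∷ m ∷ []) Γ (begin-strict
  6 * (suc m * (suc m * 1))         ≡⟨ e₁ (suc m) ⟩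
  suc m * (6 * suc m)               <⟨ ℕ.*-monoʳ-< (suc m) lt ⟩
  suc m * (8 * suc l)               ≡⟨ e₂ (suc m) (suc l) ⟩
  suc m * 8 * suc l                 ≤⟨ ℕ.*-monoˡ-≤ (suc l) appearances-lattice ⟩
  appearances (m ∷ m ∷ []) Γ (a ∷ replicate l b) * suc l ∎)
  where
  open ℕ.≤-Reasoning
  open Lattice m l a b 6⊥n l≤m
  e₁ : ∀ n → 6 * (n * (n * 1)) ≡ n * (6 * n)
  e₁ = solve-∀
  e₂ : ∀ n l → n * (8 * l) ≡ n * 8 * l
  e₂ = solve-∀

-- Eight 0s at the triangular numbers modulo 8: one in every row and column, with few repetitions on diagonals.
triangular : Pos (7 ∷ 7 ∷ []) → ℕ
triangular (i , j , _) = if toℕ i * suc (toℕ i) % 16 ≡ᵇ 2 * toℕ j then 0 else 1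

triangular-appearances : appearances (7 ∷ 7 ∷ []) triangular (0 ∷ replicate 7 1) ≡ 56
triangular-appearances = ≡.refl

-- The least number from 8 on that is prime to 6 is 11, and 8 / 11 < 6 / 8, so the lattice falls
-- short. The permutation grid reaches 56 / 64 > 6 / 8.
¬Stackable-8 : ∀ a b → a ≢ b → ¬ Stackable 2 (a ∷ replicate 7 b)
¬Stackable-8 a b a≢b = ¬Stackable-head a b 7 a≢b (7 ∷ 7 ∷ []) (letter ∘ triangular)
  (ℕ.<-≤-trans (ℕ.<ᵇ⇒< (6 * 64) (56 * 8) tt) (ℕ.*-monoˡ-≤ 8 (≡.subst (_≤ appearances (7 ∷ 7 ∷ []) (letter ∘ triangular) (a ∷ replicate 7 b))
    triangular-appearances (appearances-map (7 ∷ 7 ∷ []) triangular letter (0 ∷ replicate 7 1)))))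
  where
  letter : ℕ → ℕ
  letter zero    = a
  letter (suc _) = b

¬Stackable-ABℓ : ∀ (ℓ a b : ℕ) → 3 < ℓ → a ≢ b → ¬ Stackable 2 (a ∷ replicate (ℓ ∸ 1) b)
¬Stackable-ABℓ ℓ a b 3<ℓ a≢b = go (DivMod.quotient (ℓ divMod 6)) (DivMod.remainder (ℓ divMod 6)) (DivMod.property (ℓ divMod 6))
  where
  -- `y` and `x` are the slacks in `suc l ≤ n` and `6 * n < 8 * suc l`; as equations, both
  -- conditions are in reach of the ring solver.
  near′ : ∀ n l x y → Coprime n 6 → suc l + y ≡ n → suc (6 * n) + x ≡ 8 * suc l → ¬ Stackable 2 (a ∷ replicate l b)
  near′ (suc m) l x y 6⊥n eq₁ eq₂ = ¬Stackable-lattice m l a b a≢b 6⊥n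
    (ℕ.m+n≤o⇒m≤o l (ℕ.≤-reflexive (ℕ.suc-injective eq₁))) (ℕ.m+n≤o⇒m≤o (suc (6 * suc m)) (ℕ.≤-reflexive eq₂))
  near : ∀ k r l x y → r ≡ 1 ⊎ r ≡ 5 → suc l + y ≡ k * 6 + r → suc (6 * (k * 6 + r)) + x ≡ 8 * suc l →
         ¬ Stackable 2 (a ∷ replicate l b)
  near k r l x y r≡ = near′ (k * 6 + r) l x y (coprime-6 k r r≡)
  e₀ : ∀ k → 6 + k * 6 + 1 ≡ suc k * 6 + 1
  e₀ = solve-∀
  f₀ : ∀ k → suc (6 * (suc k * 6 + 1)) + (12 * k + 5) ≡ 8 * (6 + k * 6)
  f₀ = solve-∀
  e₁ : ∀ k → 7 + k * 6 + 0 ≡ suc k * 6 + 1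
  e₁ = solve-∀
  f₁ : ∀ k → suc (6 * (suc k * 6 + 1)) + (12 * k + 13) ≡ 8 * (7 + k * 6)
  f₁ = solve-∀
  e₂ : ∀ k → 14 + k * 6 + 3 ≡ suc (suc k) * 6 + 5
  e₂ = solve-∀
  f₂ : ∀ k → suc (6 * (suc (suc k) * 6 + 5)) + (12 * k + 9) ≡ 8 * (14 + k * 6)
  f₂ = solve-∀
  e₃ : ∀ k → 9 + k * 6 + 2 ≡ suc k * 6 + 5
  e₃ = solve-∀
  f₃ : ∀ k → suc (6 * (suc k * 6 + 5)) + (12 * k + 5) ≡ 8 * (9 + k * 6)
  f₃ = solve-∀
  e₄ : ∀ k → 4 + k * 6 + 1 ≡ k * 6 + 5
  e₄ = solve-∀
  f₄ : ∀ k → suc (6 * (k * 6 + 5)) + (12 * k + 1) ≡ 8 * (4 + k * 6)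
  f₄ = solve-∀
  e₅ : ∀ k → 5 + k * 6 + 0 ≡ k * 6 + 5
  e₅ = solve-∀
  f₅ : ∀ k → suc (6 * (k * 6 + 5)) + (12 * k + 9) ≡ 8 * (5 + k * 6)
  f₅ = solve-∀
  -- The side length is the least number prime to 6 that is at least ℓ, unless ℓ = 8.
  go : ∀ q (r : Fin 6) → ℓ ≡ toℕ r + q * 6 → ¬ Stackable 2 (a ∷ replicate (ℓ ∸ 1) b)
  go zero    0F ≡.refl = ⊥-elim (ℕ.≤⇒≯ z≤n 3<ℓ)
  go zero    1F ≡.refl = ⊥-elim (ℕ.≤⇒≯ (s≤s z≤n) 3<ℓ)
  go zero    2F ≡.refl = ⊥-elim (ℕ.≤⇒≯ (s≤s (s≤s z≤n)) 3<ℓ)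
  go zero    3F ≡.refl = ⊥-elim (ℕ.<-irrefl ≡.refl 3<ℓ)
  go (suc k) 0F ≡.refl = near (suc k) 1 (5 + k * 6) (12 * k + 5) 1 (inj₁ ≡.refl) (e₀ k) (f₀ k)
  go (suc k) 1F ≡.refl = near (suc k) 1 (6 + k * 6) (12 * k + 13) 0 (inj₁ ≡.refl) (e₁ k) (f₁ k)
  go 1       2F ≡.refl = ¬Stackable-8 a b a≢b
  go (suc (suc k)) 2F ≡.refl = near (suc (suc k)) 5 (13 + k * 6) (12 * k + 9) 3 (inj₂ ≡.refl) (e₂ k) (f₂ k)
  go (suc k) 3F ≡.refl = near (suc k) 5 (8 + k * 6) (12 * k + 5) 2 (inj₂ ≡.refl) (e₃ k) (f₃ k)
  go k       4F ≡.refl = near k 5 (3 + k * 6) (12 * k + 1) 1 (inj₂ ≡.refl) (e₄ k) (f₄ k)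
  go k       5F ≡.refl = near k 5 (4 + k * 6) (12 * k + 9) 0 (inj₂ ≡.refl) (e₅ k) (f₅ k)

-- Linear bounds from 3 × 3 windows.

Window : Set
Window = ℕ → ℕ → Bool

-- All eight directed lines of a window pass through its centre, so a three-letter appearance is
-- counted in one window only, that of its middle letter.
coord : Sign → ℕ → ℕ
coord neg t = 2 ∸ t
coord zer t = 1
coord pos t = t

tally : (Bool → Bool → Bool → Bool) → Window → ℕ
tally t x = ∑ (allDirs 2) (λ v → ⟦ nonzero v ∧ line v ⟧)
  where
  line : Vec Sign 2 → Bool
  line (s ∷ s′ ∷ []) = t (x (coord s 0) (coord s′ 0)) (x (coord s 1) (coord s′ 1)) (x (coord s 2) (coord s′ 2))

xxb xbx : Bool → Bool → Bool → Bool
xxb p q r = p ∧ q ∧ not r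
xbx p q r = p ∧ not q ∧ r

cell : ∀ {m n} → ℕ → ℕ → Pos (m ∷ n ∷ []) → Pos (m ∷ n ∷ [])
cell a b p = p ⊕ (a ∷ b ∷ [])

step-coord : ∀ {m} (i : Fin (suc m)) s t → t < 2 →
             advance (advance i (coord s t)) (1 * signVal m s) ≡ advance i (coord s (suc t))
step-coord i zer t t<2 = advance-0 (advance i 1)
step-coord i pos t t<2 = ≡.trans (advance-+ i t 1) (≡.cong (advance i) (ℕ.+-comm t 1))
step-coord {m} i neg t t<2 = ≡.trans (≡.cong (λ a → advance (advance i a) (1 * m)) (2∸t t t<2))
  (≡.trans (≡.cong (λ j → advance j (1 * m)) (≡.sym (advance-+ i (2 ∸ suc t) 1)))
           (≡.cong proj₁ (step-negate {ms = m ∷ []} (neg ∷ []) (advance i (2 ∸ suc t) , tt))))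
  where
  2∸t : ∀ t → t < 2 → 2 ∸ t ≡ 2 ∸ suc t + 1
  2∸t zero          _ = ≡.refl
  2∸t (suc zero)    _ = ≡.refl
  2∸t (suc (suc t)) (s≤s (s≤s ()))

step-cell : ∀ {m n} (p : Pos (m ∷ n ∷ [])) s s′ t → t < 2 →
            step (s ∷ s′ ∷ []) (cell (coord s t) (coord s′ t) p) ≡ cell (coord s (suc t)) (coord s′ (suc t)) p
step-cell (i , j , tt) s s′ t t<2 = ≡.cong₂ (λ x y → x , y , tt) (step-coord i s t t<2) (step-coord j s′ t t<2)

-- For each direction the sum over starting cells is translated so that the start lies at the
-- matching border cell of the window. On a short side cells of a window coincide, which is harmless
-- because the local inequality is checked for all bit patterns.
appearances≤tally : ∀ m n (Γ : Pos (m ∷ n ∷ []) → ℕ) (x : Pos (m ∷ n ∷ []) → Bool) t a b c →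
  (∀ p q r → Γ p ≡ a → Γ q ≡ b → Γ r ≡ c → t (x p) (x q) (x r) ≡ true) →
  appearances (m ∷ n ∷ []) Γ (a ∷ b ∷ c ∷ []) ≤ ∑ (allPos (m ∷ n ∷ [])) (λ p → tally t (λ i j → x (cell i j p)))
appearances≤tally m n Γ x t a b c imp = begin
  appearances ms Γ w
    ≡⟨ ≡.trans (appearances≡ ms Γ w) (∑-swap (allPos ms) (allDirs 2) (λ p v → ⟦ nonzero v ∧ reads (step v) Γ p w ⟧)) ⟩
  ∑ (allDirs 2) (λ v → ∑ (allPos ms) (λ p → ⟦ nonzero v ∧ reads (step v) Γ p w ⟧))
    ≤⟨ ∑-mono (allDirs 2) bound ⟩
  ∑ (allDirs 2) (λ v → ∑ (allPos ms) (λ p → ⟦ nonzero v ∧ line v p ⟧))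
    ≡⟨ ∑-swap (allDirs 2) (allPos ms) (λ v p → ⟦ nonzero v ∧ line v p ⟧) ⟩
  ∑ (allPos ms) (λ p → tally t (λ i j → x (cell i j p))) ∎
  where
  open ℕ.≤-Reasoning
  ms : Vec ℕ 2
  ms = m ∷ n ∷ []
  w : Word
  w = a ∷ b ∷ c ∷ []
  line : Vec Sign 2 → Pos ms → Bool
  line (s ∷ s′ ∷ []) p =
    t (x (cell (coord s 0) (coord s′ 0) p)) (x (cell (coord s 1) (coord s′ 1) p)) (x (cell (coord s 2) (coord s′ 2) p))
  bound : ∀ v → ∑ (allPos ms) (λ p → ⟦ nonzero v ∧ reads (step v) Γ p w ⟧) ≤ ∑ (allPos ms) (λ p → ⟦ nonzero v ∧ line v p ⟧)
  bound v@(s ∷ s′ ∷ []) = begin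
    ∑ (allPos ms) (λ p → ⟦ nonzero v ∧ reads (step v) Γ p w ⟧)
      ≡⟨ ∑-⊕ ms (λ p → ⟦ nonzero v ∧ reads (step v) Γ p w ⟧) (coord s 0 ∷ coord s′ 0 ∷ []) ⟨
    ∑ (allPos ms) (λ p → ⟦ nonzero v ∧ reads (step v) Γ (at 0 p) w ⟧)
      ≤⟨ ∑-mono (allPos ms) (λ p → ⟦⟧-mono (λ h → ∧-join (proj₁ (∧-split {nonzero v} h))
           (reads⇒line p (proj₂ (∧-split {nonzero v} h))))) ⟩
    ∑ (allPos ms) (λ p → ⟦ nonzero v ∧ line v p ⟧) ∎
    where
    at : ℕ → Pos ms → Pos ms
    at k = cell (coord s k) (coord s′ k)
    three : ∀ q₀ q₁ q₂ → step v q₀ ≡ q₁ → step v q₁ ≡ q₂ → reads (step v) Γ q₀ w ≡ true → t (x q₀) (x q₁) (x q₂) ≡ true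
    three q₀ q₁ q₂ ≡.refl ≡.refl h
      with Γ₀ , h₁ ← ∧-split {Γ q₀ ≡ᵇ a} h
      with Γ₁ , h₂ ← ∧-split {Γ q₁ ≡ᵇ b} h₁
      with Γ₂ , _  ← ∧-split {Γ q₂ ≡ᵇ c} h₂ = imp q₀ q₁ q₂ (≡ᵇ⇒≡ Γ₀) (≡ᵇ⇒≡ Γ₁) (≡ᵇ⇒≡ Γ₂)
    reads⇒line : ∀ p → reads (step v) Γ (at 0 p) w ≡ true → line v p ≡ true
    reads⇒line p = three (at 0 p) (at 1 p) (at 2 p) (step-cell p s s′ 0 (s≤s z≤n)) (step-cell p s s′ 1 (s≤s (s≤s z≤n)))

entry : List ℕ → ℕ → ℕ
entry []       _       = 0
entry (x ∷ xs) zero    = x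
entry (x ∷ xs) (suc n) = entry xs n

potential : List ℕ → Window → ℕ
potential table x = entry table (32 * ⟦ x 0 0 ⟧ + 16 * ⟦ x 0 1 ⟧ + 8 * ⟦ x 1 0 ⟧ + 4 * ⟦ x 1 1 ⟧ + 2 * ⟦ x 2 0 ⟧ + ⟦ x 2 1 ⟧)

transpose : Window → Window
transpose x i j = x j i

slide : Window → Window
slide x i j = x i (suc j)

-- Linear programming duality. The windows of a torus have equal statistics on the two 3 × 2 blocks
-- related by `slide`; `table` holds the multipliers of these constraints, indexed by the six bits
-- of a block and shared by both axes through `transpose`. Potentials stand on both sides to avoid
-- subtraction.
inequality : ℕ → ℕ → ℕ → List ℕ → Window → Bool
inequality α β γ table x =
  α * tally xxb x + β * tally xbx x + (potential table x + potential table (transpose x))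
    ≤ᵇ γ + (potential table (slide x) + potential table (slide (transpose x)))

everywhere : ∀ n → (Vec Bool n → Bool) → Bool
everywhere zero    f = f []
everywhere (suc n) f = everywhere n (f ∘ (true ∷_)) ∧ everywhere n (f ∘ (false ∷_))

everywhere-sound : ∀ n f → everywhere n f ≡ true → ∀ bs → f bs ≡ true
everywhere-sound zero    f h []           = h
everywhere-sound (suc n) f h (true ∷ bs)  = everywhere-sound n (f ∘ (true ∷_)) (proj₁ (∧-split {everywhere n (f ∘ (true ∷_))} h)) bs
everywhere-sound (suc n) f h (false ∷ bs) = everywhere-sound n (f ∘ (false ∷_)) (proj₂ (∧-split {everywhere n (f ∘ (true ∷_))} h)) bs

window : Vec Bool 9 → Window
window (a ∷ b ∷ c ∷ d ∷ e ∷ f ∷ g ∷ h ∷ i ∷ []) = λ where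
  0 0 → a
  0 1 → b
  0 _ → c
  1 0 → d
  1 1 → e
  1 _ → f
  _ 0 → g
  _ 1 → h
  _ _ → i

-- Summed over all windows of a torus, a potential and its translate cancel.
window-bound : ∀ α β γ table → everywhere 9 (inequality α β γ table ∘ window) ≡ true →
  ∀ (ms : Vec ℕ 2) Γ → α * appearances ms Γ (0 ∷ 0 ∷ 1 ∷ []) + β * appearances ms Γ (0 ∷ 1 ∷ 0 ∷ []) ≤ γ * size ms
window-bound α β γ table ok ms@(m ∷ n ∷ []) Γ = ℕ.+-cancelʳ-≤ (∑ P H + ∑ P V) _ _ (begin
  α * appearances ms Γ (0 ∷ 0 ∷ 1 ∷ []) + β * appearances ms Γ (0 ∷ 1 ∷ 0 ∷ []) + (∑ P H + ∑ P V)
    ≤⟨ ℕ.+-monoˡ-≤ (∑ P H + ∑ P V) (ℕ.+-mono-≤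
         (ℕ.*-monoʳ-≤ α (appearances≤tally m n Γ x xxb 0 0 1 xxb-ok)) (ℕ.*-monoʳ-≤ β (appearances≤tally m n Γ x xbx 0 1 0 xbx-ok))) ⟩
  α * ∑ P (tally xxb ∘ view) + β * ∑ P (tally xbx ∘ view) + (∑ P H + ∑ P V)
    ≡⟨ ≡.cong₂ _+_ (≡.trans (∑-+ P F G) (≡.cong₂ _+_ (∑-* P α (tally xxb ∘ view)) (∑-* P β (tally xbx ∘ view)))) (∑-+ P H V) ⟨
  ∑ P (λ p → F p + G p) + ∑ P (λ p → H p + V p)
    ≡⟨ ∑-+ P (λ p → F p + G p) (λ p → H p + V p) ⟨
  ∑ P (λ p → F p + G p + (H p + V p))
    ≤⟨ ∑-mono P (λ p → checked (view p)) ⟩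
  ∑ P (λ p → γ + (H′ p + V′ p))
    ≡⟨ ≡.trans (∑-+ P (λ _ → γ) (λ p → H′ p + V′ p)) (≡.cong₂ _+_ (∑-allPos-const ms γ) (∑-+ P H′ V′)) ⟩
  size ms * γ + (∑ P H′ + ∑ P V′)
    ≡⟨ ≡.cong₂ _+_ (ℕ.*-comm (size ms) γ) (≡.cong₂ _+_ H-slide V-slide) ⟩
  γ * size ms + (∑ P H + ∑ P V) ∎)
  where
  open ℕ.≤-Reasoning
  P : List (Pos ms)
  P = allPos ms
  x : Pos ms → Bool
  x p = Γ p ≡ᵇ 0
  view : Pos ms → Window
  view p i j = x (cell i j p)
  F G H V H′ V′ : Pos ms → ℕ
  F p = α * tally xxb (view p)
  G p = β * tally xbx (view p)
  H p = potential table (view p)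
  V p = potential table (transpose (view p))
  H′ p = potential table (slide (view p))
  V′ p = potential table (slide (transpose (view p)))
  xxb-ok : ∀ p q r → Γ p ≡ 0 → Γ q ≡ 0 → Γ r ≡ 1 → xxb (x p) (x q) (x r) ≡ true
  xxb-ok p q r eq₁ eq₂ eq₃ rewrite eq₁ | eq₂ | eq₃ = ≡.refl
  xbx-ok : ∀ p q r → Γ p ≡ 0 → Γ q ≡ 1 → Γ r ≡ 0 → xbx (x p) (x q) (x r) ≡ true
  xbx-ok p q r eq₁ eq₂ eq₃ rewrite eq₁ | eq₂ | eq₃ = ≡.refl
  -- `tally` and `potential` consult a window only at numerals below 3, where `window` of the nine
  -- values of `y` computes to `y`; so the finite check applies to arbitrary functions `y`.
  checked : ∀ y → α * tally xxb y + β * tally xbx y + (potential table y + potential table (transpose y))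
                ≤ γ + (potential table (slide y) + potential table (slide (transpose y)))
  checked y = ℕ.≤ᵇ⇒≤ _ _ (≡.subst T (≡.sym (everywhere-sound 9 (inequality α β γ table ∘ window) ok
    (y 0 0 ∷ y 0 1 ∷ y 0 2 ∷ y 1 0 ∷ y 1 1 ∷ y 1 2 ∷ y 2 0 ∷ y 2 1 ∷ y 2 2 ∷ []))) tt)
  slideʰ : ∀ a b (p : Pos ms) → cell a (suc b) p ≡ cell a b (p ⊕ (0 ∷ 1 ∷ []))
  slideʰ a b (i , j , tt) = ≡.cong₂ (λ i j → i , j , tt) (≡.sym (advance-+ i 0 a)) (≡.sym (advance-+ j 1 b))
  slideᵛ : ∀ a b (p : Pos ms) → cell (suc a) b p ≡ cell a b (p ⊕ (1 ∷ 0 ∷ []))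
  slideᵛ a b (i , j , tt) = ≡.cong₂ (λ i j → i , j , tt) (≡.sym (advance-+ i 1 a)) (≡.sym (advance-+ j 0 b))
  potential-cong : ∀ {y z} → (∀ i j → y i j ≡ z i j) → potential table y ≡ potential table z
  potential-cong eq rewrite eq 0 0 | eq 0 1 | eq 1 0 | eq 1 1 | eq 2 0 | eq 2 1 = ≡.refl
  H-slide : ∑ P H′ ≡ ∑ P H
  H-slide = ≡.trans (∑-cong P (λ p → potential-cong (λ i j → ≡.cong x (slideʰ i j p)))) (∑-⊕ ms H (0 ∷ 1 ∷ []))
  V-slide : ∑ P V′ ≡ ∑ P V
  V-slide = ≡.trans (∑-cong P (λ p → potential-cong (λ i j → ≡.cong x (slideᵛ j i p)))) (∑-⊕ ms V (1 ∷ 0 ∷ []))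

-- The two potentials are optimal dual solutions of linear programs over 3 × 3 windows.
001-bound : ∀ (ms : Vec ℕ 2) Γ → appearances ms Γ (0 ∷ 0 ∷ 1 ∷ []) ≤ 2 * size ms
001-bound ms Γ = ℕ.*-cancelˡ-≤ 4 (begin
  4 * appearances ms Γ (0 ∷ 0 ∷ 1 ∷ [])       ≡⟨ ℕ.+-identityʳ _ ⟨
  4 * appearances ms Γ (0 ∷ 0 ∷ 1 ∷ []) + 0   ≤⟨ window-bound 4 0 8 table ≡.refl ms Γ ⟩
  8 * size ms                                 ≡⟨ ℕ.*-assoc 4 2 (size ms) ⟩
  4 * (2 * size ms)                           ∎)
  where
  open ℕ.≤-Reasoning
  table : List ℕ
  table =
    4 ∷ 4 ∷ 4 ∷ 4 ∷ 0 ∷ 0 ∷ 1 ∷ 1 ∷ 8 ∷ 7 ∷ 8 ∷ 7 ∷ 4 ∷ 1 ∷ 7 ∷ 4 ∷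
    4 ∷ 4 ∷ 4 ∷ 4 ∷ 0 ∷ 0 ∷ 1 ∷ 1 ∷ 7 ∷ 6 ∷ 7 ∷ 6 ∷ 1 ∷ 2 ∷ 4 ∷ 5 ∷
    4 ∷ 4 ∷ 4 ∷ 4 ∷ 1 ∷ 1 ∷ 2 ∷ 2 ∷ 8 ∷ 7 ∷ 8 ∷ 7 ∷ 7 ∷ 4 ∷ 6 ∷ 3 ∷
    4 ∷ 4 ∷ 4 ∷ 4 ∷ 1 ∷ 1 ∷ 2 ∷ 2 ∷ 7 ∷ 6 ∷ 7 ∷ 6 ∷ 4 ∷ 5 ∷ 3 ∷ 4 ∷ []

-- The weights 1 and 2 are those with which XXB and XBX enter the estimate for AABC. The potentials
-- are quarters, hence the scaling by 4.
001-010-bound : ∀ (ms : Vec ℕ 2) Γ →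
  appearances ms Γ (0 ∷ 0 ∷ 1 ∷ []) + 2 * appearances ms Γ (0 ∷ 1 ∷ 0 ∷ []) ≤ 6 * size ms
001-010-bound ms Γ = ℕ.*-cancelˡ-≤ 4 (begin
  4 * (appearances ms Γ (0 ∷ 0 ∷ 1 ∷ []) + 2 * appearances ms Γ (0 ∷ 1 ∷ 0 ∷ []))
    ≡⟨ expand (appearances ms Γ (0 ∷ 0 ∷ 1 ∷ [])) (appearances ms Γ (0 ∷ 1 ∷ 0 ∷ [])) ⟩
  4 * appearances ms Γ (0 ∷ 0 ∷ 1 ∷ []) + 8 * appearances ms Γ (0 ∷ 1 ∷ 0 ∷ [])
    ≤⟨ window-bound 4 8 24 table ≡.refl ms Γ ⟩
  24 * size ms
    ≡⟨ ℕ.*-assoc 4 6 (size ms) ⟩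
  4 * (6 * size ms) ∎)
  where
  open ℕ.≤-Reasoning
  expand : ∀ x y → 4 * (x + 2 * y) ≡ 4 * x + 8 * y
  expand = solve-∀
  table : List ℕ
  table =
    12 ∷ 14 ∷ 10 ∷ 12 ∷ 10 ∷ 16 ∷ 9 ∷ 15 ∷ 14 ∷ 15 ∷ 8 ∷ 9 ∷ 12 ∷ 15 ∷ 9 ∷ 12 ∷
    14 ∷ 14 ∷ 12 ∷ 12 ∷ 16 ∷ 24 ∷ 11 ∷ 19 ∷ 15 ∷ 8 ∷ 13 ∷ 6 ∷ 15 ∷ 14 ∷ 12 ∷ 11 ∷
    10 ∷ 12 ∷ 10 ∷ 12 ∷ 9 ∷ 11 ∷ 16 ∷ 18 ∷ 8 ∷ 13 ∷ 0 ∷ 5 ∷ 9 ∷ 12 ∷ 10 ∷ 13 ∷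
    12 ∷ 12 ∷ 12 ∷ 12 ∷ 15 ∷ 19 ∷ 18 ∷ 22 ∷ 9 ∷ 6 ∷ 5 ∷ 2 ∷ 12 ∷ 11 ∷ 13 ∷ 12 ∷ []

-- Planar bounds for words of three and four letters.

appearances-prefix : ∀ {d} (ms : Vec ℕ d) Γ w z → appearances ms Γ (w ++ z) ≤ appearances ms Γ w
appearances-prefix ms Γ w z = appearances-mono ms Γ Γ (w ++ z) w λ p v r →
  proj₁ (∧-split {reads (step v) Γ p w} (≡.trans (≡.sym (reads-++ (step v) Γ w z p)) r))

appearances-tail : ∀ {d} (ms : Vec ℕ d) Γ a w → appearances ms Γ (a ∷ w) ≤ appearances ms Γ w
appearances-tail ms Γ a w = begin
  appearances ms Γ (a ∷ w)              ≡⟨ appearances-reverse ms Γ (a ∷ w) ⟨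
  appearances ms Γ (reverse (a ∷ w))    ≡⟨ ≡.cong (appearances ms Γ) (unfold-reverse a w) ⟩
  appearances ms Γ (reverse w ++ [ a ]) ≤⟨ appearances-prefix ms Γ (reverse w) [ a ] ⟩
  appearances ms Γ (reverse w)          ≡⟨ appearances-reverse ms Γ w ⟩
  appearances ms Γ w                    ∎
  where open ℕ.≤-Reasoning

reads-unique : ∀ {S : Set} (σ : S → S) lab w z s → length w ≡ length z →
               reads σ lab s w ≡ true → reads σ lab s z ≡ true → w ≡ z
reads-unique σ lab []      []      s eq r₁ r₂ = ≡.refl
reads-unique σ lab (a ∷ w) (b ∷ z) s eq r₁ r₂ = ≡.cong₂ _∷_
  (≡.trans (≡.sym (≡ᵇ⇒≡ {lab s} (proj₁ (∧-split {lab s ≡ᵇ a} r₁)))) (≡ᵇ⇒≡ {lab s} (proj₁ (∧-split {lab s ≡ᵇ b} r₂))))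
  (reads-unique σ lab w z (σ s) (ℕ.suc-injective eq) (proj₂ (∧-split {lab s ≡ᵇ a} r₁)) (proj₂ (∧-split {lab s ≡ᵇ b} r₂)))

-- If f turns w into a palindrome, both readings of an appearance of w become appearances of f w.
appearances-palindrome : ∀ {d} (ms : Vec ℕ d) Γ (f : ℕ → ℕ) w → map f w ≡ map f (reverse w) → w ≢ reverse w →
                         2 * appearances ms Γ w ≤ appearances ms (f ∘ Γ) (map f w)
appearances-palindrome {d} ms Γ f w pal w≢ = begin
  2 * appearances ms Γ w
    ≡⟨ ≡.cong (_+_ (appearances ms Γ w)) (≡.trans (ℕ.+-identityʳ _) (≡.sym (appearances-reverse ms Γ w))) ⟩
  appearances ms Γ w + appearances ms Γ (reverse w)
    ≡⟨ ≡.cong₂ _+_ (appearances≡ ms Γ w) (appearances≡ ms Γ (reverse w)) ⟩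
  ∑∑ (hit Γ w) + ∑∑ (hit Γ (reverse w))
    ≡⟨ ≡.trans (∑-cong (allPos ms) (λ p → ∑-+ (allDirs d) _ _)) (∑-+ (allPos ms) _ _) ⟨
  ∑∑ (λ p v → hit Γ w p v + hit Γ (reverse w) p v)
    ≤⟨ ∑-mono (allPos ms) (λ p → ∑-mono (allDirs d) (λ v → either (nonzero v) _ _ _
         (reads-map (step v) Γ f w p)
         (λ r → ≡.subst (λ u → reads (step v) (f ∘ Γ) p u ≡ true) (≡.sym pal) (reads-map (step v) Γ f (reverse w) p r))
         (λ r₁ r₂ → w≢ (reads-unique (step v) Γ w (reverse w) p (≡.sym (length-reverse w)) r₁ r₂)))) ⟩
  ∑∑ (hit (f ∘ Γ) (map f w))
    ≡⟨ appearances≡ ms (f ∘ Γ) (map f w) ⟨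
  appearances ms (f ∘ Γ) (map f w) ∎
  where
  open ℕ.≤-Reasoning
  ∑∑ : (Pos ms → Vec Sign d → ℕ) → ℕ
  ∑∑ F = ∑ (allPos ms) (λ p → ∑ (allDirs d) (F p))
  hit : (Pos ms → ℕ) → Word → Pos ms → Vec Sign d → ℕ
  hit Γ w p v = ⟦ nonzero v ∧ reads (step v) Γ p w ⟧
  either : ∀ a b c e → (b ≡ true → e ≡ true) → (c ≡ true → e ≡ true) → (b ≡ true → c ≡ true → ⊥) →
           ⟦ a ∧ b ⟧ + ⟦ a ∧ c ⟧ ≤ ⟦ a ∧ e ⟧
  either false b     c     e h₁ h₂ h₃ = z≤n
  either true  true  true  e h₁ h₂ h₃ = ⊥-elim (h₃ ≡.refl ≡.refl)
  either true  true  false e h₁ h₂ h₃ rewrite h₁ ≡.refl = s≤s z≤n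
  either true  false c     e h₁ h₂ h₃ = ⟦⟧-mono h₂

mark : ℕ → ℕ → ℕ
mark b x = if x ≡ᵇ b then 1 else 0

mark-≡ : ∀ b → mark b b ≡ 1
mark-≡ b rewrite ≡⇒≡ᵇ {b} ≡.refl = ≡.refl

mark-≢ : ∀ {a b} → a ≢ b → mark b a ≡ 0
mark-≢ {a} {b} a≢b rewrite ≢⇒≡ᵇ {a} {b} a≢b = ≡.refl

module _ (ms : Vec ℕ 2) (Γ : Pos ms → ℕ) where

  AAB-bound : ∀ {a b} → a ≢ b → appearances ms Γ (a ∷ a ∷ b ∷ []) ≤ 2 * size ms
  AAB-bound {a} {b} a≢b = ℕ.≤-trans (appearances-map ms Γ (mark b) (a ∷ a ∷ b ∷ []))
    (≡.subst (λ w → appearances ms (mark b ∘ Γ) w ≤ 2 * size ms) (≡.sym marked) (001-bound ms (mark b ∘ Γ)))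
    where
    marked : map (mark b) (a ∷ a ∷ b ∷ []) ≡ 0 ∷ 0 ∷ 1 ∷ []
    marked rewrite mark-≡ b | mark-≢ a≢b = ≡.refl

  ABBA-bound : ∀ {a b} → a ≢ b → appearances ms Γ (a ∷ b ∷ b ∷ a ∷ []) ≤ 2 * size ms
  ABBA-bound {a} {b} a≢b = begin
    appearances ms Γ (a ∷ b ∷ b ∷ a ∷ [])    ≤⟨ appearances-prefix ms Γ (a ∷ b ∷ b ∷ []) [ a ] ⟩
    appearances ms Γ (a ∷ b ∷ b ∷ [])        ≡⟨ appearances-reverse ms Γ (b ∷ b ∷ a ∷ []) ⟩
    appearances ms Γ (b ∷ b ∷ a ∷ [])        ≤⟨ AAB-bound (a≢b ∘ ≡.sym) ⟩
    2 * size ms                              ∎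
    where open ℕ.≤-Reasoning

  ABC-bound : ∀ {a b c} → a ≢ b → c ≢ b → a ≢ c →
              2 * appearances ms Γ (a ∷ b ∷ c ∷ []) ≤ appearances ms (mark b ∘ Γ) (0 ∷ 1 ∷ 0 ∷ [])
  ABC-bound {a} {b} {c} a≢b c≢b a≢c = ≡.subst (λ w → 2 * appearances ms Γ (a ∷ b ∷ c ∷ []) ≤ appearances ms (mark b ∘ Γ) w)
    (marked a≢b c≢b)
    (appearances-palindrome ms Γ (mark b) (a ∷ b ∷ c ∷ []) (≡.trans (marked a≢b c≢b) (≡.sym (marked c≢b a≢b))) (a≢c ∘ ∷-injectiveˡ))
    where
    marked : ∀ {a c} → a ≢ b → c ≢ b → map (mark b) (a ∷ b ∷ c ∷ []) ≡ 0 ∷ 1 ∷ 0 ∷ []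
    marked a≢b c≢b rewrite mark-≡ b | mark-≢ a≢b | mark-≢ c≢b = ≡.refl

  -- An appearance of AABC contains one of XXB, and its tail ABC yields two of the palindrome XBX.
  -- With the weights 1 and 2 this makes 1 + 2 · 2 = 5, matching the line concentration 2 / 5.
  AABC-bound : ∀ {a b c} → a ≢ b → c ≢ b → a ≢ c → 5 * appearances ms Γ (a ∷ a ∷ b ∷ c ∷ []) ≤ 6 * size ms
  AABC-bound {a} {b} {c} a≢b c≢b a≢c = begin
    5 * appearances ms Γ w
      ≡⟨ split (appearances ms Γ w) ⟩
    appearances ms Γ w + 2 * (2 * appearances ms Γ w)
      ≤⟨ ℕ.+-mono-≤ (ℕ.≤-trans (appearances-prefix ms Γ (a ∷ a ∷ b ∷ []) [ c ]) (appearances-map ms Γ (mark b) (a ∷ a ∷ b ∷ [])))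
           (ℕ.*-monoʳ-≤ 2 (ℕ.≤-trans (ℕ.*-monoʳ-≤ 2 (appearances-tail ms Γ a (a ∷ b ∷ c ∷ []))) (ABC-bound a≢b c≢b a≢c))) ⟩
    appearances ms (mark b ∘ Γ) (map (mark b) (a ∷ a ∷ b ∷ [])) + 2 * appearances ms (mark b ∘ Γ) (0 ∷ 1 ∷ 0 ∷ [])
      ≡⟨ ≡.cong (λ u → appearances ms (mark b ∘ Γ) u + 2 * appearances ms (mark b ∘ Γ) (0 ∷ 1 ∷ 0 ∷ [])) marked ⟩
    appearances ms (mark b ∘ Γ) (0 ∷ 0 ∷ 1 ∷ []) + 2 * appearances ms (mark b ∘ Γ) (0 ∷ 1 ∷ 0 ∷ [])
      ≤⟨ 001-010-bound ms (mark b ∘ Γ) ⟩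
    6 * size ms ∎
    where
    open ℕ.≤-Reasoning
    w : Word
    w = a ∷ a ∷ b ∷ c ∷ []
    split : ∀ x → 5 * x ≡ x + 2 * (2 * x)
    split = solve-∀
    marked : map (mark b) (a ∷ a ∷ b ∷ []) ≡ 0 ∷ 0 ∷ 1 ∷ []
    marked rewrite mark-≡ b | mark-≢ a≢b = ≡.refl

module _ (ms : Vec ℕ 2) (Γ : Pos ms → ℕ) where

  -- Merging A and C produces the palindrome XBBX, which doubles the count and is itself bounded as
  -- an ABBA.
  ABBC-bound : ∀ {a b c} → a ≢ b → c ≢ b → a ≢ c → 2 * appearances ms Γ (a ∷ b ∷ b ∷ c ∷ []) ≤ 2 * size ms
  ABBC-bound {a} {b} {c} a≢b c≢b a≢c = ℕ.≤-trans
    (appearances-palindrome ms Γ (mark b) (a ∷ b ∷ b ∷ c ∷ []) (≡.trans (marked a≢b c≢b) (≡.sym (marked c≢b a≢b))) (a≢c ∘ ∷-injectiveˡ))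
    (≡.subst (λ w → appearances ms (mark b ∘ Γ) w ≤ 2 * size ms) (≡.sym (marked a≢b c≢b)) (ABBA-bound ms (mark b ∘ Γ) λ ()))
    where
    marked : ∀ {a c} → a ≢ b → c ≢ b → map (mark b) (a ∷ b ∷ b ∷ c ∷ []) ≡ 0 ∷ 1 ∷ 1 ∷ 0 ∷ []
    marked a≢b c≢b rewrite mark-≡ b | mark-≢ a≢b | mark-≢ c≢b = ≡.refl

  -- Here B and C are merged, giving the palindrome AXXA.
  ABCA-bound : ∀ {a b c} → b ≢ a → c ≢ a → b ≢ c → 2 * appearances ms Γ (a ∷ b ∷ c ∷ a ∷ []) ≤ 2 * size ms
  ABCA-bound {a} {b} {c} b≢a c≢a b≢c = ℕ.≤-trans
    (appearances-palindrome ms Γ (mark a) (a ∷ b ∷ c ∷ a ∷ []) (≡.trans (marked b≢a c≢a) (≡.sym (marked c≢a b≢a)))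
      (b≢c ∘ ∷-injectiveˡ ∘ ∷-injectiveʳ))
    (≡.subst (λ w → appearances ms (mark a ∘ Γ) w ≤ 2 * size ms) (≡.sym (marked b≢a c≢a)) (ABBA-bound ms (mark a ∘ Γ) λ ()))
    where
    marked : ∀ {b c} → b ≢ a → c ≢ a → map (mark a) (a ∷ b ∷ c ∷ a ∷ []) ≡ 1 ∷ 0 ∷ 0 ∷ 1 ∷ []
    marked b≢a c≢a rewrite mark-≡ a | mark-≢ b≢a | mark-≢ c≢a = ≡.refl

cyclic : ∀ {m} → Vec ℕ (suc m) → Pos (m ∷ []) → ℕ
cyclic u (i , _) = Vec.lookup u i

-- The cyclic word u has two appearances of w in suc m cells, so C_1(f w) ≥ 2 / (suc m).
Stackable≤-2D : ∀ {m} (f : ℕ → ℕ) w (u : Vec ℕ (suc m)) → appearances (m ∷ []) (cyclic u) w ≡ 2 →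
  (∀ (ms : Vec ℕ 2) Γ → suc m * appearances ms Γ (map f w) ≤ 6 * size ms) → Stackable≤ 2 (map f w)
Stackable≤-2D {m} f w u two bound A B bd ms Γ = ℕ.*-cancelˡ-≤ (suc m) (begin
  suc m * (appearances ms Γ (map f w) * B)   ≡⟨ ℕ.*-assoc (suc m) (appearances ms Γ (map f w)) B ⟨
  suc m * appearances ms Γ (map f w) * B     ≤⟨ ℕ.*-monoˡ-≤ B (bound ms Γ) ⟩
  6 * size ms * B                            ≡⟨ regroup (size ms) B ⟩
  3 * size ms * (2 * B)                      ≤⟨ ℕ.*-monoʳ-≤ (3 * size ms) line ⟩
  3 * size ms * (A * (suc m * 1))            ≡⟨ regroup′ (size ms) A (suc m) ⟩
  suc m * (3 ^ 1 * A * size ms)              ∎)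
  where
  open ℕ.≤-Reasoning
  regroup : ∀ n b → 6 * n * b ≡ 3 * n * (2 * b)
  regroup = solve-∀
  regroup′ : ∀ n a k → 3 * n * (a * (k * 1)) ≡ k * (3 * a * n)
  regroup′ = solve-∀
  line : 2 * B ≤ A * (suc m * 1)
  line = ℕ.≤-trans (ℕ.*-monoˡ-≤ B (ℕ.≤-trans (ℕ.≤-reflexive (≡.sym two)) (appearances-map (m ∷ []) (cyclic u) f w)))
                   (bd (m ∷ []) (f ∘ cyclic u))

letters : ℕ → ℕ → ℕ → ℕ → ℕ
letters a b c 0 = a
letters a b c 1 = b
letters a b c _ = c

3*-bound : ∀ x n → x ≤ 2 * n → 3 * x ≤ 6 * n
3*-bound x n le = ℕ.≤-trans (ℕ.*-monoʳ-≤ 3 le) (ℕ.≤-reflexive (≡.sym (ℕ.*-assoc 3 2 n)))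

6*-bound : ∀ x n → 2 * x ≤ 2 * n → 6 * x ≤ 6 * n
6*-bound x n le = ℕ.*-monoʳ-≤ 6 x≤n
  where
  x≤n : x ≤ n
  x≤n = ℕ.*-cancelˡ-≤ 2 le

AAB-stackable : ∀ {a b} → a ≢ b → Stackable≤ 2 (a ∷ a ∷ b ∷ [])
AAB-stackable {a} {b} a≢b = Stackable≤-2D (letters a b b) (0 ∷ 0 ∷ 1 ∷ []) (0 ∷ 0 ∷ 1 ∷ []) ≡.refl
  (λ ms Γ → 3*-bound (appearances ms Γ (a ∷ a ∷ b ∷ [])) (size ms) (AAB-bound ms Γ a≢b))

-- On the cycle AAB the last A of the word is its first one again, so three cells carry an
-- appearance in each direction. ABBA closes up on ABB likewise.
AABA-stackable : ∀ {a b} → a ≢ b → Stackable≤ 2 (a ∷ a ∷ b ∷ a ∷ [])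
AABA-stackable {a} {b} a≢b = Stackable≤-2D (letters a b b) (0 ∷ 0 ∷ 1 ∷ 0 ∷ []) (0 ∷ 0 ∷ 1 ∷ []) ≡.refl
  (λ ms Γ → 3*-bound (appearances ms Γ (a ∷ a ∷ b ∷ a ∷ [])) (size ms) (ℕ.≤-trans (appearances-prefix ms Γ (a ∷ a ∷ b ∷ []) [ a ]) (AAB-bound ms Γ a≢b)))

ABBA-stackable : ∀ {a b} → a ≢ b → Stackable≤ 2 (a ∷ b ∷ b ∷ a ∷ [])
ABBA-stackable {a} {b} a≢b = Stackable≤-2D (letters a b b) (0 ∷ 1 ∷ 1 ∷ 0 ∷ []) (0 ∷ 1 ∷ 1 ∷ []) ≡.refl
  (λ ms Γ → 3*-bound (appearances ms Γ (a ∷ b ∷ b ∷ a ∷ [])) (size ms) (ABBA-bound ms Γ a≢b))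

-- The cycle AABCB is symmetric about C and thus reads AABC both ways. The cycles used for ABBC and
-- ABCA are likewise symmetric, with six cells.
AABC-stackable : ∀ {a b c} → a ≢ b → c ≢ b → a ≢ c → Stackable≤ 2 (a ∷ a ∷ b ∷ c ∷ [])
AABC-stackable {a} {b} {c} a≢b c≢b a≢c = Stackable≤-2D (letters a b c) (0 ∷ 0 ∷ 1 ∷ 2 ∷ []) (0 ∷ 0 ∷ 1 ∷ 2 ∷ 1 ∷ []) ≡.refl
  (λ ms Γ → AABC-bound ms Γ a≢b c≢b a≢c)

ABBC-stackable : ∀ {a b c} → a ≢ b → c ≢ b → a ≢ c → Stackable≤ 2 (a ∷ b ∷ b ∷ c ∷ [])
ABBC-stackable {a} {b} {c} a≢b c≢b a≢c = Stackable≤-2D (letters a b c) (0 ∷ 1 ∷ 1 ∷ 2 ∷ []) (0 ∷ 1 ∷ 1 ∷ 2 ∷ 1 ∷ 1 ∷ []) ≡.refl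
  (λ ms Γ → 6*-bound (appearances ms Γ (a ∷ b ∷ b ∷ c ∷ [])) (size ms) (ABBC-bound ms Γ a≢b c≢b a≢c))

ABCA-stackable : ∀ {a b c} → b ≢ a → c ≢ a → b ≢ c → Stackable≤ 2 (a ∷ b ∷ c ∷ a ∷ [])
ABCA-stackable {a} {b} {c} b≢a c≢a b≢c = Stackable≤-2D (letters a b c) (0 ∷ 1 ∷ 2 ∷ 0 ∷ []) (0 ∷ 1 ∷ 2 ∷ 0 ∷ 2 ∷ 1 ∷ []) ≡.refl
  (λ ms Γ → 6*-bound (appearances ms Γ (a ∷ b ∷ c ∷ a ∷ [])) (size ms) (ABCA-bound ms Γ b≢a c≢a b≢c))

Stackable≤-reverse : ∀ d w → Stackable≤ d w → Stackable≤ d (reverse w)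
Stackable≤-reverse d w st A B bd ms Γ = ≡.subst (λ n → n * B ≤ 3 ^ (d ∸ 1) * A * size ms) (≡.sym (appearances-reverse ms Γ w))
  (st A B (λ ms Γ → ≡.subst (λ n → n * B ≤ A * size ms) (appearances-reverse ms Γ w) (bd ms Γ)) ms Γ)

-- Classification of the words with at most four characters.

Exceptional : Word → Set
Exceptional w = ∃[ a ] ∃[ b ] (a ≢ b × (w ≡ a ∷ b ∷ b ∷ b ∷ [] ⊎ w ≡ b ∷ b ∷ b ∷ a ∷ []))

¬Stackable-exceptional : ∀ w → Stackable 2 w → ¬ Exceptional w
¬Stackable-exceptional w st (a , b , a≢b , inj₁ ≡.refl) = ¬Stackable-ABℓ 4 a b ℕ.≤-refl a≢b st
¬Stackable-exceptional w st (a , b , a≢b , inj₂ ≡.refl) = ¬Stackable-ABℓ 4 a b ℕ.≤-refl a≢b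
  (Stackable≤⇒Stackable 2 (a ∷ b ∷ b ∷ b ∷ []) (s≤s z≤n) (Stackable≤-reverse 2 w (Stackable⇒Stackable≤ 2 w st)))

stackable₂ : ∀ w → Stackable≤ 2 w → Stackable 2 w
stackable₂ w = Stackable≤⇒Stackable 2 w (s≤s z≤n)

∈-replicate : ∀ n {x a : ℕ} → x ∈ replicate n a → x ≡ a
∈-replicate (suc n) (here eq)  = eq
∈-replicate (suc n) (there x∈) = ∈-replicate n x∈

¬TwoLetters-replicate : ∀ n a → ¬ TwoLetters (replicate n a)
¬TwoLetters-replicate n a (_ , _ , x∈ , y∈ , x≢y) = x≢y (≡.trans (∈-replicate n x∈) (≡.sym (∈-replicate n y∈)))

module _ (a c : ℕ) where

  private
    par : ℕ → Bool
    par x = (x ≡ᵇ a) ∨ (x ≡ᵇ c)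

    par-a : par a ≡ true
    par-a rewrite ≡⇒≡ᵇ {a} ≡.refl = ≡.refl

    par-c : par c ≡ true
    par-c rewrite ≡⇒≡ᵇ {c} ≡.refl = ∨-zeroʳ (c ≡ᵇ a)

    par-other : ∀ {x} → a ≢ x → c ≢ x → par x ≡ false
    par-other {x} a≢x c≢x rewrite ≢⇒≡ᵇ {x} {a} (a≢x ∘ ≡.sym) | ≢⇒≡ᵇ {x} {c} (c≢x ∘ ≡.sym) = ≡.refl

  alternating₃ : ∀ {b} → a ≢ b → c ≢ b → Stackable 2 (a ∷ b ∷ c ∷ [])
  alternating₃ {b} a≢b c≢b = stackable₂ (a ∷ b ∷ c ∷ []) (alternating⇒Stackable≤ 1 par a b (c ∷ [])
    (≡.cong₂ _xor_ par-a (par-other a≢b c≢b) , ≡.cong₂ _xor_ (par-other a≢b c≢b) par-c , tt))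

  alternating₄ : ∀ {b d} → a ≢ b → c ≢ b → c ≢ d → a ≢ d → Stackable 2 (a ∷ b ∷ c ∷ d ∷ [])
  alternating₄ {b} {d} a≢b c≢b c≢d a≢d = stackable₂ (a ∷ b ∷ c ∷ d ∷ []) (alternating⇒Stackable≤ 1 par a b (c ∷ d ∷ [])
    (≡.cong₂ _xor_ par-a (par-other a≢b c≢b) , ≡.cong₂ _xor_ (par-other a≢b c≢b) par-c
    , ≡.cong₂ _xor_ par-c (par-other a≢d c≢d) , tt))

length₂ : ∀ {a b} → a ≢ b → Stackable 2 (a ∷ b ∷ [])
length₂ {a} {b} a≢b = stackable₂ (a ∷ b ∷ []) (alternating⇒Stackable≤ 1 (_≡ᵇ a) a b []
  (≡.cong₂ _xor_ (≡⇒≡ᵇ {a} ≡.refl) (≢⇒≡ᵇ (a≢b ∘ ≡.sym)) , tt))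

length₃ : ∀ a b c → Dec (a ≡ b) → Dec (c ≡ b) → TwoLetters (a ∷ b ∷ c ∷ []) → Stackable 2 (a ∷ b ∷ c ∷ [])
length₃ a _ _ (yes ≡.refl) (yes ≡.refl) two = ⊥-elim (¬TwoLetters-replicate 3 a two)
length₃ a _ c (yes ≡.refl) (no c≢a)     _   = stackable₂ (a ∷ a ∷ c ∷ []) (AAB-stackable (c≢a ∘ ≡.sym))
length₃ a b _ (no a≢b)     (yes ≡.refl) _   =
  stackable₂ (a ∷ b ∷ b ∷ []) (Stackable≤-reverse 2 (b ∷ b ∷ a ∷ []) (AAB-stackable (a≢b ∘ ≡.sym)))
length₃ a b c (no a≢b)     (no c≢b)     _   = alternating₃ a c a≢b c≢b

-- The four equalities decided are those between indices of different parity; if none holds, the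
-- word alternates between two classes. AACC is AC with doubled letters, and the remaining cases
-- are, up to reversal, the words treated above.
length₄ : ∀ a b c d → Dec (a ≡ b) → Dec (c ≡ b) → Dec (c ≡ d) → Dec (a ≡ d) →
          TwoLetters (a ∷ b ∷ c ∷ d ∷ []) → ¬ Exceptional (a ∷ b ∷ c ∷ d ∷ []) → Stackable 2 (a ∷ b ∷ c ∷ d ∷ [])
length₄ a _ _ _ (yes ≡.refl) (yes ≡.refl) (yes ≡.refl) _ two _ = ⊥-elim (¬TwoLetters-replicate 4 a two)
length₄ a _ _ d (yes ≡.refl) (yes ≡.refl) (no a≢d) _ _ ¬exc = ⊥-elim (¬exc (d , a , (a≢d ∘ ≡.sym) , inj₂ ≡.refl))
length₄ a _ c _ (yes ≡.refl) (no c≢a) (yes ≡.refl) _ _ _ =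
  stretch-Stackable (a ∷ c ∷ []) 2 2 (a , c , here ≡.refl , there (here ≡.refl) , (c≢a ∘ ≡.sym)) (s≤s z≤n) (s≤s z≤n) (length₂ (c≢a ∘ ≡.sym))
length₄ a _ c _ (yes ≡.refl) (no c≢a) (no c≢d) (yes ≡.refl) _ _ =
  stackable₂ (a ∷ a ∷ c ∷ a ∷ []) (AABA-stackable (c≢a ∘ ≡.sym))
length₄ a _ c d (yes ≡.refl) (no c≢a) (no c≢d) (no a≢d) _ _ =
  stackable₂ (a ∷ a ∷ c ∷ d ∷ []) (AABC-stackable (c≢a ∘ ≡.sym) (c≢d ∘ ≡.sym) a≢d)
length₄ a b _ _ (no a≢b) (yes ≡.refl) (yes ≡.refl) _ _ ¬exc = ⊥-elim (¬exc (a , b , a≢b , inj₁ ≡.refl))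
length₄ a b _ _ (no a≢b) (yes ≡.refl) (no b≢d) (yes ≡.refl) _ _ = stackable₂ (a ∷ b ∷ b ∷ a ∷ []) (ABBA-stackable a≢b)
length₄ a b _ d (no a≢b) (yes ≡.refl) (no b≢d) (no a≢d) _ _ =
  stackable₂ (a ∷ b ∷ b ∷ d ∷ []) (ABBC-stackable a≢b (b≢d ∘ ≡.sym) a≢d)
length₄ a b _ _ (no a≢b) (no c≢b) (yes ≡.refl) (yes ≡.refl) _ _ =
  stackable₂ (a ∷ b ∷ a ∷ a ∷ []) (Stackable≤-reverse 2 (a ∷ a ∷ b ∷ a ∷ []) (AABA-stackable a≢b))
length₄ a b c _ (no a≢b) (no c≢b) (yes ≡.refl) (no a≢c) _ _ =
  stackable₂ (a ∷ b ∷ c ∷ c ∷ []) (Stackable≤-reverse 2 (c ∷ c ∷ b ∷ a ∷ []) (AABC-stackable c≢b a≢b (a≢c ∘ ≡.sym)))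
length₄ a b c _ (no a≢b) (no c≢b) (no c≢a) (yes ≡.refl) _ _ =
  stackable₂ (a ∷ b ∷ c ∷ a ∷ []) (ABCA-stackable (a≢b ∘ ≡.sym) c≢a (c≢b ∘ ≡.sym))
length₄ a b c d (no a≢b) (no c≢b) (no c≢d) (no a≢d) _ _ = alternating₄ a c a≢b c≢b c≢d a≢d

length≤4⇒Stackable : ∀ w → TwoLetters w → length w ≤ 4 → ¬ Exceptional w → Stackable 2 w
length≤4⇒Stackable []                        two _ _ = ⊥-elim (¬TwoLetters-replicate 0 0 two)
length≤4⇒Stackable (a ∷ [])                  two _ _ = ⊥-elim (¬TwoLetters-replicate 1 a two)
length≤4⇒Stackable (a ∷ b ∷ []) (_ , _ , here ≡.refl , here ≡.refl , ≢) _ _ = ⊥-elim (≢ ≡.refl)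
length≤4⇒Stackable (a ∷ b ∷ []) (_ , _ , here ≡.refl , there (here ≡.refl) , a≢b) _ _ = length₂ a≢b
length≤4⇒Stackable (a ∷ b ∷ []) (_ , _ , there (here ≡.refl) , here ≡.refl , b≢a) _ _ = length₂ (b≢a ∘ ≡.sym)
length≤4⇒Stackable (a ∷ b ∷ []) (_ , _ , there (here ≡.refl) , there (here ≡.refl) , ≢) _ _ = ⊥-elim (≢ ≡.refl)
length≤4⇒Stackable (a ∷ b ∷ c ∷ [])          two _ _ = length₃ a b c (a ℕ.≟ b) (c ℕ.≟ b) two
length≤4⇒Stackable (a ∷ b ∷ c ∷ d ∷ [])      two _ ¬exc =
  length₄ a b c d (a ℕ.≟ b) (c ℕ.≟ b) (c ℕ.≟ d) (a ℕ.≟ d) two ¬exc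
length≤4⇒Stackable (_ ∷ _ ∷ _ ∷ _ ∷ _ ∷ _) _ (s≤s (s≤s (s≤s (s≤s ())))) _

length≤4-Stackable : ∀ (w : Word) → TwoLetters w → length w ≤ 4 → (Stackable 2 w ⇔ (¬ Exceptional w))
length≤4-Stackable w two len = mk⇔ (¬Stackable-exceptional w) (length≤4⇒Stackable w two len)

theorem1p4 : (∀ (w : Word) → TwoLetters w
    → (∀ (i j : Fin (length w)) → lookup w i ≡ lookup w j → toℕ i % 2 ≡ toℕ j % 2)
    → ∀ (d : ℕ) → 1 ≤ d → Stackable d w)
    × (∀ (w : Word) (d k : ℕ) → TwoLetters w → 1 ≤ d → 1 ≤ k
    → Stackable d w → Stackable d (stretch k w))
    × (∀ (w : Word) → TwoLetters w → length w ≤ 4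
    → (Stackable 2 w ⇔ (¬ (∃[ a ] ∃[ b ] (a ≢ b × (w ≡ a ∷ b ∷ b ∷ b ∷ [] ⊎ w ≡ b ∷ b ∷ b ∷ a ∷ []))))))
    × (∀ (ℓ a b : ℕ) → 3 < ℓ → a ≢ b → ¬ Stackable 2 (a ∷ replicate (ℓ ∸ 1) b))
theorem1p4 = separated⇒Stackable , stretch-Stackable , length≤4-Stackable , ¬Stackable-ABℓ
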